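{- Let $p\geq 5$ be an odd prime and let $G\leq \mathrm{Sym}(\Omega)$ be a transitive group with $|\Omega|=3p$. Let $1\neq N\trianglelefteq G$ be an intransitive normal subgroup, let $\mathcal{B}$ be the $G$-invariant partition of $\Omega$ consisting of the orbits of $N$, and let $\overline{G}$ be the permutation group induced by the action of $G$ on $\mathcal{B}$. Then: (1) if $\overline{G}$ is solvable, then $\rho(G)\in\{1,\tfrac32,3\}$; (2) if $\overline{G}$ is $2$-transitive, then either $\rho(G)\in\{1,\tfrac32,3\}$, or $p=q+1$ is a Fermat prime (for some prime power $q$) and $\overline{G}$ is an almost simple group containing (a subgroup isomorphic to) $\mathrm{PSL}(2,q)$. In particular, if $p\geq 5$ is not a Fermat prime, then $\mathcal{NQ}_{3p}\subseteq\{1,\tfrac32,3\}$.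
   Context: For a transitive group $G\leq\mathrm{Sym}(\Omega)$, a subset $\mathcal{F}\subseteq G$ is intersecting if for all $g,h\in\mathcal{F}$ there is $\omega\in\Omega$ with $\omega^g=\omega^h$. The intersection density is $\rho(G)=\max\{|\mathcal{F}|:\mathcal{F}\subseteq G\text{ intersecting}\}/|G_\omega|$, where $G_\omega$ is a point stabilizer. $G$ is imprimitive if it preserves a partition of $\Omega$ other than $\{\Omega\}$ and the partition into singletons; $G$ is quasiprimitive if every non-trivial normal subgroup of $G$ is transitive. $\mathcal{NQ}_{n}$ denotes the set of values $\rho(G)$ where $G$ ranges over the transitive groups of degree $n$ that are imprimitive and not quasiprimitive. A Fermat prime is a prime of the form $2^{2^k}+1$. -}

module Defs where

open import Level using (0ℓ)
open import Data.Nat using (ℕ; _≤_)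
import Data.Nat as ℕ
open import Data.Nat.Primality using (Prime)
open import Data.Fin using (Fin) renaming (_≟_ to _≟ᶠ_)
open import Data.Vec using (Vec; lookup; tabulate)
open import Data.List using (List; length; filter)
open import Data.List.Membership.Propositional using (_∈_)
open import Data.List.Relation.Unary.Unique.Propositional using (Unique)
open import Data.List.Relation.Unary.Any using (Any)
open import Data.List.Relation.Unary.AllPairs using (AllPairs)
open import Data.List.Relation.Binary.Sublist.Propositional using (_⊆_)
open import Data.Product using (Σ; ∃; ∃-syntax; _×_; _,_)
open import Data.Sum using (_⊎_)
open import Relation.Nullary using (¬_)
open import Relation.Binary.PropositionalEquality using (_≡_; _≢_)
open import Algebra.Bundles using (CommutativeRing)

-- Permutations of Ω = Fin n, written as vectors: σ sends i to lookup σ i.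
-- Right action convention: ω^(g·h) = (ω^g)^h.

Perm : ℕ → Set
Perm n = Vec (Fin n) n

IsPerm : ∀ {n} → Perm n → Set
IsPerm {n} σ = ∀ (i j : Fin n) → lookup σ i ≡ lookup σ j → i ≡ j

_·_ : ∀ {n} → Perm n → Perm n → Perm n
g · h = tabulate (λ i → lookup h (lookup g i))

idP : (n : ℕ) → Perm n
idP n = tabulate (λ i → i)

-- A permutation group G ≤ Sym(Fin n): a finite duplicate-free list of
-- permutations containing the identity and closed under composition
-- (for a finite set of permutations this is exactly a subgroup).
record PermGroup (n : ℕ) : Set where
  field
    elems  : List (Perm n)
    unique : Unique elems
    perms  : ∀ {g} → g ∈ elems → IsPerm g
    hasId  : idP n ∈ elems
    closed : ∀ {g h} → g ∈ elems → h ∈ elems → (g · h) ∈ elems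
open PermGroup public

_∈G_ : ∀ {n} → Perm n → PermGroup n → Set
g ∈G G = g ∈ elems G

Transitive : ∀ {n} → PermGroup n → Set
Transitive {n} G = ∀ (α β : Fin n) → ∃[ g ] (g ∈G G × lookup g α ≡ β)

_≤G_ : ∀ {n} → PermGroup n → PermGroup n → Set
H ≤G G = ∀ {x} → x ∈G H → x ∈G G

-- H ⊴ G : H ≤ G and g⁻¹ x g ∈ H for x ∈ H, g ∈ G (written x g = g y).
Normal : ∀ {n} → PermGroup n → PermGroup n → Set
Normal H G = H ≤G G × (∀ {g x} → g ∈G G → x ∈G H → ∃[ y ] (y ∈G H × (x · g) ≡ (g · y)))

Trivial : ∀ {n} → PermGroup n → Set
Trivial {n} H = ∀ {x} → x ∈G H → x ≡ idP n

Intersecting : ∀ {n} → List (Perm n) → Set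
Intersecting {n} F = ∀ {g h} → g ∈ F → h ∈ F → ∃[ ω ] (lookup g ω ≡ lookup h ω)

stabSize : ∀ {n} → PermGroup n → Fin n → ℕ
stabSize G ω = length (filter (λ g → lookup g ω ≟ᶠ ω) (elems G))

MaxIntersectingSize : ∀ {n} → PermGroup n → ℕ → Set
MaxIntersectingSize {n} G k =
  (∃[ F ] (F ⊆ elems G × Intersecting F × length F ≡ k)) ×
  (∀ (F : List (Perm n)) → F ⊆ elems G → Intersecting F → length F ≤ k)

-- ρ(G) = a / b   (for transitive G all |G_ω| agree)
DensityIs : ∀ {n} → PermGroup n → ℕ → ℕ → Set
DensityIs {n} G a b = ∃[ k ] (MaxIntersectingSize G k × (∀ (ω : Fin n) → k ℕ.* b ≡ a ℕ.* stabSize G ω))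

RhoIn1-3/2-3 : ∀ {n} → PermGroup n → Set
RhoIn1-3/2-3 G = DensityIs G 1 1 ⊎ DensityIs G 3 2 ⊎ DensityIs G 3 1

OrbitLabeling : ∀ {n m} → PermGroup n → (Fin n → Fin m) → Set
OrbitLabeling {n} {m} N β =
  (∀ (α α' : Fin n) → β α ≡ β α' → ∃[ x ] (x ∈G N × lookup x α ≡ α')) ×
  (∀ {x} (α : Fin n) → x ∈G N → β (lookup x α) ≡ β α) ×
  (∀ (b : Fin m) → ∃[ α ] (β α ≡ b))

Induced : ∀ {n m} → PermGroup n → (Fin n → Fin m) → PermGroup m → Set
Induced {n} G β Gbar =
  (∀ {g} → g ∈G G → ∃[ h ] (h ∈G Gbar × (∀ (α : Fin n) → lookup h (β α) ≡ β (lookup g α)))) ×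
  (∀ {h} → h ∈G Gbar → ∃[ g ] (g ∈G G × (∀ (α : Fin n) → lookup h (β α) ≡ β (lookup g α))))

AbelianQuotient : ∀ {n} → PermGroup n → PermGroup n → Set
AbelianQuotient H K = ∀ {a b} → a ∈G K → b ∈G K → ∃[ c ] (c ∈G H × (a · b) ≡ ((b · a) · c))

data SolvableSeries {n : ℕ} : PermGroup n → Set where
  base : ∀ (H : PermGroup n) → Trivial H → SolvableSeries H
  step : ∀ {H K : PermGroup n} → SolvableSeries H → Normal H K → AbelianQuotient H K → SolvableSeries K

Solvable : ∀ {n} → PermGroup n → Set
Solvable G = SolvableSeries G

TwoTransitive : ∀ {n} → PermGroup n → Set
TwoTransitive {n} G = ∀ (a b c d : Fin n) → a ≢ b → c ≢ d →
  ∃[ g ] (g ∈G G × lookup g a ≡ c × lookup g b ≡ d)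

-- Almost simple: T ⊴ G ≤ Aut(T) with T non-abelian simple, i.e. G has a
-- non-abelian simple normal subgroup T with C_G(T) = 1.

Simple : ∀ {n} → PermGroup n → Set
Simple {n} T = (¬ Trivial T) × (∀ (K : PermGroup n) → Normal K T → Trivial K ⊎ T ≤G K)

NonAbelian : ∀ {n} → PermGroup n → Set
NonAbelian T = ∃[ a ] ∃[ b ] (a ∈G T × b ∈G T × (a · b) ≢ (b · a))

TrivialCentralizer : ∀ {n} → PermGroup n → PermGroup n → Set
TrivialCentralizer {n} T G =
  ∀ {g} → g ∈G G → (∀ {t} → t ∈G T → (g · t) ≡ (t · g)) → g ≡ idP n

AlmostSimple : ∀ {n} → PermGroup n → Set
AlmostSimple {n} G = ∃[ T ] (Normal T G × Simple T × NonAbelian T × TrivialCentralizer T G)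

IsField : CommutativeRing 0ℓ 0ℓ → Set
IsField R = ¬ (0# ≈ 1#) × (∀ x → ¬ (x ≈ 0#) → ∃[ y ] (x * y ≈ 1#))
  where open CommutativeRing R

HasSize : CommutativeRing 0ℓ 0ℓ → ℕ → Set
HasSize R q = ∃[ xs ] (length xs ≡ q × (∀ x → Any (x ≈_) xs) × AllPairs (λ a b → ¬ (a ≈ b)) xs)
  where open CommutativeRing R

module _ (R : CommutativeRing 0ℓ 0ℓ) where
  open CommutativeRing R

  record SL2 : Set where
    field
      a b c d : Carrier
      det     : (a * d) + (- (b * c)) ≈ 1#

  _≈M_ : SL2 → SL2 → Set
  A ≈M B = (SL2.a A ≈ SL2.a B) × (SL2.b A ≈ SL2.b B) × (SL2.c A ≈ SL2.c B) × (SL2.d A ≈ SL2.d B)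

  record ProductOf (A B C : SL2) : Set where
    field
      pa : SL2.a C ≈ (SL2.a A * SL2.a B) + (SL2.b A * SL2.c B)
      pb : SL2.b C ≈ (SL2.a A * SL2.b B) + (SL2.b A * SL2.d B)
      pc : SL2.c C ≈ (SL2.c A * SL2.a B) + (SL2.d A * SL2.c B)
      pd : SL2.d C ≈ (SL2.c A * SL2.b B) + (SL2.d A * SL2.d B)

  IsScalar : Carrier → SL2 → Set
  IsScalar s A = (SL2.a A ≈ s) × (SL2.b A ≈ 0#) × (SL2.c A ≈ 0#) × (SL2.d A ≈ s)

  -- φ : SL(2,F) → G a homomorphism with kernel {I, -I}; its image is a
  -- subgroup of G isomorphic to PSL(2,F) = SL(2,F)/{±I}.
  PSL2EmbedsIn : ∀ {n} → PermGroup n → Set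
  PSL2EmbedsIn {n} G = Σ (SL2 → Perm n) λ φ →
    ((∀ A → φ A ∈G G) ×
     (∀ A B → A ≈M B → φ A ≡ φ B) ×
     (∀ A B C → ProductOf A B C → φ C ≡ (φ A · φ B)) ×
     (∀ A → (φ A ≡ idP n → IsScalar 1# A ⊎ IsScalar (- 1#) A) ×
            (IsScalar 1# A ⊎ IsScalar (- 1#) A → φ A ≡ idP n)))

ContainsPSL2 : ∀ {n} → ℕ → PermGroup n → Set₁
ContainsPSL2 q G = ∃[ R ] (IsField R × HasSize R q × PSL2EmbedsIn R G)

IsPrimePower : ℕ → Set
IsPrimePower q = ∃[ r ] ∃[ k ] (Prime r × 1 ≤ k × q ≡ r ℕ.^ k)

FermatPrime : ℕ → Set
FermatPrime p = Prime p × ∃[ k ] (p ≡ (2 ℕ.^ (2 ℕ.^ k)) ℕ.+ 1)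

-- G preserves a partition of Ω other than {Ω} and the singletons; the
-- partition is given as the fibres of a class function f.
Imprimitive : ∀ {n} → PermGroup n → Set
Imprimitive {n} G = Σ (Fin n → Fin n) λ f →
  ((∃[ α ] ∃[ α' ] (α ≢ α' × f α ≡ f α')) ×
   (∃[ α ] ∃[ α' ] (f α ≢ f α')) ×
   (∀ {g} → g ∈G G → ∀ (α α' : Fin n) →
      (f α ≡ f α' → f (lookup g α) ≡ f (lookup g α')) ×
      (f (lookup g α) ≡ f (lookup g α') → f α ≡ f α')))

NotQuasiprimitive : ∀ {n} → PermGroup n → Set
NotQuasiprimitive {n} G = ∃[ N ] (Normal N G × ¬ Trivial N × ¬ Transitive N)

{-# OPTIONS --safe #-}
-- Distinct elements of a clique of G (no two agree at a point) cannot both translate an element into the same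
-- intersecting family, so a clique of size 3p gives ρ(G) = 1. The orbits of N are three blocks of size p or p blocks
-- of size 3.
--
-- In the first case a product of commuting elements of order p is semiregular; its powers, multiplied by those of an
-- element rotating the blocks, form a clique of size 3p.
--
-- In the second case an element of order p yields coordinates ℤ/p × ℤ/3, and the elements of G acting as a translation
-- on every block form a cyclic code in (ℤ/3)^p. A codeword of full weight again gives a clique. Without such a word G
-- acts on the blocks by affine maps: if x ↦ -x occurs, the code is reversible, so the convolution kernel projecting onto
-- it is symmetric and G preserves it up to signs, which makes G affine by Müller's polynomial argument; otherwise the
-- translations are self-normalising and counting their conjugates leaves nothing else. Now ρ(G) depends only on the set
-- of multipliers a of elements x ↦ a x + b that keep the orientation of the blocks: it is 1 if some a ≠ ±1 occurs,
-- 3/2 if these are ±1, and 3 if a = 1 only.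
module Submission where

-- The obstacle is the case without a codeword of full weight. Let C be the group of elements fixing
-- every block and translating inside it. Two elements of one coset of C then always agree on some
-- block, so these cosets are themselves intersecting, and a counting argument finer than a clique
-- is needed. Its substitute uses the products e_j · t^i · c, where c runs over C, i over ℤ/p, and
-- e_1, ..., e_l (l ≤ 3) act linearly on the blocks with distinct multipliers and keep the
-- orientation. For each g, at most |C| of the products g · e_j · t^i · c lie in a given
-- intersecting family. Hence the family has at most |G| / (l p) elements, against |G| / (3 p) for a
-- point stabiliser, and the three values 3, 3/2, 1 are 3 / l for l = 1, 2, 3. For l = 3 a
-- stabiliser attains the bound. For l ≤ 2 the extremal family is C, enlarged by
-- orientation-reversing elements of one multiplier where such exist. That its translates cover G
-- requires every element to be affine on the blocks, so affineness is proved exactly under the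
-- assumption that orientation-keeping multipliers are ±1.

open import Algebra.Bundles using (CommutativeRing)

-- A ring solver with integer coefficients for arbitrary commutative rings.

module IntegerSolver {c ℓ} (R : CommutativeRing c ℓ) where

  open import Algebra.Solver.Ring.AlmostCommutativeRing
    using (fromCommutativeRing; _-Raw-AlmostCommutative⟶_)
  import Algebra.Solver.Ring as RingSolver
  import Algebra.Properties.Ring as RingProperties
  import Algebra.Properties.Semiring.Mult as SemiringMult
  open import Data.Integer using (ℤ; +_; -[1+_]; _⊖_)
  import Data.Integer as ℤ
  import Data.Integer.Properties as ℤ
  open import Data.Maybe using (Maybe; just; nothing)
  open import Data.Nat using (ℕ; zero; suc)
  import Data.Nat as ℕ
  import Data.Nat.Properties as ℕ
  open import Relation.Binary.PropositionalEquality as ≡ using (_≡_)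
  open import Relation.Nullary using (yes; no)

  open CommutativeRing R
  open RingProperties ring
  open SemiringMult semiring
  open import Relation.Binary.Reasoning.Setoid setoid

  -- Integer coefficients have decidable equality, so the solver can cancel terms over rings that
  -- have none. The unfolding of `×` makes the coefficient 1 denote `1# + 0#`, which is why the unit
  -- is usually handed to the solver as a variable.
  fromℤ : ℤ → Carrier
  fromℤ (+ n)    = n × 1#
  fromℤ -[1+ n ] = - (suc n × 1#)

  private
    cancel : ∀ x y → (1# + x) - (1# + y) ≈ x - y
    cancel x y = begin
      (1# + x) + - (1# + y)      ≈⟨ +-cong (+-comm 1# x) (sym (-‿+-comm 1# y)) ⟩
      (x + 1#) + (- 1# + - y)    ≈⟨ +-assoc x 1# _ ⟩
      x + (1# + (- 1# + - y))    ≈⟨ +-congˡ (sym (+-assoc 1# _ _)) ⟩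
      x + ((1# + - 1#) + - y)    ≈⟨ +-congˡ (+-congʳ (-‿inverseʳ 1#)) ⟩
      x + (0# + - y)             ≈⟨ +-congˡ (+-identityˡ _) ⟩
      x - y                      ∎

    ⊖-homo : ∀ m n → fromℤ (m ⊖ n) ≈ m × 1# - n × 1#
    ⊖-homo zero    zero    = sym (-‿inverseʳ 0#)
    ⊖-homo zero    (suc n) = sym (+-identityˡ _)
    ⊖-homo (suc m) zero    = sym (trans (+-congˡ -0#≈0#) (+-identityʳ _))
    ⊖-homo (suc m) (suc n) = begin
      fromℤ (suc m ⊖ suc n)        ≡⟨ ≡.cong fromℤ (ℤ.[1+m]⊖[1+n]≡m⊖n m n) ⟩
      fromℤ (m ⊖ n)                ≈⟨ ⊖-homo m n ⟩
      m × 1# - n × 1#              ≈⟨ cancel _ _ ⟨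
      suc m × 1# - suc n × 1#      ∎

    ×-+ : ∀ m n → (m ℕ.+ n) × 1# ≈ m × 1# + n × 1#
    ×-+ m n = ×-homo-+ 1# m n

    +-homo : ∀ i j → fromℤ (i ℤ.+ j) ≈ fromℤ i + fromℤ j
    +-homo (+ m)    (+ n)    = ×-+ m n
    +-homo (+ m)    -[1+ n ] = ⊖-homo m (suc n)
    +-homo -[1+ m ] (+ n)    = trans (⊖-homo n (suc m)) (+-comm _ _)
    +-homo -[1+ m ] -[1+ n ] = begin
      - (suc (suc (m ℕ.+ n)) × 1#)           ≡⟨ ≡.cong (λ k → - (suc k × 1#)) (≡.sym (ℕ.+-suc m n)) ⟩
      - ((suc m ℕ.+ suc n) × 1#)             ≈⟨ -‿cong (×-+ (suc m) (suc n)) ⟩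
      - (suc m × 1# + suc n × 1#)            ≈⟨ -‿+-comm _ _ ⟨
      - (suc m × 1#) - suc n × 1#            ∎

    -‿homo : ∀ i → fromℤ (ℤ.- i) ≈ - fromℤ i
    -‿homo (+ zero)  = sym -0#≈0#
    -‿homo (+ suc n) = refl
    -‿homo -[1+ n ]  = sym (-‿involutive _)

    ×-* : ∀ m n → (m ℕ.* n) × 1# ≈ (m × 1#) * (n × 1#)
    ×-* = ×1-homo-*

    pos-*ʳ : ∀ m j → fromℤ ((+ m) ℤ.* j) ≈ m × 1# * fromℤ j
    pos-*ʳ m (+ n)    = trans (reflexive (≡.cong fromℤ (≡.sym (ℤ.pos-* m n)))) (×-* m n)
    pos-*ʳ m -[1+ n ] = begin
      fromℤ ((+ m) ℤ.* -[1+ n ])        ≡⟨ ≡.cong fromℤ (≡.sym (ℤ.neg-distribʳ-* (+ m) (+ suc n))) ⟩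
      fromℤ (ℤ.- ((+ m) ℤ.* (+ suc n))) ≈⟨ -‿homo ((+ m) ℤ.* (+ suc n)) ⟩
      - fromℤ ((+ m) ℤ.* (+ suc n))     ≈⟨ -‿cong (pos-*ʳ m (+ suc n)) ⟩
      - (m × 1# * (suc n × 1#))         ≈⟨ -‿distribʳ-* _ _ ⟩
      m × 1# * - (suc n × 1#)           ∎

    *-homo : ∀ i j → fromℤ (i ℤ.* j) ≈ fromℤ i * fromℤ j
    *-homo (+ m)    j = pos-*ʳ m j
    *-homo -[1+ m ] j = begin
      fromℤ (-[1+ m ] ℤ.* j)         ≡⟨ ≡.cong fromℤ (≡.sym (ℤ.neg-distribˡ-* (+ suc m) j)) ⟩
      fromℤ (ℤ.- ((+ suc m) ℤ.* j))  ≈⟨ -‿homo ((+ suc m) ℤ.* j) ⟩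
      - fromℤ ((+ suc m) ℤ.* j)      ≈⟨ -‿cong (pos-*ʳ (suc m) j) ⟩
      - (suc m × 1# * fromℤ j)       ≈⟨ -‿distribˡ-* _ _ ⟩
      - (suc m × 1#) * fromℤ j       ∎

    morphism : ℤ.+-*-rawRing -Raw-AlmostCommutative⟶ fromCommutativeRing R
    morphism = record
      { ⟦_⟧    = fromℤ
      ; +-homo = +-homo
      ; *-homo = *-homo
      ; -‿homo = -‿homo
      ; 0-homo = refl
      ; 1-homo = +-identityʳ 1#
      }

    decide : ∀ i j → Maybe (fromℤ i ≈ fromℤ j)
    decide i j with i ℤ.≟ j
    ... | yes ≡.refl = just refl
    ... | no _       = nothing

  open RingSolver ℤ.+-*-rawRing (fromCommutativeRing R) morphism decide public
    using (solve; con; _:+_; _:*_; _:-_; :-_; _:=_)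

-- The field ℤ/p.

module Zmod where

  open import Algebra.Bundles using (CommutativeRing)
  open import Algebra.Core using (Op₁; Op₂)
  open import Algebra.Structures using (IsCommutativeRing)
  open import Data.Fin using (Fin; toℕ)
  open import Data.Fin.Properties using (toℕ-injective; toℕ-fromℕ<; toℕ<n)
  open import Data.Nat using (ℕ; NonZero; ≢-nonZero; _∸_; _%_)
  import Data.Nat as ℕ
  import Algebra.Properties.Ring as RingProperties
  import Algebra.Properties.Group as GroupProperties
  import Data.Nat.Properties as ℕ
  open import Data.Nat.Coprimality using (coprime-Bézout; prime⇒coprime)
  open import Data.Nat.Divisibility using (_∣_; m%n≡0⇒n∣m)
  open import Data.Nat.DivMod using (_mod_; m%n<n; m<n⇒m%n≡m; n%n≡0; %-distribˡ-+; %-distribˡ-*; m*n%n≡0)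
  open import Data.Nat.GCD using (module Bézout)
  open import Data.Nat.Primality using (Prime; prime⇒nonZero)
  open import Data.Product using (∃; _,_; _×_; proj₂)
  open import Level using (0ℓ)
  open import Relation.Binary.PropositionalEquality hiding ([_])
  open ≡-Reasoning

  -- A copy of ℤ/p on Fin p whose operations do not compute.
  record PrimeField (p : ℕ) : Set where
    infixl 6 _+_
    infixl 7 _*_
    infix  8 -_
    field
      _+_ _*_ : Op₂ (Fin p)
      -_      : Op₁ (Fin p)
      0# 1#   : Fin p
      isCommutativeRing : IsCommutativeRing _≡_ _+_ _*_ -_ 0# 1#
      inverse : ∀ x → x ≢ 0# → ∃ λ y → x * y ≡ 1#
      [_]     : ℕ → Fin p
      []-+    : ∀ m n → [ m ℕ.+ n ] ≡ [ m ] + [ n ]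
      []-*    : ∀ m n → [ m ℕ.* n ] ≡ [ m ] * [ n ]
      []-1    : [ 1 ] ≡ 1#
      []-toℕ  : ∀ x → [ toℕ x ] ≡ x
      []-0    : ∀ n → [ n ] ≡ 0# → p ∣ n
      []-p    : [ p ] ≡ 0#

    commutativeRing : CommutativeRing 0ℓ 0ℓ
    commutativeRing = record { isCommutativeRing = isCommutativeRing }

  module Construction (n : ℕ) .{{_ : NonZero n}} where

    [_] : ℕ → Fin n
    [ x ] = x mod n

    toℕ-[] : ∀ x → toℕ [ x ] ≡ x % n
    toℕ-[] x = toℕ-fromℕ< (m%n<n x n)

    []-cong : ∀ {x y} → x % n ≡ y % n → [ x ] ≡ [ y ]
    []-cong {x} {y} eq = toℕ-injective (trans (toℕ-[] x) (trans eq (sym (toℕ-[] y))))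

    []-toℕ : ∀ a → [ toℕ a ] ≡ a
    []-toℕ a = toℕ-injective (trans (toℕ-[] _) (m<n⇒m%n≡m (toℕ<n a)))

    _+_ _*_ : Op₂ (Fin n)
    a + b = [ toℕ a ℕ.+ toℕ b ]
    a * b = [ toℕ a ℕ.* toℕ b ]

    -_ : Op₁ (Fin n)
    - a = [ n ∸ toℕ a ]

    []-+ : ∀ x y → [ x ℕ.+ y ] ≡ [ x ] + [ y ]
    []-+ x y = []-cong (trans (%-distribˡ-+ x y n) (cong₂ (λ a b → (a ℕ.+ b) % n) (sym (toℕ-[] x)) (sym (toℕ-[] y))))

    []-* : ∀ x y → [ x ℕ.* y ] ≡ [ x ] * [ y ]
    []-* x y = []-cong (trans (%-distribˡ-* x y n) (cong₂ (λ a b → (a ℕ.* b) % n) (sym (toℕ-[] x)) (sym (toℕ-[] y))))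

    []-0⇒∣ : ∀ x → [ x ] ≡ [ 0 ] → n ∣ x
    []-0⇒∣ x eq = m%n≡0⇒n∣m x n (trans (sym (toℕ-[] x)) (trans (cong toℕ eq) (trans (toℕ-[] 0) (m*n%n≡0 0 n))))

    []-n : [ n ] ≡ [ 0 ]
    []-n = []-cong (trans (n%n≡0 n) (sym (m*n%n≡0 0 n)))

    -- Moves identities between residues to natural-number representatives, where `[_]` is a
    -- homomorphism and the laws of ℕ apply.
    []-elim : (P : Fin n → Set) → (∀ x → P [ x ]) → ∀ a → P a
    []-elim P f a = subst P ([]-toℕ a) (f (toℕ a))

    +-comm : ∀ a b → a + b ≡ b + a
    +-comm a b = cong [_] (ℕ.+-comm (toℕ a) (toℕ b))

    *-comm : ∀ a b → a * b ≡ b * a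
    *-comm a b = cong [_] (ℕ.*-comm (toℕ a) (toℕ b))

    +-assoc : ∀ a b c → (a + b) + c ≡ a + (b + c)
    +-assoc = []-elim _ λ x → []-elim _ λ y → []-elim _ λ z → begin
      ([ x ] + [ y ]) + [ z ]  ≡⟨ cong (_+ [ z ]) ([]-+ x y) ⟨
      [ x ℕ.+ y ] + [ z ]      ≡⟨ []-+ _ z ⟨
      [ x ℕ.+ y ℕ.+ z ]        ≡⟨ cong [_] (ℕ.+-assoc x y z) ⟩
      [ x ℕ.+ (y ℕ.+ z) ]      ≡⟨ []-+ x _ ⟩
      [ x ] + [ y ℕ.+ z ]      ≡⟨ cong ([ x ] +_) ([]-+ y z) ⟩
      [ x ] + ([ y ] + [ z ])  ∎

    *-assoc : ∀ a b c → (a * b) * c ≡ a * (b * c)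
    *-assoc = []-elim _ λ x → []-elim _ λ y → []-elim _ λ z → begin
      ([ x ] * [ y ]) * [ z ]  ≡⟨ cong (_* [ z ]) ([]-* x y) ⟨
      [ x ℕ.* y ] * [ z ]      ≡⟨ []-* _ z ⟨
      [ x ℕ.* y ℕ.* z ]        ≡⟨ cong [_] (ℕ.*-assoc x y z) ⟩
      [ x ℕ.* (y ℕ.* z) ]      ≡⟨ []-* x _ ⟩
      [ x ] * [ y ℕ.* z ]      ≡⟨ cong ([ x ] *_) ([]-* y z) ⟩
      [ x ] * ([ y ] * [ z ])  ∎

    distribˡ : ∀ a b c → a * (b + c) ≡ (a * b) + (a * c)
    distribˡ = []-elim _ λ x → []-elim _ λ y → []-elim _ λ z → begin
      [ x ] * ([ y ] + [ z ])              ≡⟨ cong ([ x ] *_) ([]-+ y z) ⟨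
      [ x ] * [ y ℕ.+ z ]                  ≡⟨ []-* x _ ⟨
      [ x ℕ.* (y ℕ.+ z) ]                  ≡⟨ cong [_] (ℕ.*-distribˡ-+ x y z) ⟩
      [ x ℕ.* y ℕ.+ x ℕ.* z ]              ≡⟨ []-+ _ _ ⟩
      [ x ℕ.* y ] + [ x ℕ.* z ]            ≡⟨ cong₂ _+_ ([]-* x y) ([]-* x z) ⟩
      ([ x ] * [ y ]) + ([ x ] * [ z ])    ∎

    +-identityˡ : ∀ a → [ 0 ] + a ≡ a
    +-identityˡ = []-elim _ λ x → sym ([]-+ 0 x)

    *-identityˡ : ∀ a → [ 1 ] * a ≡ a
    *-identityˡ = []-elim _ λ x → trans (sym ([]-* 1 x)) (cong [_] (ℕ.*-identityˡ x))

    -‿inverseˡ : ∀ a → (- a) + a ≡ [ 0 ]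
    -‿inverseˡ a = begin
      [ n ∸ toℕ a ] + a          ≡⟨ cong ([ n ∸ toℕ a ] +_) ([]-toℕ a) ⟨
      [ n ∸ toℕ a ] + [ toℕ a ]  ≡⟨ []-+ _ _ ⟨
      [ n ∸ toℕ a ℕ.+ toℕ a ]    ≡⟨ cong [_] (ℕ.m∸n+n≡m (ℕ.<⇒≤ (toℕ<n a))) ⟩
      [ n ]                      ≡⟨ []-n ⟩
      [ 0 ]                      ∎

    byComm : ∀ {_∘_ : Op₂ (Fin n)} {e} → (∀ a b → a ∘ b ≡ b ∘ a) → (∀ a → e ∘ a ≡ a) → (∀ a → e ∘ a ≡ a) × (∀ a → a ∘ e ≡ a)
    byComm comm id = id , λ a → trans (comm a _) (id a)

    isCommutativeRing : IsCommutativeRing _≡_ _+_ _*_ -_ [ 0 ] [ 1 ]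
    isCommutativeRing = record
      { isRing = record
        { +-isAbelianGroup = record
          { isGroup = record
            { isMonoid = record
              { isSemigroup = record
                { isMagma = record { isEquivalence = isEquivalence ; ∙-cong = cong₂ _+_ }
                ; assoc = +-assoc }
              ; identity = byComm +-comm +-identityˡ }
            ; inverse = -‿inverseˡ , λ a → trans (+-comm a (- a)) (-‿inverseˡ a)
            ; ⁻¹-cong = cong -_ }
          ; comm = +-comm }
        ; *-cong = cong₂ _*_
        ; *-assoc = *-assoc
        ; *-identity = byComm *-comm *-identityˡ
        ; distrib = distribˡ , λ a b c → trans (*-comm (b + c) a) (trans (distribˡ a b c) (cong₂ _+_ (*-comm a b) (*-comm a c)))
        }
      ; *-comm = *-comm
      }

  primeField : ∀ {p} → Prime p → PrimeField p
  primeField {p} pr = record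
    { isCommutativeRing = isCommutativeRing
    ; inverse = λ a a≢0 → inv a a≢0
    ; [_] = [_] ; []-+ = []-+ ; []-* = []-* ; []-1 = refl ; []-toℕ = []-toℕ ; []-0 = []-0⇒∣ ; []-p = []-n
    }
    where
    open Construction p {{prime⇒nonZero pr}}
    module I = IsCommutativeRing isCommutativeRing
    ring : CommutativeRing 0ℓ 0ℓ
    ring = record { isCommutativeRing = isCommutativeRing }
    open RingProperties (CommutativeRing.ring ring) using (-‿distribʳ-*)
    open GroupProperties (CommutativeRing.+-group ring) using (inverseˡ-unique)

    multiple : ∀ a k → [ k ℕ.* toℕ a ] ≡ a * [ k ]
    multiple a k = trans ([]-* k _) (trans (*-comm [ k ] [ toℕ a ]) (cong (_* [ k ]) ([]-toℕ a)))

    vanish : ∀ k → [ k ℕ.* p ] ≡ [ 0 ]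
    vanish k = trans ([]-* k p) (trans (cong ([ k ] *_) []-n) (I.zeroʳ [ k ]))

    inv : ∀ a → a ≢ [ 0 ] → ∃ λ b → a * b ≡ [ 1 ]
    inv a a≢0 = bézout (coprime-Bézout (prime⇒coprime pr {{nonZero}} (toℕ<n a)))
      where
      nonZero : NonZero (toℕ a)
      nonZero = ≢-nonZero λ eq → a≢0 (trans (sym ([]-toℕ a)) (cong [_] eq))

      bézout : Bézout.Identity 1 p (toℕ a) → ∃ λ b → a * b ≡ [ 1 ]
      -- Here 1 + y a = x p, so the inverse of a is the class of -y.
      bézout (Bézout.+- x y eq) = - [ y ] , trans (sym (-‿distribʳ-* a [ y ])) (sym (inverseˡ-unique _ _ (begin
        [ 1 ] + (a * [ y ])      ≡⟨ cong ([ 1 ] +_) (multiple a y) ⟨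
        [ 1 ] + [ y ℕ.* toℕ a ]  ≡⟨ []-+ 1 _ ⟨
        [ 1 ℕ.+ y ℕ.* toℕ a ]    ≡⟨ cong [_] eq ⟩
        [ x ℕ.* p ]              ≡⟨ vanish x ⟩
        [ 0 ]                    ∎)))
      bézout (Bézout.-+ x y eq) = [ y ] , (begin
        a * [ y ]                ≡⟨ multiple a y ⟨
        [ y ℕ.* toℕ a ]          ≡⟨ cong [_] eq ⟨
        [ 1 ℕ.+ x ℕ.* p ]        ≡⟨ []-+ 1 _ ⟩
        [ 1 ] + [ x ℕ.* p ]      ≡⟨ cong ([ 1 ] +_) (vanish x) ⟩
        [ 1 ] + [ 0 ]            ≡⟨ proj₂ I.+-identity _ ⟩
        [ 1 ]                    ∎)

-- Cardinalities of decidable subsets of finite sets.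

module Counting where

  open import Data.Bool using (if_then_else_)
  open import Data.Fin using (Fin; zero; suc; _≟_; _↑ˡ_; _↑ʳ_; combine)
  open import Data.Fin.Properties using (any?)
  open import Data.Fin.Permutation using (permutation)
  open import Data.Nat using (ℕ; zero; suc; _+_; _*_; _≤_; z≤n; s≤s; _<_)
  open import Data.Nat.Properties hiding (_≟_)
  open import Data.Product using (∃; _,_; _×_)
  open import Data.Unit using (tt)
  open import Function using (_∘_)
  open import Level using (0ℓ)
  open import Relation.Binary.PropositionalEquality
  open import Relation.Nullary using (Dec; yes; no; does; ¬_; contradiction; ¬?; _×-dec_)
  open import Relation.Unary using (Pred; Decidable)
  open import Algebra.Properties.Semiring.Sum +-*-semiring public

  𝟙 : {A : Set} → Dec A → ℕ
  𝟙 a? = if does a? then 1 else 0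

  𝟙-yes : {A : Set} (a? : Dec A) → A → 𝟙 a? ≡ 1
  𝟙-yes (yes _) _ = refl
  𝟙-yes (no ¬a) a = contradiction a ¬a

  𝟙-no : {A : Set} (a? : Dec A) → ¬ A → 𝟙 a? ≡ 0
  𝟙-no (yes a) ¬a = contradiction a ¬a
  𝟙-no (no _)  _  = refl

  𝟙-mono : {A B : Set} (a? : Dec A) (b? : Dec B) → (A → B) → 𝟙 a? ≤ 𝟙 b?
  𝟙-mono (no _)  b? f = z≤n
  𝟙-mono (yes a) b? f = ≤-reflexive (sym (𝟙-yes b? (f a)))

  𝟙-cong : {A B : Set} (a? : Dec A) (b? : Dec B) → (A → B) → (B → A) → 𝟙 a? ≡ 𝟙 b?
  𝟙-cong a? b? f g = ≤-antisym (𝟙-mono a? b? f) (𝟙-mono b? a? g)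

  𝟙-× : {A B : Set} (a? : Dec A) (b? : Dec B) → 𝟙 (a? ×-dec b?) ≡ 𝟙 a? * 𝟙 b?
  𝟙-× (yes _) (yes _) = refl
  𝟙-× (yes _) (no _)  = refl
  𝟙-× (no _)  _       = refl

  sum-mono : ∀ {n} {f g : Fin n → ℕ} → (∀ i → f i ≤ g i) → sum f ≤ sum g
  sum-mono {zero}  h = z≤n
  sum-mono {suc n} h = +-mono-≤ (h zero) (sum-mono (h ∘ suc))

  sum-const : ∀ n c → ∑[ i < n ] c ≡ n * c
  sum-const zero    c = refl
  sum-const (suc n) c = cong (c +_) (sum-const n c)

  sum-≤-const : ∀ {n} {f : Fin n → ℕ} {c} → (∀ i → f i ≤ c) → sum f ≤ n * c
  sum-≤-const {n} {c = c} h = ≤-trans (sum-mono h) (≤-reflexive (sum-const n c))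

  term≤sum : ∀ {n} (f : Fin n → ℕ) i → f i ≤ sum f
  term≤sum f zero    = m≤m+n _ _
  term≤sum f (suc i) = ≤-trans (term≤sum (f ∘ suc) i) (m≤n+m _ (f zero))

  sum-positive : ∀ {n} (f : Fin n → ℕ) → 0 < sum f → ∃ λ i → 0 < f i
  sum-positive {suc n} f pos with f zero in eq
  ... | suc _ = zero , subst (0 <_) (sym eq) (s≤s z≤n)
  ... | zero  with i , q ← sum-positive (f ∘ suc) pos = suc i , q

  sum-single : ∀ {n} (f : Fin n → ℕ) i → (∀ j → j ≢ i → f j ≡ 0) → sum f ≡ f i
  sum-single {suc n} f zero h =
    trans (cong (f zero +_) (trans (sum-cong-≗ {x = f ∘ suc} (λ j → h (suc j) λ ())) (sum-replicate-zero n))) (+-identityʳ _)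
  sum-single {suc n} f (suc i) h =
    trans (cong (_+ sum (f ∘ suc)) (h zero λ ())) (sum-single (f ∘ suc) i λ j j≢i → h (suc j) λ { refl → j≢i refl })

  sum-bijection : ∀ {m n} (f : Fin n → ℕ) (to : Fin m → Fin n) (from : Fin n → Fin m) →
                  (∀ y → to (from y) ≡ y) → (∀ x → from (to x) ≡ x) → sum f ≡ sum (f ∘ to)
  sum-bijection f to from tf ft = sum-permute f (permutation to from tf ft)

  module _ {n : ℕ} where

    -- Cardinalities are sums of indicators, so that double counting becomes an exchange of two
    -- sums.
    count : {P : Pred (Fin n) 0ℓ} → Decidable P → ℕ
    count P? = sum (λ i → 𝟙 (P? i))

    module _ {P Q : Pred (Fin n) 0ℓ} (P? : Decidable P) (Q? : Decidable Q) where

      count-mono : (∀ i → P i → Q i) → count P? ≤ count Q?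
      count-mono h = sum-mono λ i → 𝟙-mono (P? i) (Q? i) (h i)

      count-cong : (∀ i → P i → Q i) → (∀ i → Q i → P i) → count P? ≡ count Q?
      count-cong f g = sum-cong-≗ λ i → 𝟙-cong (P? i) (Q? i) (f i) (g i)

    count-all : {P : Pred (Fin n) 0ℓ} (P? : Decidable P) → (∀ i → P i) → count P? ≡ n
    count-all P? h = trans (sum-cong-≗ λ i → 𝟙-yes (P? i) (h i)) (trans (sum-const n 1) (*-identityʳ n))

    count-none : {P : Pred (Fin n) 0ℓ} (P? : Decidable P) → (∀ i → ¬ P i) → count P? ≡ 0
    count-none P? h = trans (sum-cong-≗ λ i → 𝟙-no (P? i) (h i)) (sum-replicate-zero n)

    count-positive : {P : Pred (Fin n) 0ℓ} (P? : Decidable P) → ∀ i → P i → 0 < count P?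
    count-positive P? i p = ≤-trans (≤-reflexive (sym (𝟙-yes (P? i) p))) (term≤sum (λ i → 𝟙 (P? i)) i)

    count-witness : {P : Pred (Fin n) 0ℓ} (P? : Decidable P) → 0 < count P? → ∃ P
    count-witness P? pos with sum-positive (λ i → 𝟙 (P? i)) pos
    ... | i , q with P? i
    ... | yes p = i , p

    count-unique : {P : Pred (Fin n) 0ℓ} (P? : Decidable P) → ∀ i → P i → (∀ j → P j → j ≡ i) → count P? ≡ 1
    count-unique P? i p u = trans (sum-single _ i λ j j≢i → 𝟙-no (P? j) (j≢i ∘ u j)) (𝟙-yes (P? i) p)

    count-≤1 : {P : Pred (Fin n) 0ℓ} (P? : Decidable P) → (∀ i j → P i → P j → i ≡ j) → count P? ≤ 1
    count-≤1 P? u with any? P?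
    ... | yes (i , p) = ≤-reflexive (count-unique P? i p λ j q → u j i q p)
    ... | no none     = ≤-trans (≤-reflexive (count-none P? λ i p → none (i , p))) z≤n

    count-split : {P Q : Pred (Fin n) 0ℓ} (P? : Decidable P) (Q? : Decidable Q) →
                  count P? ≡ count (λ i → P? i ×-dec Q? i) + count (λ i → P? i ×-dec ¬? (Q? i))
    count-split {P} {Q} P? Q? = trans (sum-cong-≗ λ i → split i) (∑-distrib-+ (λ i → 𝟙 (P? i ×-dec Q? i)) (λ i → 𝟙 (P? i ×-dec ¬? (Q? i))))
      where
      split : ∀ i → 𝟙 (P? i) ≡ 𝟙 (P? i ×-dec Q? i) + 𝟙 (P? i ×-dec ¬? (Q? i))
      split i with P? i | Q? i
      ... | yes _ | yes _ = refl
      ... | yes _ | no _  = refl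
      ... | no _  | yes _ = refl
      ... | no _  | no _  = refl

    count-< : {P Q : Pred (Fin n) 0ℓ} (P? : Decidable P) (Q? : Decidable Q) →
              (∀ i → P i → Q i) → ∀ j → Q j → ¬ P j → count P? < count Q?
    count-< P? Q? P⊆Q j q ¬p = begin-strict
      count P?                                                                ≡⟨ +-identityʳ _ ⟨
      count P? + 0                                                            <⟨ +-monoʳ-< (count P?) (count-positive (λ i → Q? i ×-dec ¬? (P? i)) j (q , ¬p)) ⟩
      count P? + count (λ i → Q? i ×-dec ¬? (P? i))                           ≤⟨ +-monoˡ-≤ _ (count-mono P? (λ i → Q? i ×-dec P? i) λ i p → P⊆Q i p , p) ⟩
      count (λ i → Q? i ×-dec P? i) + count (λ i → Q? i ×-dec ¬? (P? i))      ≡⟨ count-split Q? P? ⟨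
      count Q?                                                                ∎
      where open ≤-Reasoning

    subset-of-smaller : {P Q : Pred (Fin n) 0ℓ} (P? : Decidable P) (Q? : Decidable Q) →
                        (∀ i → P i → Q i) → count Q? ≤ count P? → ∀ i → Q i → P i
    subset-of-smaller P? Q? P⊆Q le i q with P? i
    ... | yes p = p
    ... | no ¬p = contradiction (count-< P? Q? P⊆Q i q ¬p) (≤⇒≯ le)

    another : {P : Pred (Fin n) 0ℓ} (P? : Decidable P) → 1 < count P? → ∀ i → ∃ λ j → P j × j ≢ i
    another {P} P? gt i with any? (λ j → P? j ×-dec ¬? (j ≟ i))
    ... | yes found = found
    ... | no none   = contradiction gt (≤⇒≯ (count-≤1 P? λ j k p q → trans (is-i j p) (sym (is-i k q))))
      where
      is-i : ∀ j → P j → j ≡ i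
      is-i j p with j ≟ i
      ... | yes eq = eq
      ... | no neq = contradiction (j , p , neq) none

  -- The pairs (i, f i) with i in P are counted by rows and by columns: one pair in each row of P,
  -- and by injectivity at most one in each column.
  count-image : ∀ {m n} {P : Pred (Fin m) 0ℓ} {Q : Pred (Fin n) 0ℓ} (P? : Decidable P) (Q? : Decidable Q) (f : Fin m → Fin n) →
                (∀ i → P i → Q (f i)) → (∀ i j → P i → P j → f i ≡ f j → i ≡ j) → count P? ≤ count Q?
  count-image {m} {n} {P} {Q} P? Q? f into inj = begin
    count P?                                              ≡⟨ sum-cong-≗ (λ i → sym (row i)) ⟩
    sum (λ i → sum (λ j → 𝟙 (hit? i j)))                  ≡⟨ ∑-comm (λ i j → 𝟙 (hit? i j)) ⟩
    sum (λ j → sum (λ i → 𝟙 (hit? i j)))                  ≤⟨ sum-mono column ⟩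
    count Q?                                              ∎
    where
    open ≤-Reasoning
    hit? : ∀ i j → Dec (P i × f i ≡ j)
    hit? i j = P? i ×-dec (f i ≟ j)

    row : ∀ i → count (hit? i) ≡ 𝟙 (P? i)
    row i with P? i in eq
    ... | yes p = count-unique (λ j → yes p ×-dec (f i ≟ j)) (f i) (p , refl) λ j (_ , e) → sym e
    ... | no ¬p = count-none (λ j → no ¬p ×-dec (f i ≟ j)) λ j (p , _) → ¬p p

    column : ∀ j → count (λ i → hit? i j) ≤ 𝟙 (Q? j)
    column j with any? (λ i → hit? i j)
    ... | yes (i , p , refl) = ≤-trans (count-≤1 (λ i′ → hit? i′ (f i)) λ a b (p , e) (q , e′) → inj a b p q (trans e (sym e′)))
                                       (≤-reflexive (sym (𝟙-yes (Q? (f i)) (into i p))))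
    ... | no none = ≤-trans (≤-reflexive (count-none (λ i → hit? i j) λ i h → none (i , h))) z≤n

  -- Presents a subset of size c as `Fin c`; used to bound orbits, to list the roots of a
  -- polynomial, and to number the points of a block.
  record Listing {n : ℕ} (P : Pred (Fin n) 0ℓ) (c : ℕ) : Set where
    field
      at        : Fin c → Fin n
      injective : ∀ i j → at i ≡ at j → i ≡ j
      member    : ∀ i → P (at i)
      index     : ∀ x → P x → Fin c
      at-index  : ∀ x p → at (index x p) ≡ x

  listing : ∀ {n} {P : Pred (Fin n) 0ℓ} (P? : Decidable P) → Listing P (count P?)
  listing {zero} P? = record { at = λ () ; injective = λ () ; member = λ () ; index = λ () ; at-index = λ () }
  listing {suc n} {P} P? with P? zero | listing (λ i → P? (suc i))
  ... | no ¬p | l = record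
    { at = suc ∘ at
    ; injective = λ i j eq → injective i j (suc-inj eq)
    ; member = member
    ; index = λ { zero p → contradiction p ¬p ; (suc x) p → index x p }
    ; at-index = λ { zero p → contradiction p ¬p ; (suc x) p → cong suc (at-index x p) } }
    where
    open Listing l
    suc-inj : ∀ {n} {i j : Fin n} → suc i ≡ suc j → i ≡ j
    suc-inj refl = refl
  ... | yes p | l = record
    { at = λ { zero → zero ; (suc i) → suc (at i) }
    ; injective = λ { zero zero _ → refl ; (suc i) (suc j) eq → cong suc (injective i j (suc-inj eq)) }
    ; member = λ { zero → p ; (suc i) → member i }
    ; index = λ { zero _ → zero ; (suc x) q → suc (index x q) }
    ; at-index = λ { zero _ → refl ; (suc x) q → cong suc (at-index x q) } }
    where
    open Listing l
    suc-inj : ∀ {n} {i j : Fin n} → suc i ≡ suc j → i ≡ j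
    suc-inj refl = refl

  -- A missed value y would make f inject n points into the n - 1 points other than y.
  injective⇒surjective : ∀ {n} (f : Fin n → Fin n) → (∀ i j → f i ≡ f j → i ≡ j) → ∀ y → ∃ λ x → f x ≡ y
  injective⇒surjective {n} f inj y with any? (λ x → f x ≟ y)
  ... | yes found = found
  ... | no none   = contradiction (≤-trans (count-< (λ x → ¬? (x ≟ y)) (λ _ → yes tt) (λ _ _ → tt) y tt λ neq → neq refl)
                                           (count-image (λ _ → yes tt) (λ x → ¬? (x ≟ y)) f (λ x _ e → none (x , e)) λ i j _ _ → inj i j))
                                  (<-irrefl refl)

  sum-++ : ∀ m {n} (f : Fin (m + n) → ℕ) → sum f ≡ sum (λ i → f (i ↑ˡ n)) + sum (λ j → f (m ↑ʳ j))
  sum-++ zero    f = refl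
  sum-++ (suc m) f = trans (cong (f zero +_) (sum-++ m (f ∘ suc))) (sym (+-assoc (f zero) _ _))

  sum-combine : ∀ m {n} (f : Fin (m * n) → ℕ) → sum f ≡ ∑[ i < m ] ∑[ j < n ] f (combine i j)
  sum-combine zero        f = refl
  sum-combine (suc m) {n} f = trans (sum-++ n f) (cong (sum (λ j → f (j ↑ˡ (m * n))) +_) (sum-combine m (λ x → f (n ↑ʳ x))))

-- Iteration of a map of prime period and the resulting congruences.

module Orbits where

  open Counting
  open import Data.Fin using (Fin; toℕ; fromℕ<; _≟_)
  open import Data.Fin.Properties using (any?; toℕ<n; toℕ-fromℕ<; toℕ-injective; injective⇒≤)
  open import Data.Nat using (ℕ; zero; suc; _+_; _*_; _∸_; _≤_; _<_; NonZero; >-nonZero; pred; _%_; _/_)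
  open import Data.Nat.Coprimality using (coprime-Bézout; prime⇒coprime)
  open import Data.Nat.Divisibility using (_∣_; ∣m∣n⇒∣m+n; ∣m+n∣m⇒∣n; ∣-refl; _∣0)
  open import Data.Nat.DivMod using (m≡m%n+[m/n]*n; m%n<n)
  open import Data.Nat.GCD using (module Bézout)
  open import Data.Nat.Induction using (<-wellFounded)
  open import Data.Nat.Primality using (Prime; prime⇒nonZero)
  open import Data.Nat.Properties hiding (_≟_)
  open import Data.Unit using (tt)
  open import Data.Product using (∃; _,_; _×_; proj₁; proj₂)
  open import Induction.WellFounded using (Acc; acc)
  open import Level using (0ℓ)
  open import Relation.Binary.Definitions using (tri<; tri≈; tri>)
  open import Relation.Binary.PropositionalEquality
  open import Relation.Nullary using (yes; no; ¬_; contradiction; ¬?; _×-dec_)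
  open import Relation.Unary using (Pred; Decidable)

  module _ {A : Set} (f : A → A) where

    iter : ℕ → A → A
    iter zero    x = x
    iter (suc k) x = iter k (f x)

    iter-suc : ∀ k x → iter (suc k) x ≡ f (iter k x)
    iter-suc zero    x = refl
    iter-suc (suc k) x = iter-suc k (f x)

    iter-+ : ∀ j k x → iter (j + k) x ≡ iter k (iter j x)
    iter-+ zero    k x = refl
    iter-+ (suc j) k x = iter-+ j k (f x)

    iter-preserves : (P : A → Set) → (∀ x → P x → P (f x)) → ∀ k x → P x → P (iter k x)
    iter-preserves P h zero    x p = p
    iter-preserves P h (suc k) x p = iter-preserves P h k (f x) (h x p)

    iter-fixed : ∀ {x} → f x ≡ x → ∀ k → iter k x ≡ x
    iter-fixed e zero    = refl
    iter-fixed e (suc k) = trans (cong (iter k) e) (iter-fixed e k)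

    iter-* : ∀ {d x} → iter d x ≡ x → ∀ k → iter (k * d) x ≡ x
    iter-* e zero    = refl
    iter-* {d} e (suc k) = trans (iter-+ d (k * d) _) (trans (cong (iter (k * d)) e) (iter-* e k))

    module Periodic {p} (pr : Prime p) (period : ∀ x → iter p x ≡ x) where

      private instance
        p≢0 : NonZero p
        p≢0 = prime⇒nonZero pr

      iter-% : ∀ k x → iter k x ≡ iter (k % p) x
      iter-% k x = begin
        iter k x                                   ≡⟨ cong (λ m → iter m x) (m≡m%n+[m/n]*n k p) ⟩
        iter (k % p + k / p * p) x                 ≡⟨ iter-+ (k % p) _ x ⟩
        iter (k / p * p) (iter (k % p) x)          ≡⟨ iter-* (period _) (k / p) ⟩
        iter (k % p) x                             ∎
        where open ≡-Reasoning

      private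
        cong-iter : ∀ k .{{_ : NonZero k}} {x y} → f x ≡ f y → iter k x ≡ iter k y
        cong-iter (suc k) e = cong (iter k) e

      f-injective : ∀ {x y} → f x ≡ f y → x ≡ y
      f-injective {x} {y} e = trans (sym (period x)) (trans (cong-iter p e) (period y))

      iter-cancel : ∀ k {x y} → iter k x ≡ iter k y → x ≡ y
      iter-cancel zero    e = e
      iter-cancel (suc k) e = f-injective (iter-cancel k e)

      -- As d is prime to p, Bézout makes a multiple of d and a multiple of p differ by 1. Both
      -- multiples fix x, so one more application of f fixes it as well.
      iter-fixed⁻ : ∀ {d x} → 0 < d → d < p → iter d x ≡ x → f x ≡ x
      iter-fixed⁻ {d} {x} 0<d d<p e with coprime-Bézout (prime⇒coprime pr {{>-nonZero 0<d}} d<p)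
      ... | Bézout.+- a b eq = iter-cancel (b * d) (trans (cong (λ k → iter k x) eq) (trans (iter-* (period x) a) (sym (iter-* e b))))
      ... | Bézout.-+ a b eq = iter-cancel (a * p) (trans (cong (λ k → iter k x) eq) (trans (iter-* e b) (sym (iter-* (period x) a))))

      private
        ordered : ∀ {i j x} → i < j → j < p → iter i x ≡ iter j x → f x ≡ x
        ordered {i} {j} {x} i<j j<p e =
          iter-cancel i (trans (iter-suc i x)
            (iter-fixed⁻ (m<n⇒0<n∸m i<j) (≤-<-trans (m∸n≤m j i) j<p) (begin
              iter (j ∸ i) (iter i x) ≡⟨ iter-+ i (j ∸ i) x ⟨
              iter (i + (j ∸ i)) x    ≡⟨ cong (λ k → iter k x) (m+[n∸m]≡n (<⇒≤ i<j)) ⟩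
              iter j x                ≡⟨ e ⟨
              iter i x                ∎)))
          where open ≡-Reasoning

      iter-injective : ∀ {i j x} → f x ≢ x → i < p → j < p → iter i x ≡ iter j x → i ≡ j
      iter-injective {i} {j} moved i<p j<p e with <-cmp i j
      ... | tri< i<j _ _ = contradiction (ordered i<j j<p e) moved
      ... | tri≈ _ i≡j _ = i≡j
      ... | tri> _ _ j<i = contradiction (ordered j<i i<p (sym e)) moved

      iterᶠ-injective : ∀ {x} → f x ≢ x → (i j : Fin p) → iter (toℕ i) x ≡ iter (toℕ j) x → i ≡ j
      iterᶠ-injective moved i j e = toℕ-injective (iter-injective moved (toℕ<n i) (toℕ<n j) e)

  module _ {n p} (pr : Prime p) (f : Fin n → Fin n) (period : ∀ x → iter f p x ≡ x) where

    open Periodic f pr period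

    private instance
      p≢0 : NonZero p
      p≢0 = prime⇒nonZero pr

    private
      Orbit : Fin n → Pred (Fin n) 0ℓ
      Orbit x y = ∃ λ (i : Fin p) → iter f (toℕ i) x ≡ y

      orbit? : ∀ x → Decidable (Orbit x)
      orbit? x y = any? λ i → iter f (toℕ i) x ≟ y

      orbit : ∀ x k → Orbit x (iter f k x)
      orbit x k = fromℕ< (m%n<n k p) , trans (cong (λ m → iter f m x) (toℕ-fromℕ< (m%n<n k p))) (sym (iter-% k x))

      orbit-size : ∀ {x} → f x ≢ x → count (orbit? x) ≡ p
      orbit-size {x} moved = ≤-antisym bound
        (begin
          p                                  ≡⟨ count-all {n = p} (λ i → yes tt) (λ i → tt) ⟨
          count {n = p} (λ i → yes tt)       ≤⟨ count-image (λ i → yes tt) (orbit? x) (λ i → iter f (toℕ i) x) (λ i _ → i , refl) (λ i j _ _ → iterᶠ-injective moved i j) ⟩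
          count (orbit? x)                   ∎)
        where
        open ≤-Reasoning
        L = listing (orbit? x)
        open Listing L
        bound : count (orbit? x) ≤ p
        bound = injective⇒≤ {f = λ i → proj₁ (member i)} λ {i} {j} e →
          injective i j (trans (sym (proj₂ (member i))) (trans (cong (λ k → iter f (toℕ k) x) e) (proj₂ (member j))))

    -- Every orbit in P has exactly p points. Orbits are removed one at a time, by induction on the
    -- number of points left.
    ∣-count : {P : Pred (Fin n) 0ℓ} (P? : Decidable P) → (∀ x → P x → P (f x)) → (∀ x → P x → f x ≢ x) → p ∣ count P?
    ∣-count P? = induct P? (<-wellFounded (count P?))
      where
      induct : {P : Pred (Fin n) 0ℓ} (P? : Decidable P) → Acc _<_ (count P?) →
               (∀ x → P x → P (f x)) → (∀ x → P x → f x ≢ x) → p ∣ count P?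
      induct {P} P? (acc smaller) closed moved with any? P?
      ... | no none = subst (p ∣_) (sym (count-none P? λ i pi → none (i , pi))) (p ∣0)
      ... | yes (x , px) = subst (p ∣_) (sym split) (∣m∣n⇒∣m+n (subst (p ∣_) (sym size) ∣-refl) (induct rest? (smaller less) closed′ λ y r → moved y (proj₁ r)))
        where
        rest? : Decidable (λ y → P y × ¬ Orbit x y)
        rest? y = P? y ×-dec ¬? (orbit? x y)
        split = count-split P? (orbit? x)
        size : count (λ y → P? y ×-dec orbit? x y) ≡ p
        size = trans (count-cong (λ y → P? y ×-dec orbit? x y) (orbit? x) (λ _ → proj₂)
                       λ { y (i , refl) → iter-preserves f P closed (toℕ i) x px , i , refl })
                     (orbit-size (moved x px))
        less : count rest? < count P?
        less = count-< rest? P? (λ _ → proj₁) x px λ r → proj₂ r (orbit x 0)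
        closed′ : ∀ y → P y × ¬ Orbit x y → P (f y) × ¬ Orbit x (f y)
        -- If f y = f^i x, then y = f^(i + p - 1) x, so a point outside the orbit of x cannot be
        -- mapped into it.
        closed′ y (py , out) = closed y py , λ (i , e) → out (subst (Orbit x)
          (f-injective (trans (sym (iter-suc f (toℕ i + pred p) x)) (trans (cong (λ m → iter f m x) (trans (sym (+-suc (toℕ i) (pred p))) (cong (toℕ i +_) (suc-pred p))))
            (trans (iter-+ f (toℕ i) p x) (trans (period _) e)))))
          (orbit x (toℕ i + pred p)))

    -- The fixed-point congruence for a cyclic group of order p: the moved points of P form a set
    -- closed under f, so their number is divisible by p.
    ∣-count-fixed : {P : Pred (Fin n) 0ℓ} (P? : Decidable P) → (∀ x → P x → P (f x)) → p ∣ count P? →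
                    p ∣ count (λ x → P? x ×-dec (f x ≟ x))
    ∣-count-fixed P? closed p∣ = ∣m+n∣m⇒∣n
      (subst (p ∣_) (trans (count-split P? (λ x → f x ≟ x)) (+-comm (count (λ x → P? x ×-dec (f x ≟ x))) _)) p∣)
      (∣-count (λ x → P? x ×-dec ¬? (f x ≟ x)) (λ x (px , moved) → closed x px , λ e → moved (f-injective e)) (λ x → proj₂))

-- Finite permutation groups, translates of subsets, and intersection density.

module FinGroup where

  open Counting
  open Orbits
  open import Algebra.Bundles using (Group)
  open import Algebra.Core using (Op₁; Op₂)
  open import Algebra.Structures using (IsGroup)
  import Algebra.Properties.Group as GroupProperties
  open import Data.Fin using (Fin; _≟_)
  open import Data.Fin.Properties using (any?)
  open import Data.Nat using (ℕ; zero; suc; _*_; _≤_; _<_; NonZero)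
  open import Data.Nat.Properties hiding (_≟_)
  open import Data.Product using (∃; _,_; _×_; proj₁; proj₂)
  open import Data.Sum using (_⊎_)
  open import Level using (0ℓ)
  open import Relation.Binary.PropositionalEquality
  open import Relation.Nullary using (yes; no; contradiction; ¬?)
  open import Relation.Unary using (Pred; Decidable)

  -- Group elements are numbers below N, so that sets of them can be searched and counted;
  -- faithfulness turns equations between elements into pointwise ones.
  record FiniteAction (N n : ℕ) : Set where
    infixl 7 _∙_
    infix  8 _⁻¹
    field
      _∙_      : Op₂ (Fin N)
      ε        : Fin N
      _⁻¹      : Op₁ (Fin N)
      isGroup  : IsGroup _≡_ _∙_ ε _⁻¹
      act      : Fin N → Fin n → Fin n
      act-ε    : ∀ ω → act ε ω ≡ ω
      act-∙    : ∀ g h ω → act (g ∙ h) ω ≡ act h (act g ω)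
      faithful : ∀ {g h} → (∀ ω → act g ω ≡ act h ω) → g ≡ h

    group : Group 0ℓ 0ℓ
    group = record { isGroup = isGroup }

    open IsGroup isGroup public using (assoc; identityˡ; identityʳ; inverseˡ; inverseʳ)
    open GroupProperties group public using (∙-cancelˡ; ∙-cancelʳ; ⁻¹-anti-homo-∙; ⁻¹-involutive; ε⁻¹≈ε)

    El : Set
    El = Fin N

    x∙y∙y⁻¹ : ∀ x y → (x ∙ y) ∙ y ⁻¹ ≡ x
    x∙y∙y⁻¹ x y = trans (assoc x y _) (trans (cong (x ∙_) (inverseʳ y)) (identityʳ x))

    x∙y⁻¹∙y : ∀ x y → (x ∙ y ⁻¹) ∙ y ≡ x
    x∙y⁻¹∙y x y = trans (assoc x _ y) (trans (cong (x ∙_) (inverseˡ y)) (identityʳ x))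

    act-⁻¹ˡ : ∀ g ω → act (g ⁻¹) (act g ω) ≡ ω
    act-⁻¹ˡ g ω = trans (sym (act-∙ g _ ω)) (trans (cong (λ h → act h ω) (inverseʳ g)) (act-ε ω))

    act-⁻¹ʳ : ∀ g ω → act g (act (g ⁻¹) ω) ≡ ω
    act-⁻¹ʳ g ω = trans (sym (act-∙ _ g ω)) (trans (cong (λ h → act h ω) (inverseˡ g)) (act-ε ω))

    act-injective : ∀ g {α β} → act g α ≡ act g β → α ≡ β
    act-injective g {α} {β} e = trans (sym (act-⁻¹ˡ g α)) (trans (cong (act (g ⁻¹)) e) (act-⁻¹ˡ g β))

    infixr 9 _^_
    _^_ : El → ℕ → El
    g ^ zero  = ε
    g ^ suc k = g ∙ g ^ k

    act-^ : ∀ g k ω → act (g ^ k) ω ≡ iter (act g) k ω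
    act-^ g zero    ω = act-ε ω
    act-^ g (suc k) ω = trans (act-∙ g _ ω) (act-^ g k (act g ω))

    conj : El → El → El
    conj g x = g ⁻¹ ∙ x ∙ g

    act-conj : ∀ g x ω → act (conj g x) (act g ω) ≡ act g (act x ω)
    act-conj g x ω = trans (act-∙ _ g _) (cong (act g) (trans (act-∙ _ x _) (cong (act x) (act-⁻¹ˡ g ω))))

    conj-∙ : ∀ g x y → conj g (x ∙ y) ≡ conj g x ∙ conj g y
    conj-∙ g x y = sym (begin
      (g ⁻¹ ∙ x ∙ g) ∙ (g ⁻¹ ∙ y ∙ g)      ≡⟨ cong ((g ⁻¹ ∙ x ∙ g) ∙_) (assoc _ y g) ⟩
      (g ⁻¹ ∙ x ∙ g) ∙ (g ⁻¹ ∙ (y ∙ g))    ≡⟨ assoc _ _ _ ⟨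
      (g ⁻¹ ∙ x ∙ g) ∙ g ⁻¹ ∙ (y ∙ g)      ≡⟨ cong (_∙ (y ∙ g)) (x∙y∙y⁻¹ _ g) ⟩
      g ⁻¹ ∙ x ∙ (y ∙ g)                   ≡⟨ assoc _ y g ⟨
      g ⁻¹ ∙ x ∙ y ∙ g                     ≡⟨ cong (_∙ g) (assoc _ x y) ⟩
      g ⁻¹ ∙ (x ∙ y) ∙ g                   ∎)
      where open ≡-Reasoning

    conj-ε : ∀ g → conj g ε ≡ ε
    conj-ε g = trans (cong (_∙ g) (identityʳ _)) (inverseˡ g)

    conj-^ : ∀ g x k → conj g (x ^ k) ≡ conj g x ^ k
    conj-^ g x zero    = conj-ε g
    conj-^ g x (suc k) = trans (conj-∙ g x _) (cong (conj g x ∙_) (conj-^ g x k))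

    ε^ : ∀ k → ε ^ k ≡ ε
    ε^ zero    = refl
    ε^ (suc k) = trans (identityˡ _) (ε^ k)

    ^-suc : ∀ x k → x ^ suc k ≡ x ^ k ∙ x
    ^-suc x zero    = trans (identityʳ x) (sym (identityˡ x))
    ^-suc x (suc k) = trans (cong (x ∙_) (^-suc x k)) (sym (assoc x _ x))

    iter-∙ : ∀ x k y → iter (_∙ x) k y ≡ y ∙ x ^ k
    iter-∙ x zero    y = sym (identityʳ y)
    iter-∙ x (suc k) y = trans (iter-∙ x k (y ∙ x)) (assoc y x _)

    period : ∀ x p → x ^ p ≡ ε → ∀ ω → iter (act x) p ω ≡ ω
    period x p e ω = trans (sym (act-^ x p ω)) (trans (cong (λ g → act g ω) e) (act-ε ω))

    ^-from-action : ∀ x p → (∀ ω → iter (act x) p ω ≡ ω) → x ^ p ≡ ε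
    ^-from-action x p h = faithful λ ω → trans (act-^ x p ω) (trans (h ω) (sym (act-ε ω)))

    moves : ∀ {x} → x ≢ ε → ∃ λ ω → act x ω ≢ ω
    moves {x} x≢ε with any? (λ ω → ¬? (act x ω ≟ ω))
    ... | yes found = found
    ... | no none   = contradiction (faithful λ ω → trans (fixes ω) (sym (act-ε ω))) x≢ε
      where
      fixes : ∀ ω → act x ω ≡ ω
      fixes ω with act x ω ≟ ω
      ... | yes e = e
      ... | no  m = contradiction (ω , m) none

    Transitiveᵃ : Set
    Transitiveᵃ = ∀ α β → ∃ λ g → act g α ≡ β

    Agree : El → El → Set
    Agree g h = ∃ λ ω → act g ω ≡ act h ω

    agree-cancel : ∀ g {x y} → Agree (g ∙ x) (g ∙ y) → Agree x y
    agree-cancel g {x} {y} (ω , e) = act g ω , trans (sym (act-∙ g x ω)) (trans e (act-∙ g y ω))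

    Intersectingᵃ : Pred El 0ℓ → Set
    Intersectingᵃ P = ∀ g h → P g → P h → Agree g h

    fixes? : ∀ ω → Decidable (λ g → act g ω ≡ ω)
    fixes? ω g = act g ω ≟ ω

    -- The analogue of `DensityIs` with decidable predicates in place of sublists, so that unions
    -- and translates of families need no list manipulation.
    Density : ℕ → ℕ → Set₁
    Density a b = ∃ λ (P : Pred El 0ℓ) → ∃ λ (P? : Decidable P) → Intersectingᵃ P ×
      (∀ {Q} (Q? : Decidable Q) → Intersectingᵃ Q → count Q? ≤ count P?) ×
      (∀ ω → count P? * b ≡ a * count (fixes? ω))

    Density1-3/2-3 : Set₁
    Density1-3/2-3 = Density 1 1 ⊎ Density 3 2 ⊎ Density 3 1

    module _ {P : Pred El 0ℓ} (P? : Decidable P) where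

      count-translate : ∀ h → count (λ g → P? (g ∙ h)) ≡ count P?
      count-translate h = sym (sum-bijection _ (_∙ h) (_∙ h ⁻¹) (λ y → x∙y⁻¹∙y y h) (λ x → x∙y∙y⁻¹ x h))

      -- Pairs (g, j) with g s_j in P, counted by j first: right multiplication by s_j is a
      -- bijection, so each j contributes |P|. Upper and lower bounds for |P| both start from this
      -- sum.
      count-translates : ∀ {c} (s : Fin c → El) → ∑[ g < N ] (count λ j → P? (g ∙ s j)) ≡ c * count P?
      count-translates {c} s = trans (∑-comm (λ g j → 𝟙 (P? (g ∙ s j))))
        (trans (sum-cong-≗ λ j → count-translate (s j)) (sum-const c _))

      translates-cover : ∀ {c} (s : Fin c → El) → (∀ g → ∃ λ j → P (g ∙ s j)) → N ≤ c * count P?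
      translates-cover {c} s cover = begin
        N                                              ≡⟨ trans (sum-const N 1) (*-identityʳ N) ⟨
        ∑[ g < N ] 1                                   ≤⟨ sum-mono (λ g → count-positive (λ j → P? (g ∙ s j)) _ (proj₂ (cover g))) ⟩
        ∑[ g < N ] (count λ j → P? (g ∙ s j))          ≡⟨ count-translates s ⟩
        c * count P?                                   ∎
        where open ≤-Reasoning

      translates-disjoint : ∀ {c} (s : Fin c → El) → (∀ g i j → P (g ∙ s i) → P (g ∙ s j) → i ≡ j) → c * count P? ≤ N
      translates-disjoint {c} s disj = begin
        c * count P?                                   ≡⟨ count-translates s ⟨
        ∑[ g < N ] (count λ j → P? (g ∙ s j))          ≤⟨ sum-≤-const (λ g → count-≤1 (λ j → P? (g ∙ s j)) (disj g)) ⟩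
        N * 1                                          ≡⟨ *-identityʳ N ⟩
        N                                              ∎
        where open ≤-Reasoning

      clique-bound : ∀ {c} (s : Fin c → El) → (∀ i j → Agree (s i) (s j) → i ≡ j) →
                     Intersectingᵃ P → c * count P? ≤ N
      clique-bound s clique int = translates-disjoint s λ g i j p q → clique i j (agree-cancel g (int _ _ p q))

    stabiliser-intersecting : ∀ ω → Intersectingᵃ (λ g → act g ω ≡ ω)
    stabiliser-intersecting ω g h p q = ω , trans p (sym q)

    module _ (transitive : Transitiveᵃ) where

      -- With s_α carrying α to ω, the product g s_α lies in the stabiliser exactly when g carries ω
      -- to α, so for each g precisely one α works.
      orbit-stabiliser : ∀ ω → n * count (fixes? ω) ≡ N
      orbit-stabiliser ω = ≤-antisym (translates-disjoint (fixes? ω) s disj) (translates-cover (fixes? ω) s cover)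
        where
        s : Fin n → El
        s α = proj₁ (transitive α ω)
        s-act : ∀ α → act (s α) α ≡ ω
        s-act α = proj₂ (transitive α ω)
        preimage : ∀ g i → act (g ∙ s i) ω ≡ ω → act g ω ≡ i
        preimage g i p = act-injective (s i) (trans (sym (act-∙ g (s i) ω)) (trans p (sym (s-act i))))
        disj : ∀ g i j → act (g ∙ s i) ω ≡ ω → act (g ∙ s j) ω ≡ ω → i ≡ j
        disj g i j p q = trans (sym (preimage g i p)) (preimage g j q)
        cover : ∀ g → ∃ λ j → act (g ∙ s j) ω ≡ ω
        cover g = act g ω , trans (act-∙ g _ ω) (s-act (act g ω))

      -- Largest families of size N / c, measured against stabilisers of size N / n, give density n
      -- / c; the last argument expresses this ratio without division.
      density : ∀ c .{{_ : NonZero c}} {P} (P? : Decidable P) → Intersectingᵃ P → N ≤ c * count P? →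
                (∀ {Q} (Q? : Decidable Q) → Intersectingᵃ Q → c * count Q? ≤ N) →
                ∀ a b → (∀ k s → c * k ≡ n * s → k * b ≡ a * s) → Density a b
      density c {P} P? int lower upper a b ratio = P , P? , int
        , (λ Q? q → *-cancelˡ-≤ c (≤-trans (upper Q? q) lower))
        , λ ω → ratio _ _ (trans (≤-antisym (upper P? int) lower) (sym (orbit-stabiliser ω)))

      clique-density : .{{_ : NonZero n}} → Fin n → (s : Fin n → El) → (∀ i j → Agree (s i) (s j) → i ≡ j) → Density 1 1
      clique-density ω s clique = density n (fixes? ω) (stabiliser-intersecting ω)
        (≤-reflexive (sym (orbit-stabiliser ω))) (λ Q? → clique-bound Q? s clique)
        1 1 λ k s e → trans (*-identityʳ k) (trans (*-cancelˡ-≡ k s n e) (sym (*-identityˡ s)))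

-- Cauchy's theorem, in a counting form for subgroups.

module Cauchy where

  open Counting
  open Orbits
  open FinGroup
  open import Data.Fin using (Fin; zero; suc; _≟_; combine; remQuot)
  open import Data.Fin.Properties using (remQuot-combine; combine-remQuot)
  open import Data.List using (List; []; _∷_; _++_; length; replicate; drop)
  open import Data.List.Properties using (++-assoc; ++-identityʳ; length-++; length-replicate; ∷-injective; ∷ʳ-injective)
  open import Data.List.Relation.Unary.All using (All; []; _∷_; all?)
  open import Data.List.Relation.Unary.All.Properties using (++⁺; drop⁺; replicate⁺)
  open import Data.Nat using (ℕ; zero; suc; _*_; _^_; _≤_; _<_; nonTrivial⇒n>1; >-nonZero; s≤s)
  open import Data.Nat.Divisibility using (_∣_; ∣m⇒∣m*n; ∣⇒≤)
  open import Data.Nat.Primality using (Prime; prime⇒nonTrivial; ¬prime[0])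
  open import Data.Nat.Properties hiding (_≟_)
  open import Data.Product using (∃; _,_; _×_; proj₁; proj₂; uncurry)
  open import Data.Unit using (⊤; tt)
  open import Level using (0ℓ)
  open import Relation.Binary.PropositionalEquality
  open import Relation.Nullary using (yes; no; contradiction; _×-dec_)
  open import Relation.Unary using (Pred; Decidable)

  rotate : {A : Set} → List A → List A
  rotate []       = []
  rotate (x ∷ xs) = xs ++ x ∷ []

  iter-rotate : {A : Set} (xs ys : List A) → iter rotate (length xs) (xs ++ ys) ≡ ys ++ xs
  iter-rotate []       ys = sym (++-identityʳ ys)
  iter-rotate (x ∷ xs) ys = begin
    iter rotate (length xs) ((xs ++ ys) ++ x ∷ [])  ≡⟨ cong (iter rotate (length xs)) (++-assoc xs ys _) ⟩
    iter rotate (length xs) (xs ++ (ys ++ x ∷ []))  ≡⟨ iter-rotate xs _ ⟩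
    (ys ++ x ∷ []) ++ xs                            ≡⟨ ++-assoc ys _ xs ⟩
    ys ++ x ∷ xs                                    ∎
    where open ≡-Reasoning

  iter-rotate-length : {A : Set} (xs : List A) → iter rotate (length xs) xs ≡ xs
  iter-rotate-length xs = trans (cong (iter rotate (length xs)) (sym (++-identityʳ xs))) (iter-rotate xs [])

  rotation-invariant : {A : Set} (x : A) (xs : List A) → xs ++ x ∷ [] ≡ x ∷ xs → xs ≡ replicate (length xs) x
  rotation-invariant x []       e = refl
  rotation-invariant x (y ∷ ys) e with refl ← proj₁ (∷-injective e) = cong (x ∷_) (rotation-invariant x ys (proj₂ (∷-injective e)))

  module Tuples {N : ℕ} (pad : Fin N) where

    -- Numbers the lists of length k, so that the counting lemmas for `Fin` apply to tuples; the
    -- padding of shorter lists is an arbitrary choice.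
    encode : ∀ k → List (Fin N) → Fin (N ^ k)
    encode zero    _        = zero
    encode (suc k) []       = combine pad (encode k [])
    encode (suc k) (x ∷ xs) = combine x (encode k xs)

    decode : ∀ k → Fin (N ^ k) → List (Fin N)
    decode zero    _ = []
    decode (suc k) i = proj₁ (remQuot (N ^ k) i) ∷ decode k (proj₂ (remQuot {N} (N ^ k) i))

    length-decode : ∀ k i → length (decode k i) ≡ k
    length-decode zero    i = refl
    length-decode (suc k) i = cong suc (length-decode k _)

    encode-decode : ∀ k i → encode k (decode k i) ≡ i
    encode-decode zero    zero = refl
    encode-decode (suc k) i    = trans (cong (combine (proj₁ (remQuot {N} (N ^ k) i))) (encode-decode k _)) (combine-remQuot {N} (N ^ k) i)

    decode-combine : ∀ k x i → decode (suc k) (combine x i) ≡ x ∷ decode k i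
    decode-combine k x i = cong (λ q → proj₁ q ∷ decode k (proj₂ q)) (remQuot-combine x i)

    decode-encode : ∀ xs → decode (length xs) (encode (length xs) xs) ≡ xs
    decode-encode []       = refl
    decode-encode (x ∷ xs) = trans (decode-combine _ x _) (cong (x ∷_) (decode-encode xs))

    count-tuples : {H : Pred (Fin N) 0ℓ} (H? : Decidable H) → ∀ k → count (λ i → all? H? (decode k i)) ≡ count H? ^ k
    count-tuples H? zero    = refl
    count-tuples H? (suc k) = begin
      count (λ i → all? H? (decode (suc k) i))                              ≡⟨ sum-combine N (λ i → 𝟙 (all? H? (decode (suc k) i))) ⟩
      ∑[ x < N ] ∑[ i < N ^ k ] 𝟙 (all? H? (decode (suc k) (combine x i)))  ≡⟨ sum-cong-≗ (λ x → trans (sum-cong-≗ (term x)) (sym (*-distribˡ-sum (𝟙 (H? x)) (λ i → 𝟙 (all? H? (decode k i)))))) ⟩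
      ∑[ x < N ] (𝟙 (H? x) * count (λ i → all? H? (decode k i)))            ≡⟨ *-distribʳ-sum (count λ i → all? H? (decode k i)) (λ x → 𝟙 (H? x)) ⟨
      count H? * count (λ i → all? H? (decode k i))                         ≡⟨ cong (count H? *_) (count-tuples H? k) ⟩
      count H? * count H? ^ k                                               ∎
      where
      open ≡-Reasoning
      term : ∀ x i → 𝟙 (all? H? (decode (suc k) (combine x i))) ≡ 𝟙 (H? x) * 𝟙 (all? H? (decode k i))
      term x i = begin
        𝟙 (all? H? (decode (suc k) (combine x i)))   ≡⟨ cong (λ l → 𝟙 (all? H? l)) (decode-combine k x i) ⟩
        𝟙 (all? H? (x ∷ decode k i))                 ≡⟨ 𝟙-cong (all? H? (x ∷ decode k i)) (H? x ×-dec all? H? (decode k i)) (λ { (h ∷ hs) → h , hs }) (uncurry _∷_) ⟩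
        𝟙 (H? x ×-dec all? H? (decode k i))          ≡⟨ 𝟙-× (H? x) (all? H? (decode k i)) ⟩
        𝟙 (H? x) * 𝟙 (all? H? (decode k i))          ∎

  module _ {N n} (G : FiniteAction N n) where
    open FiniteAction G renaming (_^_ to _^ᴳ_)

    record Subgroup (H : Pred El 0ℓ) : Set where
      field
        ε∈ : H ε
        ∙∈ : ∀ {x y} → H x → H y → H (x ∙ y)
        ⁻¹∈ : ∀ {x} → H x → H (x ⁻¹)

    -- Right multiplication by x permutes H with period p and without fixed points.
    ∣-subgroup : ∀ {p} → Prime p → ∀ {H} (H? : Decidable H) → Subgroup H → ∀ {x} → H x → x ≢ ε → x ^ᴳ p ≡ ε → p ∣ count H?
    ∣-subgroup {p} pr H? sub {x} hx x≢ε e = ∣-count pr (_∙ x) (λ y → trans (iter-∙ x p y) (trans (cong (y ∙_) e) (identityʳ y)))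
      H? (λ y hy → Subgroup.∙∈ sub hy hx) λ y _ e → x≢ε (∙-cancelˡ y x ε (trans e (sym (identityʳ y))))

    product : List El → El
    product []       = ε
    product (x ∷ xs) = x ∙ product xs

    product-++ : ∀ xs ys → product (xs ++ ys) ≡ product xs ∙ product ys
    product-++ []       ys = sym (identityˡ _)
    product-++ (x ∷ xs) ys = trans (cong (x ∙_) (product-++ xs ys)) (sym (assoc x _ _))

    product-replicate : ∀ k x → product (replicate k x) ≡ x ^ᴳ k
    product-replicate zero    x = refl
    product-replicate (suc k) x = cong (x ∙_) (product-replicate k x)

    -- A p-tuple with product ε is stored as its first p - 1 entries, which are free; this restores
    -- the last one.
    complete : List El → List El
    complete xs = xs ++ product xs ⁻¹ ∷ []

    shiftᵗ : List El → List El
    shiftᵗ xs = drop 1 (complete xs)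

    -- The entry that completes the shifted tuple turns out to be the dropped first entry, so
    -- shifting the stored part rotates the whole tuple.
    complete-shift : ∀ xs → complete (shiftᵗ xs) ≡ rotate (complete xs)
    complete-shift []       = cong (_∷ []) refl
    complete-shift (x ∷ xs) = cong (λ y → (xs ++ z ∷ []) ++ y ∷ []) (begin
      product (xs ++ z ∷ []) ⁻¹          ≡⟨ cong _⁻¹ (trans (product-++ xs _) (cong (product xs ∙_) (identityʳ z))) ⟩
      (product xs ∙ z) ⁻¹                ≡⟨ cong (λ y → (product xs ∙ y) ⁻¹) (⁻¹-anti-homo-∙ x (product xs)) ⟩
      (product xs ∙ (product xs ⁻¹ ∙ x ⁻¹)) ⁻¹  ≡⟨ cong _⁻¹ (trans (sym (assoc _ _ _)) (trans (cong (_∙ x ⁻¹) (inverseʳ _)) (identityˡ _))) ⟩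
      (x ⁻¹) ⁻¹                          ≡⟨ ⁻¹-involutive x ⟩
      x                                  ∎)
      where
      open ≡-Reasoning
      z = (x ∙ product xs) ⁻¹

    length-∷ʳ : ∀ (xs : List El) {z} → length (xs ++ z ∷ []) ≡ suc (length xs)
    length-∷ʳ xs = trans (length-++ xs) (+-comm (length xs) 1)

    length-shift : ∀ xs → length (shiftᵗ xs) ≡ length xs
    length-shift []       = refl
    length-shift (x ∷ xs) = length-∷ʳ xs

    complete-injective : ∀ xs ys → complete xs ≡ complete ys → xs ≡ ys
    complete-injective xs ys e = proj₁ (∷ʳ-injective xs ys e)

    -- McKay: the p-tuples over H with product ε are rotated by a group of order p.
    module McKay {k} (pr : Prime (suc k)) {H : Pred El 0ℓ} (H? : Decidable H) (sub : Subgroup H) (p∣H : suc k ∣ count H?) where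
      open Subgroup sub
      open Tuples {N} ε

      roots? : Decidable (λ x → H x × x ^ᴳ suc k ≡ ε)
      roots? x = H? x ×-dec (x ^ᴳ suc k ≟ ε)

      private
        τ : Fin (N ^ k) → Fin (N ^ k)
        τ i = encode k (shiftᵗ (decode k i))

        decode-encodeₖ : ∀ xs → length xs ≡ k → decode k (encode k xs) ≡ xs
        decode-encodeₖ xs refl = decode-encode xs

        decode-τ : ∀ i → decode k (τ i) ≡ shiftᵗ (decode k i)
        decode-τ i = decode-encodeₖ _ (trans (length-shift (decode k i)) (length-decode k i))

        decode-injective : ∀ {i j} → decode k i ≡ decode k j → i ≡ j
        decode-injective {i} {j} e = trans (sym (encode-decode k i)) (trans (cong (encode k) e) (encode-decode k j))

        complete-iter : ∀ m i → complete (decode k (iter τ m i)) ≡ iter rotate m (complete (decode k i))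
        complete-iter zero    i = refl
        complete-iter (suc m) i = trans (complete-iter m (τ i)) (cong (iter rotate m)
          (trans (cong complete (decode-τ i)) (complete-shift (decode k i))))

        τ-period : ∀ i → iter τ (suc k) i ≡ i
        τ-period i = decode-injective (complete-injective _ _ (trans (complete-iter (suc k) i)
          (trans (cong (λ m → iter rotate m l) (sym (trans (length-∷ʳ (decode k i)) (cong suc (length-decode k i)))))
                 (iter-rotate-length l))))
          where l = complete (decode k i)

        In : Pred (Fin (N ^ k)) 0ℓ
        In i = All H (decode k i)

        in? : Decidable In
        in? i = all? H? (decode k i)

        product∈ : ∀ {xs} → All H xs → H (product xs)
        product∈ []       = ε∈
        product∈ (h ∷ hs) = ∙∈ h (product∈ hs)

        complete∈ : ∀ {xs} → All H xs → All H (complete xs)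
        complete∈ hs = ++⁺ hs (⁻¹∈ (product∈ hs) ∷ [])

        τ∈ : ∀ i → In i → In (τ i)
        τ∈ i hs = subst (All H) (sym (decode-τ i)) (drop⁺ 1 (complete∈ hs))

        fixed? : Decidable (λ i → In i × τ i ≡ i)
        fixed? i = in? i ×-dec (τ i ≟ i)

        0<k : 0 < k
        0<k with nonTrivial⇒n>1 (suc k) {{prime⇒nonTrivial pr}}
        ... | s≤s q = q

        -- There are |H|^k tuples with k > 0, a multiple of p. The fixed ones are constant, and a
        -- constant tuple has product ε exactly when its entry is a p-th root of ε.
        p∣fixed : suc k ∣ count fixed?
        p∣fixed = ∣-count-fixed pr τ τ-period in? τ∈ (subst (suc k ∣_) (sym (count-tuples H? k)) (divides-power k 0<k))
          where
          divides-power : ∀ m → 0 < m → suc k ∣ count H? ^ m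
          divides-power (suc m) _ = ∣m⇒∣m*n _ p∣H

        shift-invariant : ∀ xs → 0 < length xs → shiftᵗ xs ≡ xs → ∃ λ x → xs ≡ replicate (length xs) x
        shift-invariant (x ∷ xs) _ fixed = x , trans (sym fixed)
          (trans (rotation-invariant x _ (trans (sym (complete-shift (x ∷ xs))) (cong complete fixed)))
                 (cong (λ m → replicate m x) (length-shift (x ∷ xs))))

        diagonal : ∀ i → τ i ≡ i → ∃ λ x → decode k i ≡ replicate k x
        diagonal i e with x , eq ← shift-invariant (decode k i) (subst (0 <_) (sym (length-decode k i)) 0<k) (trans (sym (decode-τ i)) (cong (decode k) e))
          = x , trans eq (cong (λ m → replicate m x) (length-decode k i))

        fixed-power : ∀ x → shiftᵗ (replicate k x) ≡ replicate k x → x ^ᴳ suc k ≡ ε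
        fixed-power x e = begin
          x ∙ x ^ᴳ k                ≡⟨ ^-suc x k ⟩
          x ^ᴳ k ∙ x                ≡⟨ cong (_∙ x) (product-replicate k x) ⟨
          product (replicate k x) ∙ x  ≡⟨ cong (product (replicate k x) ∙_) (last k 0<k e) ⟨
          product (replicate k x) ∙ product (replicate k x) ⁻¹ ≡⟨ inverseʳ _ ⟩
          ε ∎
          where
          open ≡-Reasoning
          snoc : ∀ m (z : El) → replicate m x ++ z ∷ [] ≡ replicate (suc m) x → z ≡ x
          snoc zero    z e = proj₁ (∷-injective e)
          snoc (suc m) z e = snoc m z (proj₂ (∷-injective e))
          last : ∀ m → 0 < m → shiftᵗ (replicate m x) ≡ replicate m x → product (replicate m x) ⁻¹ ≡ x
          last (suc m) _ e = snoc m _ e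

        power-fixed : ∀ x → x ^ᴳ suc k ≡ ε → shiftᵗ (replicate k x) ≡ replicate k x
        power-fixed x e = trans (cong (λ z → drop 1 (replicate k x ++ z ∷ [])) inv) (snoc k)
          where
          inv : product (replicate k x) ⁻¹ ≡ x
          inv = ∙-cancelˡ (product (replicate k x)) _ _ (trans (inverseʳ _) (sym (trans (cong (_∙ x) (product-replicate k x)) (trans (sym (^-suc x k)) e))))
          snoc : ∀ m → drop 1 (replicate m x ++ x ∷ []) ≡ replicate m x
          snoc zero    = refl
          snoc (suc m) = go m
            where
            go : ∀ m → replicate m x ++ x ∷ [] ≡ replicate (suc m) x
            go zero    = refl
            go (suc m) = cong (x ∷_) (go m)

        replicate-injective : ∀ {m} → 0 < m → ∀ {x y : El} → replicate m x ≡ replicate m y → x ≡ y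
        replicate-injective {suc m} _ e = proj₁ (∷-injective e)

        replicate∈⁻ : ∀ {m} → 0 < m → ∀ {x} → All H (replicate m x) → H x
        replicate∈⁻ {suc m} _ (h ∷ _) = h

        fixed≤roots : count fixed? ≤ count roots?
        fixed≤roots = count-image fixed? roots? root into inj
          where
          root : Fin (N ^ k) → El
          root i with τ i ≟ i
          ... | yes e = proj₁ (diagonal i e)
          ... | no _  = ε
          root-eq : ∀ i → τ i ≡ i → decode k i ≡ replicate k (root i)
          root-eq i e with τ i ≟ i
          ... | yes e′ = proj₂ (diagonal i e′)
          ... | no ¬e  = contradiction e ¬e
          into : ∀ i → In i × τ i ≡ i → H (root i) × root i ^ᴳ suc k ≡ ε
          into i (hs , e) = replicate∈⁻ 0<k (subst (All H) (root-eq i e) hs)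
                          , fixed-power _ (trans (cong shiftᵗ (sym (root-eq i e))) (trans (sym (decode-τ i)) (trans (cong (decode k) e) (root-eq i e))))
          inj : ∀ i j → In i × τ i ≡ i → In j × τ j ≡ j → root i ≡ root j → i ≡ j
          inj i j (_ , e) (_ , e′) eq = decode-injective (trans (root-eq i e) (trans (cong (replicate k) eq) (sym (root-eq j e′))))

        roots≤fixed : count roots? ≤ count fixed?
        roots≤fixed = count-image roots? fixed? (λ x → encode k (replicate k x))
          (λ x (h , e) → subst (All H) (sym (dec x)) (replicate⁺ k h)
                       , cong (encode k) (trans (cong shiftᵗ (dec x)) (power-fixed x e)))
          λ x y _ _ e → replicate-injective 0<k (trans (sym (dec x)) (trans (cong (decode k) e) (dec y)))
          where
          dec : ∀ x → decode k (encode k (replicate k x)) ≡ replicate k x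
          dec x = decode-encodeₖ _ (length-replicate k)

      p∣roots : suc k ∣ count roots?
      p∣roots = subst (suc k ∣_) (≤-antisym fixed≤roots roots≤fixed) p∣fixed

    -- Divisibility of the count, and not just existence of a root, allows the roots to be acted on
    -- again by conjugation and the fixed-point congruence to be applied a second time. It is stated
    -- for subgroups in order to cover the pointwise stabiliser of a block.
    ∣-roots : ∀ {p} → Prime p → ∀ {H} (H? : Decidable H) → Subgroup H → p ∣ count H? →
              p ∣ count (λ x → H? x ×-dec (x ^ᴳ p ≟ ε))
    ∣-roots {zero}  pr = contradiction pr ¬prime[0]
    ∣-roots {suc k} pr = McKay.p∣roots pr

    -- A nonempty set of size divisible by p has at least p ≥ 2 members.
    ∣-another : ∀ {p} → Prime p → ∀ {P : Pred El 0ℓ} (P? : Decidable P) → p ∣ count P? → P ε → ∃ λ x → P x × x ≢ ε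
    ∣-another {p} pr P? p∣ pε = another P? (≤-trans (nonTrivial⇒n>1 p {{prime⇒nonTrivial pr}})
      (∣⇒≤ {{>-nonZero (count-positive P? ε pε)}} p∣)) ε

    cauchy : ∀ {p} → Prime p → p ∣ N → ∃ λ x → x ^ᴳ p ≡ ε × x ≢ ε
    cauchy {p} pr p∣N =
      let x , (_ , e) , x≢ε = ∣-another pr (λ x → yes tt ×-dec (x ^ᴳ p ≟ ε)) (∣-roots pr (λ _ → yes tt) whole p∣whole) (tt , ε^ p)
      in  x , e , x≢ε
      where
      whole : Subgroup (λ _ → ⊤)
      whole = _
      p∣whole : p ∣ count {n = N} (λ _ → yes tt)
      p∣whole = subst (p ∣_) (sym (count-all {n = N} (λ _ → yes tt) λ _ → tt)) p∣N

-- From lists of permutations to finite actions, and back for the density.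

module PermAction where

  open import Defs
  open Counting
  open FinGroup
  open import Data.Bool using (true; false)
  open import Data.Fin using (Fin; zero; suc; _≟_)
  open import Data.List using (List; []; _∷_; length; filter)
  import Data.List as List
  open import Data.List.Membership.Propositional using (_∈_)
  open import Data.List.Membership.Propositional.Properties using (∈-lookup)
  open import Data.List.Relation.Binary.Sublist.Propositional using (_⊆_; []; _∷_; _∷ʳ_)
  open import Data.List.Relation.Unary.All as All using (All; []; _∷_)
  open import Data.List.Relation.Unary.AllPairs using ([]; _∷_)
  open import Data.List.Relation.Unary.Any using (here; there; index)
  open import Data.List.Relation.Unary.Any.Properties using (lookup-index)
  open import Data.List.Relation.Unary.Unique.Propositional using (Unique)
  open import Data.Nat using (ℕ; zero; suc; _*_; _≤_; z≤n)
  open import Data.Nat.Properties hiding (_≟_)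
  open import Data.Product using (∃; _,_; _×_; proj₁; proj₂)
  import Data.Sum as Sum
  open import Data.Vec using (lookup; tabulate)
  open import Data.Vec.Properties using (tabulate∘lookup; tabulate-cong; lookup∘tabulate; ≡-dec)
  open import Function using (_∘_)
  open import Level using (0ℓ)
  open import Relation.Binary.PropositionalEquality
  open import Relation.Nullary using (yes; no; contradiction; does)
  open import Relation.Unary using (Pred; Decidable)

  module _ {A : Set} where

    length-filter : ∀ {P : Pred A 0ℓ} (P? : Decidable P) xs → length (filter P? xs) ≡ count (λ i → P? (List.lookup xs i))
    length-filter P? []       = refl
    length-filter P? (x ∷ xs) with does (P? x)
    ... | true  = cong suc (length-filter P? xs)
    ... | false = length-filter P? xs

    length-sublist : ∀ {P : Pred A 0ℓ} (P? : Decidable P) {xs ys} → xs ⊆ ys → All P xs → length xs ≤ count (λ i → P? (List.lookup ys i))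
    length-sublist P? []         []       = z≤n
    length-sublist P? (y ∷ʳ s)   ps       = ≤-trans (length-sublist P? s ps) (m≤n+m _ (𝟙 (P? y)))
    length-sublist P? (refl ∷ s) (p ∷ ps) = +-mono-≤ (≤-reflexive (sym (𝟙-yes (P? _) p))) (length-sublist P? s ps)

    select : ∀ xs {P : Pred (Fin (length xs)) 0ℓ} → Decidable P → List A
    select []       P? = []
    select (x ∷ xs) P? with P? zero
    ... | yes _ = x ∷ select xs (P? ∘ suc)
    ... | no _  = select xs (P? ∘ suc)

    select-⊆ : ∀ xs {P : Pred (Fin (length xs)) 0ℓ} (P? : Decidable P) → select xs P? ⊆ xs
    select-⊆ []       P? = []
    select-⊆ (x ∷ xs) P? with P? zero
    ... | yes _ = refl ∷ select-⊆ xs (P? ∘ suc)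
    ... | no _  = x ∷ʳ select-⊆ xs (P? ∘ suc)

    length-select : ∀ xs {P : Pred (Fin (length xs)) 0ℓ} (P? : Decidable P) → length (select xs P?) ≡ count P?
    length-select []       P? = refl
    length-select (x ∷ xs) P? with P? zero
    ... | yes _ = cong suc (length-select xs (P? ∘ suc))
    ... | no _  = length-select xs (P? ∘ suc)

    ∈-select : ∀ xs {P : Pred (Fin (length xs)) 0ℓ} (P? : Decidable P) {x} → x ∈ select xs P? → ∃ λ i → P i × x ≡ List.lookup xs i
    ∈-select (x ∷ xs) P? x∈ with P? zero
    ∈-select (x ∷ xs) P? (here refl) | yes p = zero , p , refl
    ∈-select (x ∷ xs) P? (there x∈)  | yes p with i , q , e ← ∈-select xs (P? ∘ suc) x∈ = suc i , q , e
    ∈-select (x ∷ xs) P? x∈          | no _  with i , q , e ← ∈-select xs (P? ∘ suc) x∈ = suc i , q , e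

    unique-lookup : ∀ {xs : List A} → Unique xs → ∀ i j → List.lookup xs i ≡ List.lookup xs j → i ≡ j
    unique-lookup (_ ∷ _)  zero    zero    _ = refl
    unique-lookup (x∉ ∷ _) zero    (suc j) e = contradiction e (All.lookup x∉ (∈-lookup j))
    unique-lookup (x∉ ∷ _) (suc i) zero    e = contradiction (sym e) (All.lookup x∉ (∈-lookup i))
    unique-lookup (_ ∷ u)  (suc i) (suc j) e = cong suc (unique-lookup u i j e)

  perm-ext : ∀ {n} {g h : Perm n} → (∀ ω → lookup g ω ≡ lookup h ω) → g ≡ h
  perm-ext {g = g} {h} e = trans (sym (tabulate∘lookup g)) (trans (tabulate-cong e) (tabulate∘lookup h))

  module _ {n : ℕ} (G : PermGroup n) where

    size : ℕ
    size = length (elems G)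

    perm : Fin size → Perm n
    perm = List.lookup (elems G)

    perm∈ : ∀ g → perm g ∈G G
    perm∈ = ∈-lookup

    perm-injective : ∀ {g h} → perm g ≡ perm h → g ≡ h
    perm-injective = unique-lookup (unique G) _ _

    position : ∀ {g} → g ∈G G → Fin size
    position = index

    perm-position : ∀ {g} (g∈ : g ∈G G) → perm (position g∈) ≡ g
    perm-position g∈ = sym (lookup-index g∈)

    private
      infixl 7 _∙_
      _∙_ : Fin size → Fin size → Fin size
      g ∙ h = position (closed G (perm∈ g) (perm∈ h))

      ε : Fin size
      ε = position (hasId G)

      act : Fin size → Fin n → Fin n
      act g = lookup (perm g)

      act-ε : ∀ ω → act ε ω ≡ ω
      act-ε ω = trans (cong (λ g → lookup g ω) (perm-position (hasId G))) (lookup∘tabulate _ ω)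

      act-∙ : ∀ g h ω → act (g ∙ h) ω ≡ act h (act g ω)
      act-∙ g h ω = trans (cong (λ x → lookup x ω) (perm-position (closed G (perm∈ g) (perm∈ h)))) (lookup∘tabulate _ ω)

      faithful : ∀ {g h} → (∀ ω → act g ω ≡ act h ω) → g ≡ h
      faithful e = perm-injective (perm-ext e)

      assoc : ∀ f g h → (f ∙ g) ∙ h ≡ f ∙ (g ∙ h)
      assoc f g h = faithful λ ω → trans (act-∙ (f ∙ g) h ω) (trans (cong (act h) (act-∙ f g ω)) (sym (trans (act-∙ f (g ∙ h) ω) (act-∙ g h _))))

      identityˡ : ∀ g → ε ∙ g ≡ g
      identityˡ g = faithful λ ω → trans (act-∙ ε g ω) (cong (act g) (act-ε ω))

      identityʳ : ∀ g → g ∙ ε ≡ g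
      identityʳ g = faithful λ ω → trans (act-∙ g ε ω) (act-ε _)

      cancelʳ : ∀ g x y → x ∙ g ≡ y ∙ g → x ≡ y
      cancelʳ g x y e = faithful λ ω → perms G (perm∈ g) _ _ (trans (sym (act-∙ x g ω)) (trans (cong (λ z → act z ω) e) (act-∙ y g ω)))

      -- Inverses come from finiteness: right multiplication by g is injective, hence surjective,
      -- and so it attains ε.
      left-inverse : ∀ g → ∃ λ h → h ∙ g ≡ ε
      left-inverse g = injective⇒surjective (_∙ g) (cancelʳ g) ε

      _⁻¹ : Fin size → Fin size
      g ⁻¹ = proj₁ (left-inverse g)

      inverseˡ : ∀ g → (g ⁻¹) ∙ g ≡ ε
      inverseˡ g = proj₂ (left-inverse g)

      inverseʳ : ∀ g → g ∙ (g ⁻¹) ≡ ε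
      inverseʳ g = cancelʳ g _ _ (trans (assoc g _ g) (trans (cong (g ∙_) (inverseˡ g)) (trans (identityʳ g) (sym (identityˡ g)))))

    action : FiniteAction size n
    action = record
      { _∙_ = _∙_ ; ε = ε ; _⁻¹ = _⁻¹
      ; isGroup = record
        { isMonoid = record
          { isSemigroup = record { isMagma = record { isEquivalence = isEquivalence ; ∙-cong = cong₂ _∙_ } ; assoc = assoc }
          ; identity = identityˡ , identityʳ }
        ; inverse = inverseˡ , inverseʳ ; ⁻¹-cong = cong _⁻¹ }
      ; act = act ; act-ε = act-ε ; act-∙ = act-∙ ; faithful = faithful }

    open FiniteAction action using (Density; Density1-3/2-3; Transitiveᵃ)

    transitiveᵃ : Transitive G → Transitiveᵃ
    transitiveᵃ tr α β with g , g∈ , e ← tr α β = position g∈ , trans (cong (λ x → lookup x α) (perm-position g∈)) e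

    -- A predicate becomes a sublist through `select`. Conversely a sublist becomes the predicate of
    -- membership in it, decidable because permutations are vectors.
    densityIs : ∀ {a b} → Density a b → DensityIs G a b
    densityIs {a} {b} (P , P? , int , maximal , ratio) = count P? , (attained , bound) , λ ω →
      trans (ratio ω) (cong (a *_) (sym (length-filter (λ g → lookup g ω ≟ ω) (elems G))))
      where
      attained : ∃ λ F → F ⊆ elems G × Intersecting F × length F ≡ count P?
      attained = select (elems G) P? , select-⊆ (elems G) P? , intersecting , length-select (elems G) P?
        where
        intersecting : Intersecting (select (elems G) P?)
        intersecting g∈ h∈ with i , p , refl ← ∈-select (elems G) P? g∈ | j , q , refl ← ∈-select (elems G) P? h∈ = int i j p q
      open import Data.List.Membership.DecPropositional (≡-dec {n = n} _≟_) using (_∈?_)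
      bound : ∀ F → F ⊆ elems G → Intersecting F → length F ≤ count P?
      bound F F⊆ int′ = ≤-trans (length-sublist (_∈? F) F⊆ (All.tabulate λ x∈ → x∈)) (maximal (λ i → perm i ∈? F) λ g h g∈ h∈ → int′ g∈ h∈)

    rho : Density1-3/2-3 → RhoIn1-3/2-3 G
    rho = Sum.map (densityIs {1} {1}) (Sum.map (densityIs {3} {2}) (densityIs {3} {1}))

-- Permutations of ℤ/p that preserve a difference set are affine.

module Muller where

  open Counting using (count; listing; Listing; count-<; count-split; count-all; count-mono; injective⇒surjective)
  open Zmod
  import Algebra.Properties.Semiring.Sum as Sums
  open import Algebra.Bundles using (CommutativeRing)
  open import Data.Bool using (if_then_else_)
  open import Data.Fin using (Fin; toℕ; _≟_)
  open import Data.Fin.Permutation using (permutation)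
  open import Data.List using (List; []; _∷_; length; tabulate)
  open import Data.List.Membership.Propositional using (_∈_)
  open import Data.List.Membership.Propositional.Properties using (∈-tabulate⁺; ∈-tabulate⁻)
  open import Data.List.Properties using (length-tabulate)
  open import Data.List.Relation.Unary.Any using (here; there)
  open import Data.Nat using (ℕ; zero; suc; _≤_; _<_; z≤n; s≤s; NonZero; >-nonZero; nonTrivial⇒n>1; pred; _∸_)
  import Data.Nat as ℕ
  import Data.Nat.Properties as ℕ
  open import Data.Nat.Divisibility using (∣⇒≤)
  open import Data.Nat.Primality using (Prime; prime⇒nonTrivial; prime⇒nonZero)
  open import Data.Integer using () renaming (+_ to +ℤ_)
  open import Data.Product using (∃; _,_; _×_; proj₁; proj₂)
  open import Data.Sum using (_⊎_; inj₁; inj₂)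
  open import Data.Unit using (⊤; tt)
  open import Function using (_∘_; id)
  open import Level using (0ℓ)
  open import Relation.Binary.PropositionalEquality hiding ([_])
  open import Relation.Nullary using (Dec; yes; no; ¬_; contradiction; ¬?; _×-dec_; does)
  open import Relation.Unary using (Pred; Decidable)

  module FieldTheory {p} (pr : Prime p) (F : PrimeField p) where
    open PrimeField F public
    open CommutativeRing commutativeRing public
      using (_-_; +-comm; +-assoc; +-identityˡ; +-identityʳ; *-comm; *-assoc; *-identityˡ; *-identityʳ; zeroˡ; zeroʳ; -‿inverseʳ; -‿inverseˡ; distribˡ; distribʳ; semiring)
    open IntegerSolver commutativeRing public
    module S = Sums semiring

    K : Set
    K = Fin p

    1<p : 1 < p
    1<p = nonTrivial⇒n>1 p {{prime⇒nonTrivial pr}}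

    [0] : [ 0 ] ≡ 0#
    [0] = begin
      [ 0 ]                  ≡⟨ solve 2 (λ a b → a := a :+ b :- b) refl [ 0 ] [ 0 ] ⟩
      [ 0 ] + [ 0 ] - [ 0 ]  ≡⟨ cong (_- [ 0 ]) ([]-+ 0 0) ⟨
      [ 0 ] - [ 0 ]          ≡⟨ -‿inverseʳ _ ⟩
      0#                     ∎
      where open ≡-Reasoning

    [suc] : ∀ k → [ suc k ] ≡ [ k ] + 1#
    [suc] k = trans (cong [_] (sym (ℕ.+-comm k 1))) (trans ([]-+ k 1) (cong ([ k ] +_) []-1))

    []-nonzero : ∀ {k} → 0 < k → k < p → [ k ] ≢ 0#
    []-nonzero {k} 0<k k<p e = ℕ.<⇒≱ k<p (∣⇒≤ {{>-nonZero 0<k}} ([]-0 k e))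

    1≢0 : 1# ≢ 0#
    1≢0 e = []-nonzero (s≤s z≤n) 1<p (trans []-1 e)

    *-nonzero : ∀ {x y} → x ≢ 0# → y ≢ 0# → x * y ≢ 0#
    *-nonzero {x} {y} x≢0 y≢0 e with z , xz≡1 ← inverse x x≢0 = y≢0 (begin
      y            ≡⟨ *-identityˡ y ⟨
      1# * y       ≡⟨ cong (_* y) xz≡1 ⟨
      (x * z) * y  ≡⟨ solve 3 (λ x y z → x :* z :* y := z :* (x :* y)) refl x y z ⟩
      z * (x * y)  ≡⟨ cong (z *_) e ⟩
      z * 0#       ≡⟨ zeroʳ z ⟩
      0#           ∎)
      where open ≡-Reasoning

    x-y≡0⇒x≡y : ∀ {x y} → x - y ≡ 0# → x ≡ y
    x-y≡0⇒x≡y {x} {y} e = trans (solve 2 (λ x y → x := x :- y :+ y) refl x y) (trans (cong (_+ y) e) (+-identityˡ y))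

    -- The element 1 generates the additive group.
    step-invariant : {A : Set} (f : K → A) → (∀ x → f (x + 1#) ≡ f x) → ∀ x → f x ≡ f 0#
    step-invariant f step x = trans (cong f (sym ([]-toℕ x))) (go (toℕ x))
      where
      go : ∀ k → f [ k ] ≡ f 0#
      go zero    = cong f [0]
      go (suc k) = trans (cong f ([suc] k)) (trans (step _) (go k))

    sumᴷ-single : ∀ {n} (f : Fin n → K) i → (∀ j → j ≢ i → f j ≡ 0#) → S.sum f ≡ f i
    sumᴷ-single {suc n} f Fin.zero h = trans (cong (f Fin.zero +_)
      (trans (S.sum-cong-≗ {x = f ∘ Fin.suc} (λ j → h (Fin.suc j) λ ())) (S.sum-replicate-zero n))) (+-identityʳ _)
    sumᴷ-single f (Fin.suc i) h = trans (cong₂ _+_ (h Fin.zero λ ())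
      (sumᴷ-single (f ∘ Fin.suc) i λ j j≢i → h (Fin.suc j) λ { refl → j≢i refl })) (+-identityˡ _)

  -- Müller's argument: a translation-invariant difference operator commuting with π lowers all degrees by the
  -- same amount k, which is incompatible with the degrees of the powers of π unless π has degree one.
  module _ {p} (pr : Prime p) (F : PrimeField p) where
    open FieldTheory pr F

    private
      Fun : Set
      Fun = K → K

      Δ : Fun → Fun
      Δ f x = f (x + 1#) - f x

      -- Lead m c f: the m-th difference of f is the constant m! c.
      Lead : ℕ → K → Fun → Set
      Lead zero    c f = ∀ x → f x ≡ c
      Lead (suc m) c f = Lead m ([ suc m ] * c) (Δ f)

      Δ-cong : ∀ {f g : Fun} → (∀ x → f x ≡ g x) → ∀ x → Δ f x ≡ Δ g x
      Δ-cong e x = cong₂ _-_ (e (x + 1#)) (e x)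

      lead-cong : ∀ m {c d} {f g : Fun} → c ≡ d → (∀ x → f x ≡ g x) → Lead m c f → Lead m d g
      lead-cong zero    e h l x = trans (sym (h x)) (trans (l x) e)
      lead-cong (suc m) e h l   = lead-cong m (cong ([ suc m ] *_) e) (Δ-cong h) l

      lead-+ : ∀ m {c d} {f g : Fun} → Lead m c f → Lead m d g → Lead m (c + d) (λ x → f x + g x)
      lead-+ zero    l l′ x = cong₂ _+_ (l x) (l′ x)
      lead-+ (suc m) {c} {d} {f} {g} l l′ = lead-cong m
        (sym (distribˡ _ c d))
        (λ x → solve 4 (λ a b c d → (a :- b) :+ (c :- d) := (a :+ c) :- (b :+ d)) refl (f (x + 1#)) (f x) (g (x + 1#)) (g x))
        (lead-+ m l l′)

      lead-scale : ∀ m a {c} {f : Fun} → Lead m c f → Lead m (a * c) (λ x → a * f x)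
      lead-scale zero    a l x = cong (a *_) (l x)
      lead-scale (suc m) a {c} {f} l = lead-cong m
        (solve 3 (λ a b c → a :* (b :* c) := b :* (a :* c)) refl a [ suc m ] c)
        (λ x → solve 3 (λ a b c → a :* (b :- c) := a :* b :- a :* c) refl a (f (x + 1#)) (f x))
        (lead-scale m a l)

      lead-raise : ∀ m {c} {f : Fun} → Lead m c f → Lead (suc m) 0# f
      lead-raise zero    {c} l x = trans (cong₂ _-_ (l _) (l x)) (trans (-‿inverseʳ c) (sym (zeroʳ _)))
      lead-raise (suc m) l = lead-cong (suc m) (sym (zeroʳ _)) (λ _ → refl) (lead-raise m l)

      lead-shift : ∀ m {c} {f : Fun} → Lead m c f → Lead m c (λ x → f (x + 1#))
      lead-shift zero    l x = l _
      lead-shift (suc m) l   = lead-shift m l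

      -- The discrete Leibniz rule Δ(f g)(x) = Δf(x) · g(x + 1) + f(x) · Δg(x). The two terms
      -- contribute m + 1 and n + 1 times c d, which is the factor required in the total degree.
      lead-* : ∀ m n {c d} {f g : Fun} → Lead m c f → Lead n d g → Lead (m ℕ.+ n) (c * d) (λ x → f x * g x)
      lead-* zero    n {c} l l′ = lead-cong n refl (λ x → cong (_* _) (sym (l x))) (lead-scale n c l′)
      lead-* (suc m) zero {c} {d} {f} {g} l l′ = subst (λ k → Lead (suc k) (c * d) (λ x → f x * g x)) (sym (ℕ.+-identityʳ m))
        (lead-cong (suc m) (*-comm d c) (λ x → trans (cong (_* f x) (sym (l′ x))) (*-comm (g x) (f x))) (lead-scale (suc m) d l))
      lead-* (suc m) (suc n) {c} {d} {f} {g} l l′ = lead-cong (m ℕ.+ suc n) coefficient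
        (λ x → solve 4 (λ a b c d → (a :- b) :* c :+ b :* (c :- d) := a :* c :- b :* d) refl (f (x + 1#)) (f x) (g (x + 1#)) (g x))
        (lead-+ (m ℕ.+ suc n) (lead-* m (suc n) l (lead-shift (suc n) l′))
          (subst (λ k → Lead k (c * ([ suc n ] * d)) (λ x → f x * Δ g x)) (sym (ℕ.+-suc m n)) (lead-* (suc m) n l l′)))
        where
        open ≡-Reasoning
        coefficient : ([ suc m ] * c) * d + c * ([ suc n ] * d) ≡ [ suc m ℕ.+ suc n ] * (c * d)
        coefficient = trans
          (solve 4 (λ a b c d → (a :* c) :* d :+ c :* (b :* d) := (a :+ b) :* (c :* d)) refl [ suc m ] [ suc n ] c d)
          (cong (_* (c * d)) (sym ([]-+ (suc m) (suc n))))

      lead-const : ∀ c → Lead 0 c (λ _ → c)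
      lead-const c x = refl

      lead-linear : ∀ a → Lead 1 1# (λ x → x - a)
      lead-linear a x = trans (solve 3 (λ x a o → (x :+ o :- a) :- (x :- a) := o) refl x a 1#)
                              (sym (trans (*-identityʳ _) []-1))

      -- The iterated difference is m! c, and m! is invertible for m < p; below degree p a function
      -- therefore determines its leading coefficient.
      lead-zero : ∀ m {c} {f : Fun} → m < p → Lead m c f → (∀ x → f x ≡ 0#) → c ≡ 0#
      lead-zero zero    m<p l z = trans (sym (l 0#)) (z 0#)
      lead-zero (suc m) {c} {f} m<p l z with c ≟ 0#
      ... | yes e = e
      ... | no c≢0 = contradiction (lead-zero m (ℕ.<⇒≤ m<p) l λ x → trans (cong₂ _-_ (z _) (z x)) (-‿inverseʳ 0#))
                                   (*-nonzero ([]-nonzero (s≤s z≤n) m<p) c≢0)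

      lead-not-constant : ∀ m {c e} {f : Fun} → 0 < m → m < p → c ≢ 0# → Lead m c f → ¬ (∀ x → f x ≡ e)
      lead-not-constant (suc m) {e = e} _ m<p c≢0 l const = *-nonzero ([]-nonzero (s≤s z≤n) m<p) c≢0
        (lead-zero m (ℕ.<⇒≤ m<p) l λ x → trans (cong₂ _-_ (const _) (const x)) (-‿inverseʳ e))

      Deg : ℕ → Fun → Set
      Deg m f = ∃ λ c → Lead m c f

      divide : ∀ {m} → suc m < p → ∀ c → ∃ λ d → [ suc m ] * d ≡ c
      divide {m} m<p c with y , e ← inverse [ suc m ] ([]-nonzero (s≤s z≤n) m<p) =
        y * c , trans (sym (*-assoc _ y c)) (trans (cong (_* c) e) (*-identityˡ c))

      -- The new leading coefficient is that of Δf divided by the degree; the division is possible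
      -- because degrees stay below p.
      deg-lower : ∀ m {f : Fun} → m < p → Lead (suc m) 0# f → Deg m f
      deg-lower zero    {f} m<p l = f 0# , step-invariant f λ x → x-y≡0⇒x≡y (trans (l x) (zeroʳ _))
      deg-lower (suc m) {f} m<p l
        with c , l′ ← deg-lower m {Δ f} (ℕ.<⇒≤ m<p) (lead-cong (suc m) {f = Δ f} (zeroʳ _) (λ _ → refl) l)
        with d , e ← divide m<p c
        = d , lead-cong m (sym e) (λ _ → refl) l′

      deg-raise : ∀ {m n} {f : Fun} → m ≤ n → Deg m f → Deg n f
      deg-raise {m} {n} m≤n d with ℕ.m≤n⇒m<n∨m≡n m≤n
      ... | inj₂ refl = d
      deg-raise {m} {suc n} m≤n d | inj₁ (s≤s m≤n′) with c , l ← deg-raise m≤n′ d = 0# , lead-raise n l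

      deg-+ : ∀ m {f g : Fun} → Deg m f → Deg m g → Deg m (λ x → f x + g x)
      deg-+ m (c , l) (d , l′) = c + d , lead-+ m l l′

      deg-sum : ∀ m {n} (f : Fin n → Fun) → (∀ i → Deg m (f i)) → Deg m (λ x → S.sum (λ i → f i x))
      deg-sum m {zero}  f d = deg-raise {0} {m} {λ _ → 0#} z≤n (0# , lead-const 0#)
      deg-sum m {suc n} f d = deg-+ m (d Fin.zero) (deg-sum m (λ i → f (Fin.suc i)) (λ i → d (Fin.suc i)))

      vanishing : List K → Fun
      vanishing []       x = 1#
      vanishing (a ∷ as) x = (x - a) * vanishing as x

      lead-vanishing : ∀ as → Lead (length as) 1# (vanishing as)
      lead-vanishing []       = lead-const 1#
      lead-vanishing (a ∷ as) = lead-cong (length (a ∷ as)) (*-identityˡ 1#) (λ _ → refl) (lead-* 1 (length as) (lead-linear a) (lead-vanishing as))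

      vanishing-∈ : ∀ {as x} → x ∈ as → vanishing as x ≡ 0#
      vanishing-∈ {a ∷ as} (here refl) = trans (cong (_* vanishing as a) (-‿inverseʳ a)) (zeroˡ _)
      vanishing-∈ {a ∷ as} {x} (there x∈) = trans (cong ((x - a) *_) (vanishing-∈ x∈)) (zeroʳ _)

      vanishing-∉ : ∀ {as x} → ¬ (x ∈ as) → vanishing as x ≢ 0#
      vanishing-∉ {[]}     x∉ = 1≢0
      vanishing-∉ {a ∷ as} x∉ = *-nonzero (λ e → x∉ (here (x-y≡0⇒x≡y e))) (vanishing-∉ (x∉ ∘ there))

      module Roots {P : Pred K 0ℓ} (P? : Decidable P) where
        open Listing (listing P?)

        roots : List K
        roots = tabulate at

        length-roots : length roots ≡ count P?
        length-roots = length-tabulate at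

        root : ∀ {x} → P x → vanishing roots x ≡ 0#
        root {x} px = vanishing-∈ (subst (_∈ roots) (at-index x px) (∈-tabulate⁺ {f = at} (index x px)))

        non-root : ∀ {x} → ¬ P x → vanishing roots x ≢ 0#
        non-root ¬px = vanishing-∉ λ x∈ → ¬px (subst P (sym (proj₂ (∈-tabulate⁻ {f = at} x∈))) (member _))

      p-1<p : pred p < p
      p-1<p = ℕ.≤-reflexive (ℕ.suc-pred p {{prime⇒nonZero pr}})

      -- Lagrange interpolation: the basis function at a is a scaled product of x - b over the p - 1
      -- points b other than a.
      interpolate : ∀ (f : Fun) → Deg (pred p) f
      interpolate f = proj₁ (deg-sum (pred p) basis basis-deg) , lead-cong (pred p) refl agrees (proj₂ (deg-sum (pred p) basis basis-deg))
        where
        module R (a : K) = Roots (λ x → ¬? (x ≟ a))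
        scale : ∀ a → ∃ λ y → vanishing (R.roots a) a * y ≡ 1#
        scale a = inverse _ (R.non-root a λ neq → neq refl)
        basis : K → Fun
        basis a x = (f a * proj₁ (scale a)) * vanishing (R.roots a) x
        degree : ∀ a → length (R.roots a) ≤ pred p
        degree a = subst (_≤ pred p) (sym (R.length-roots a)) (ℕ.<⇒≤pred
          (subst (count (λ x → ¬? (x ≟ a)) <_) (count-all {n = p} (λ _ → yes tt) (λ _ → tt))
            (count-< (λ x → ¬? (x ≟ a)) (λ _ → yes tt) (λ _ _ → tt) a tt λ neq → neq refl)))
        basis-deg : ∀ a → Deg (pred p) (basis a)
        basis-deg a = deg-raise (degree a) (_ , lead-scale (length (R.roots a)) (f a * proj₁ (scale a)) (lead-vanishing (R.roots a)))
        agrees : ∀ x → S.sum (λ a → basis a x) ≡ f x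
        agrees x = trans
          (sumᴷ-single (λ a → basis a x) x λ a a≢x → trans (cong ((f a * proj₁ (scale a)) *_) (R.root a (a≢x ∘ sym))) (zeroʳ _))
          (trans (solve 3 (λ f y v → f :* y :* v := f :* (v :* y)) refl (f x) (proj₁ (scale x)) (vanishing (R.roots x) x))
            (trans (cong (f x *_) (proj₂ (scale x))) (*-identityʳ _)))

      power : ℕ → Fun
      power zero    x = 1#
      power (suc j) x = x * power j x

      lead-power : ∀ j {m c} {f : Fun} → Lead m c f → Lead (j ℕ.* m) (power j c) (power j ∘ f)
      lead-power zero    l = lead-const 1#
      lead-power (suc j) {m} l = lead-* m (j ℕ.* m) l (lead-power j l)

      power-nonzero : ∀ j {c} → c ≢ 0# → power j c ≢ 0#
      power-nonzero zero    _   = 1≢0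
      power-nonzero (suc j) c≢0 = *-nonzero c≢0 (power-nonzero j c≢0)

      lead-id : Lead 1 1# id
      lead-id = lead-cong 1 refl (λ x → solve 1 (λ x → x :- con (+ℤ 0) := x) refl x) (lead-linear 0#)

      monomial : ∀ j → Lead j 1# (power j)
      monomial zero    = lead-const 1#
      monomial (suc j) = lead-cong (suc j) (*-identityˡ 1#) (λ _ → refl) (lead-* 1 j lead-id (monomial j))

      leading : ∀ m {f : Fun} → m < p → Deg m f → (∃ λ c → ∀ x → f x ≡ c) ⊎ (∃ λ k → 0 < k × k ≤ m × ∃ λ c → c ≢ 0# × Lead k c f)
      leading zero    m<p d = inj₁ d
      leading (suc m) m<p (c , l) with c ≟ 0#
      ... | no c≢0 = inj₂ (suc m , s≤s z≤n , ℕ.≤-refl , c , c≢0 , l)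
      ... | yes refl with leading m (ℕ.<⇒≤ m<p) (deg-lower m (ℕ.<⇒≤ m<p) l)
      ... | inj₁ const = inj₁ const
      ... | inj₂ (k , 0<k , k≤m , rest) = inj₂ (k , 0<k , ℕ.m≤n⇒m≤1+n k≤m , rest)

      lead-1-affine : ∀ {c} {f : Fun} → Lead 1 c f → ∀ x → f x ≡ c * x + f 0#
      lead-1-affine {c} {f} l x = trans (solve 3 (λ f c x → f := c :* x :+ (f :- c :* x)) refl (f x) c x)
        (cong (c * x +_) (trans (step-invariant (λ x → f x - c * x) step x)
          (solve 2 (λ f c → f :- c :* con (+ℤ 0) := f) refl (f 0#) c)))
        where
        open ≡-Reasoning
        step : ∀ x → f (x + 1#) - c * (x + 1#) ≡ f x - c * x
        step x = begin
          f (x + 1#) - c * (x + 1#)      ≡⟨ solve 5 (λ g f c x o → g :- c :* (x :+ o) := (g :- f) :+ (f :- c :* x) :- c :* o) refl (f (x + 1#)) (f x) c x 1# ⟩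
          Δ f x + (f x - c * x) - c * 1# ≡⟨ cong (λ y → y + (f x - c * x) - c * 1#) (trans (l x) (trans (cong (_* c) []-1) (*-identityˡ c))) ⟩
          c + (f x - c * x) - c * 1#     ≡⟨ cong (λ y → c + (f x - c * x) - y) (*-identityʳ c) ⟩
          c + (f x - c * x) - c          ≡⟨ solve 2 (λ c y → c :+ y :- c := y) refl c (f x - c * x) ⟩
          f x - c * x                    ∎

      module Operator {D : Pred K 0ℓ} (D? : Decidable D) where

        χ : K → K
        χ d = if does (D? d) then 1# else 0#

        χ-yes : ∀ {d} → D d → χ d ≡ 1#
        χ-yes {d} dd with D? d
        ... | yes _  = refl
        ... | no ¬dd = contradiction dd ¬dd

        χ-no : ∀ {d} → ¬ D d → χ d ≡ 0#
        χ-no {d} ¬dd with D? d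
        ... | yes dd = contradiction dd ¬dd
        ... | no _   = refl

        χ-cong : ∀ {d e} → (D d → D e) → (D e → D d) → χ d ≡ χ e
        χ-cong {d} f g with D? d
        ... | yes dd = sym (χ-yes (f dd))
        ... | no ¬dd = sym (χ-no (¬dd ∘ g))

        -- Up to sign, the Laplacian of the Cayley digraph on ℤ/p with connection set D. Translation
        -- invariance makes it commute with Δ; an automorphism π of the digraph makes it commute
        -- with substitution of π.
        B : Fun → Fun
        B f x = S.sum λ d → χ d * (f (x + d) - f x)

        B-cong : ∀ {f g : Fun} → (∀ x → f x ≡ g x) → ∀ x → B f x ≡ B g x
        B-cong e x = S.sum-cong-≗ λ d → cong (χ d *_) (cong₂ _-_ (e (x + d)) (e x))

        B-linear : ∀ (f g : Fun) a x → B (λ y → f y + a * g y) x ≡ B f x + a * B g x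
        B-linear f g a x = trans
          (S.sum-cong-≗ λ d → solve 6 (λ c a f f′ g g′ → c :* ((f :+ a :* g) :- (f′ :+ a :* g′)) := c :* (f :- f′) :+ a :* (c :* (g :- g′)))
                                refl (χ d) a (f (x + d)) (f x) (g (x + d)) (g x))
          (trans (S.∑-distrib-+ (λ d → χ d * (f (x + d) - f x)) _)
            (cong (B f x +_) (sym (S.*-distribˡ-sum a (λ d → χ d * (g (x + d) - g x))))))

        B-const : ∀ {f : Fun} {c} → (∀ x → f x ≡ c) → ∀ x → B f x ≡ 0#
        B-const {c = c} e x = trans (S.sum-cong-≗ λ d → trans (cong (χ d *_) (trans (cong₂ _-_ (e _) (e x)) (-‿inverseʳ c))) (zeroʳ _))
                                    (S.sum-replicate-zero p)

        B-Δ : ∀ (f : Fun) x → B (Δ f) x ≡ Δ (B f) x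
        B-Δ f x = begin
          B (Δ f) x                                     ≡⟨ B-cong (λ y → solve 2 (λ a b → a :- b := a :+ (:- con (+ℤ 1)) :* b) refl (f (y + 1#)) (f y)) x ⟩
          B (λ y → f (y + 1#) + neg * f y) x            ≡⟨ B-linear (λ y → f (y + 1#)) f neg x ⟩
          B (λ y → f (y + 1#)) x + neg * B f x          ≡⟨ cong (_+ neg * B f x) (S.sum-cong-≗ λ d → cong (λ y → χ d * (f y - f (x + 1#)))
                                                            (solve 3 (λ x d o → x :+ d :+ o := x :+ o :+ d) refl x d 1#)) ⟩
          B f (x + 1#) + neg * B f x                    ≡⟨ solve 2 (λ a b → a :+ (:- con (+ℤ 1)) :* b := a :- b) refl (B f (x + 1#)) (B f x) ⟩
          Δ (B f) x                                     ∎
          where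
          open ≡-Reasoning
          neg = - (1# + 0#)

        KillsBelow : ℕ → Set
        KillsBelow zero    = ⊤
        KillsBelow (suc j) = ∀ (f : Fun) → Deg j f → ∀ x → B f x ≡ 0#

        kills : ∀ {k} → KillsBelow k → ∀ {j} → j < k → ∀ {f : Fun} → Deg j f → ∀ x → B f x ≡ 0#
        kills {suc k} kb (s≤s j≤k) {f} d = kb f (deg-raise {f = f} j≤k d)

        value : ℕ → K
        value j = B (power j) 0#

        kill-lower : ∀ {j} → j < p → KillsBelow j → ∀ {f : Fun} → Lead j 0# f → ∀ x → B f x ≡ 0#
        kill-lower {zero}  j<p kb l = B-const l
        kill-lower {suc j} j<p kb {f} l = kb f (deg-lower j (ℕ.<⇒≤ j<p) l)

        kill-Δ : ∀ {j} → KillsBelow j → ∀ {c} {f : Fun} → Lead j c f → ∀ x → B (Δ f) x ≡ 0#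
        kill-Δ {zero}  kb {c} l = B-const {c = 0#} λ x → trans (cong₂ _-_ (l _) (l x)) (-‿inverseʳ c)
        kill-Δ {suc j} kb {f = f} l = kb (Δ f) (_ , l)

        -- The function f - c x^j has lower degree and is killed. What remains, B(x^j), is constant,
        -- because its difference is B applied to Δ(x^j), again of lower degree.
        B-lead : ∀ {j} → j < p → KillsBelow j → ∀ {c} {f : Fun} → Lead j c f → ∀ x → B f x ≡ c * value j
        B-lead {j} j<p kb {c} {f} l x = begin
          B f x                                                      ≡⟨ B-cong (λ y → solve 3 (λ f c m → f := (f :+ (:- c) :* m) :+ c :* m) refl (f y) c (power j y)) x ⟩
          B (λ y → (f y + (- c) * power j y) + c * power j y) x      ≡⟨ B-linear (λ y → f y + (- c) * power j y) (power j) c x ⟩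
          B (λ y → f y + (- c) * power j y) x + c * B (power j) x    ≡⟨ cong (_+ c * B (power j) x) (kill-lower j<p kb
                                                                          (lead-cong j (solve 1 (λ c → c :+ (:- c) :* (con (+ℤ 1)) := con (+ℤ 0)) refl c) (λ _ → refl)
                                                                            (lead-+ j l (lead-scale j (- c) (lead-cong j (sym (+-identityʳ 1#)) (λ _ → refl) (monomial j))))) x) ⟩
          0# + c * B (power j) x                                     ≡⟨ +-identityˡ _ ⟩
          c * B (power j) x                                          ≡⟨ cong (c *_) (step-invariant (B (power j)) (λ y → x-y≡0⇒x≡y
                                                                          (trans (sym (B-Δ (power j) y)) (kill-Δ {j} kb (monomial j) y))) x) ⟩
          c * value j                                                ∎
          where open ≡-Reasoning

        -- The least degree k that survives under `B` is the amount by which `B` lowers degrees.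
        search : ∀ n → n < p → KillsBelow (suc n) ⊎ (∃ λ k → k ≤ n × KillsBelow k × value k ≢ 0#)
        search n n<p with previous n n<p
          where
          previous : ∀ n → n < p → KillsBelow n ⊎ (∃ λ k → k ≤ n × KillsBelow k × value k ≢ 0#)
          previous zero    _   = inj₁ tt
          previous (suc n) n<p with search n (ℕ.<⇒≤ n<p)
          ... | inj₁ kb = inj₁ kb
          ... | inj₂ (k , k≤n , rest) = inj₂ (k , ℕ.m≤n⇒m≤1+n k≤n , rest)
        ... | inj₂ found = inj₂ found
        ... | inj₁ kb with value n ≟ 0#
        ... | no v≢0  = inj₂ (n , ℕ.≤-refl , kb , v≢0)
        ... | yes v≡0 = inj₁ λ f (c , l) x → trans (B-lead n<p kb {c} {f} l x) (trans (cong (c *_) v≡0) (zeroʳ c))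

        -- x ∏ (x - d), over d in D other than d₀, has degree at most |D| and is not annihilated by B.
        not-killed : ¬ D 0# → ∀ {d₀} → D d₀ → ¬ KillsBelow (suc (count D?))
        not-killed ¬D0 {d₀} Dd₀ kb = *-nonzero (λ { refl → ¬D0 Dd₀ }) (non-root λ (_ , neq) → neq refl)
          (trans (sym Bf) (kb f (deg-raise {f = f} degree (_ , lead-* 1 (length roots) lead-id (lead-vanishing roots))) 0#))
          where
          open Roots (λ d → D? d ×-dec ¬? (d ≟ d₀))
          f : Fun
          f x = x * vanishing roots x
          degree : suc (length roots) ≤ count D?
          degree = subst (λ l → suc l ≤ count D?) (sym length-roots) (count-< (λ d → D? d ×-dec ¬? (d ≟ d₀)) D? (λ _ → proj₁) d₀ Dd₀ λ (_ , neq) → neq refl)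
          term : ∀ d → f (0# + d) - f 0# ≡ f d
          term d = trans (cong₂ (λ a b → f a - b) (+-identityˡ d) (zeroˡ _)) (solve 1 (λ x → x :- con (+ℤ 0) := x) refl (f d))
          Bf : B f 0# ≡ f d₀
          Bf = trans (sumᴷ-single _ d₀ other) (trans (cong (_* (f (0# + d₀) - f 0#)) (χ-yes Dd₀)) (trans (*-identityˡ _) (term d₀)))
            where
            other : ∀ d → d ≢ d₀ → χ d * (f (0# + d) - f 0#) ≡ 0#
            other d neq with D? d
            ... | no _   = zeroˡ _
            ... | yes Dd = trans (*-identityˡ _) (trans (term d) (trans (cong (d *_) (root (Dd , neq))) (zeroʳ d)))

        -- Since `B` commutes with Δ, the drop by k in degree k itself propagates to all degrees
        -- below p, one difference at a time.
        lowers-degree : ∀ {k} → KillsBelow k → value k ≢ 0# → ∀ r {c} {f : Fun} → r ℕ.+ k < p → c ≢ 0# → Lead (r ℕ.+ k) c f →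
                        ∃ λ d → d ≢ 0# × Lead r d (B f)
        lowers-degree {k} kb v≢0 zero    {c} r+k<p c≢0 l = c * value k , *-nonzero c≢0 v≢0 , B-lead r+k<p kb l
        lowers-degree {k} kb v≢0 (suc r) {c} {f} r+k<p c≢0 l
          with lowers-degree kb v≢0 r (ℕ.<⇒≤ r+k<p) (*-nonzero ([]-nonzero (s≤s z≤n) r+k<p) c≢0) l
        ... | d , d≢0 , l′ with divide {r} (ℕ.≤-<-trans (s≤s (ℕ.m≤m+n r k)) r+k<p) d
        ... | e , eq = e , (λ { refl → d≢0 (trans (sym eq) (zeroʳ _)) }) , lead-cong r (sym eq) (B-Δ f) l′

        module _ (π : K → K) (π-injective : ∀ i j → π i ≡ π j → i ≡ j)
                 (forth : ∀ i j → D (i - j) → D (π i - π j)) (back : ∀ i j → D (π i - π j) → D (i - j)) where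

          -- For fixed x, the map d ↦ π(x + d) - π(x) is a permutation of ℤ/p that preserves
          -- membership in D, so it reindexes the sum.
          B-∘ : ∀ (f : Fun) x → B (f ∘ π) x ≡ B f (π x)
          B-∘ f x = sym (trans (S.sum-permute _ (permutation φ φ⁻¹ φ-φ⁻¹ φ⁻¹-φ)) (S.sum-cong-≗ λ d → cong₂ _*_
            (χ-cong (λ q → subst D (cancel x d) (back _ _ q)) (λ q → forth _ _ (subst D (sym (cancel x d)) q)))
            (cong (λ y → f y - f (π x)) (solve 2 (λ a b → b :+ (a :- b) := a) refl (π (x + d)) (π x)))))
            where
            cancel : ∀ x d → (x + d) - x ≡ d
            cancel = solve 2 (λ x d → x :+ d :- x := d) refl
            φ : K → K
            φ d = π (x + d) - π x
            φ-injective : ∀ d e → φ d ≡ φ e → d ≡ e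
            φ-injective d e eq = trans (sym (cancel x d)) (trans (cong (_- x) (π-injective _ _
              (trans (solve 2 (λ a b → a := (a :- b) :+ b) refl (π (x + d)) (π x)) (trans (cong (_+ π x) eq)
                (solve 2 (λ a b → (a :- b) :+ b := a) refl (π (x + e)) (π x)))))) (cancel x e))
            φ⁻¹ : K → K
            φ⁻¹ y = proj₁ (injective⇒surjective φ φ-injective y)
            φ-φ⁻¹ : ∀ y → φ (φ⁻¹ y) ≡ y
            φ-φ⁻¹ y = proj₂ (injective⇒surjective φ φ-injective y)
            φ⁻¹-φ : ∀ d → φ⁻¹ (φ d) ≡ d
            φ⁻¹-φ d = φ-injective _ _ (φ-φ⁻¹ (φ d))

          -- Let π have degree M ≥ 2. If k M < p, then B(π^k) has degree k M - k > 0, although it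
          -- equals B(x^k) composed with π, a constant. Otherwise let j M be the last multiple of M
          -- below p. Then j < k, so B(π^j), being B(x^j) composed with π, is zero, although it has
          -- degree j M - k with nonzero leading coefficient.
          nonlinear-impossible : (∃ λ d → D d) → count D? ℕ.+ count D? < p →
            ∀ m {c} → suc (suc m) ≤ pred p → c ≢ 0# → Lead (suc (suc m)) c π →
            ∀ k → 0 < k → k ≤ count D? → KillsBelow k → ¬ (value k ≢ 0#)
          nonlinear-impossible (d₀ , Dd₀) 2D<p m {c} m≤p-1 c≢0 l k 0<k k≤D kb v≢0 = impossible (k ℕ.* M ℕ.<? p)
            where
            instance
              k≢0 : NonZero k
              k≢0 = >-nonZero 0<k

            M = suc (suc m)
            M<p : M < p
            M<p = ℕ.≤-<-trans m≤p-1 p-1<p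

            lowered : ∀ j → j ℕ.* M < p → k ≤ j ℕ.* M → ∃ λ d → d ≢ 0# × Lead (j ℕ.* M ∸ k) d (B (power j ∘ π))
            lowered j jM<p k≤jM = lowers-degree kb v≢0 (j ℕ.* M ∸ k) (subst (_< p) (sym eq) jM<p) (power-nonzero j c≢0)
              (subst (λ e → Lead e (power j c) (power j ∘ π)) (sym eq) (lead-power j l))
              where eq = ℕ.m∸n+n≡m k≤jM

            last-multiple : ∀ n → p ≤ suc n ℕ.* M → ∃ λ j → 0 < j × j ℕ.* M < p × p ≤ suc j ℕ.* M
            last-multiple zero    le = contradiction (ℕ.≤-trans le (ℕ.≤-reflexive (ℕ.*-identityˡ M))) (ℕ.<⇒≱ M<p)
            last-multiple (suc n) le with suc n ℕ.* M ℕ.<? p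
            ... | yes lt = suc n , s≤s z≤n , lt , le
            ... | no ¬lt = last-multiple n (ℕ.≮⇒≥ ¬lt)

            impossible : ¬ Dec (k ℕ.* M < p)
            impossible (yes kM<p) with d , d≢0 , l′ ← lowered k kM<p (ℕ.m≤m*n k M) =
              lead-not-constant (k ℕ.* M ∸ k) (ℕ.m<n⇒0<n∸m (ℕ.m<m*n k M (s≤s (s≤s z≤n)))) (ℕ.≤-<-trans (ℕ.m∸n≤m _ k) kM<p) d≢0 l′
                λ x → trans (B-∘ (power k) x) (B-lead (ℕ.≤-<-trans (ℕ.m≤m*n k M) kM<p) kb (monomial k) (π x))
            impossible (no kM≮p) with last-multiple k (ℕ.≤-trans (ℕ.≮⇒≥ kM≮p) (ℕ.m≤n+m _ M))
            ... | j , 0<j , jM<p , p≤ with lowered j jM<p k≤jM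
              where
              -- This is where |D| < p / 2 enters: j M < k would give p ≤ (j + 1) M ≤ 2 j M ≤ 2 k ≤
              -- 2 |D| < p.
              k≤jM : k ≤ j ℕ.* M
              k≤jM = ℕ.≮⇒≥ λ jM<k → ℕ.<⇒≱ 2D<p (begin
                p                         ≤⟨ p≤ ⟩
                M ℕ.+ j ℕ.* M             ≤⟨ ℕ.+-monoˡ-≤ (j ℕ.* M) (ℕ.m≤n*m M j {{>-nonZero 0<j}}) ⟩
                j ℕ.* M ℕ.+ j ℕ.* M       ≤⟨ ℕ.+-mono-≤ (ℕ.<⇒≤ jM<k) (ℕ.<⇒≤ jM<k) ⟩
                k ℕ.+ k                   ≤⟨ ℕ.+-mono-≤ k≤D k≤D ⟩
                count D? ℕ.+ count D?     ∎)
                where open ℕ.≤-Reasoning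
            ... | d , d≢0 , l′ = d≢0 (lead-zero (j ℕ.* M ∸ k) (ℕ.≤-<-trans (ℕ.m∸n≤m _ k) jM<p) l′
                    λ x → trans (B-∘ (power j) x) (kills kb j<k (_ , monomial j) (π x)))
              where
              j<k : j < k
              j<k = ℕ.*-cancelʳ-< M j k (ℕ.<-≤-trans jM<p (ℕ.≮⇒≥ kM≮p))

          small : ¬ D 0# → (∃ λ d → D d) → count D? ℕ.+ count D? < p → ∃ λ a → ∀ x → π x ≡ a * x + π 0#
          small ¬D0 (d₀ , Dd₀) 2D<p = by-degree (leading (pred p) p-1<p (interpolate π))
            where
            by-value : ∀ m {c} → suc (suc m) ≤ pred p → c ≢ 0# → Lead (suc (suc m)) c π →
              ¬ (KillsBelow (suc (count D?)) ⊎ (∃ λ k → k ≤ count D? × KillsBelow k × value k ≢ 0#))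
            by-value m m≤ c≢0 l (inj₁ kb) = not-killed ¬D0 Dd₀ kb
            by-value m m≤ c≢0 l (inj₂ (zero , _ , _ , v≢0)) = v≢0 (B-const {c = 1#} (λ _ → refl) 0#)
            by-value m m≤ c≢0 l (inj₂ (suc k , k≤D , kb , v≢0)) = nonlinear-impossible (d₀ , Dd₀) 2D<p m m≤ c≢0 l (suc k) (s≤s z≤n) k≤D kb v≢0

            by-degree : (∃ λ c → ∀ x → π x ≡ c) ⊎ (∃ λ k → 0 < k × k ≤ pred p × ∃ λ c → c ≢ 0# × Lead k c π) → ∃ λ a → ∀ x → π x ≡ a * x + π 0#
            by-degree (inj₁ (c , const)) = contradiction (π-injective 1# 0# (trans (const 1#) (sym (const 0#)))) 1≢0
            by-degree (inj₂ (1 , _ , _ , c , _ , l)) = c , lead-1-affine l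
            by-degree (inj₂ (suc (suc m) , _ , m≤p-1 , c , c≢0 , l)) =
              contradiction (search (count D?) (ℕ.≤-<-trans (ℕ.m≤m+n _ _) 2D<p)) (by-value m m≤p-1 c≢0 l)

    -- D and the set of nonzero elements outside D are both nonempty and invariant, and the smaller
    -- of the two has fewer than p / 2 elements.
    affine-of-invariant : ∀ {D : Pred K 0ℓ} → Decidable D → ¬ D 0# → (∃ λ d → D d) → (∃ λ d → d ≢ 0# × ¬ D d) →
      (π : K → K) → (∀ i j → π i ≡ π j → i ≡ j) →
      (∀ i j → D (i - j) → D (π i - π j)) → (∀ i j → D (π i - π j) → D (i - j)) →
      ∃ λ a → ∀ x → π x ≡ a * x + π 0#
    affine-of-invariant {D} D? ¬D0 (d , Dd) (d′ , d′≢0 , ¬Dd′) π π-injective forth back with count D? ℕ.+ count D? ℕ.<? p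
    ... | yes 2D<p = Operator.small D? π π-injective forth back ¬D0 (d , Dd) 2D<p
    ... | no 2D≮p  = Operator.small C? π π-injective forthᶜ backᶜ (λ (neq , _) → neq refl) (d′ , d′≢0 , ¬Dd′) 2C<p
      where
      C : Pred K 0ℓ
      C x = x ≢ 0# × ¬ D x
      C? : Decidable C
      C? x = ¬? (x ≟ 0#) ×-dec ¬? (D? x)
      same : ∀ {i j} → i - j ≡ 0# → π i - π j ≡ 0#
      same {i} e with refl ← x-y≡0⇒x≡y e = -‿inverseʳ (π i)
      same⁻ : ∀ {i j} → π i - π j ≡ 0# → i - j ≡ 0#
      same⁻ {i} e with refl ← π-injective _ _ (x-y≡0⇒x≡y e) = -‿inverseʳ i
      forthᶜ : ∀ i j → C (i - j) → C (π i - π j)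
      forthᶜ i j (neq , ¬Dij) = neq ∘ same⁻ , ¬Dij ∘ back i j
      backᶜ : ∀ i j → C (π i - π j) → C (i - j)
      backᶜ i j (neq , ¬Dij) = neq ∘ same , ¬Dij ∘ forth i j
      total : count D? ℕ.+ count C? < p
      total = begin-strict
        count D? ℕ.+ count C?                      ≤⟨ ℕ.+-monoˡ-≤ (count C?) (count-mono D? (λ x → ¬? (x ≟ 0#) ×-dec D? x) λ x Dx → (λ { refl → ¬D0 Dx }) , Dx) ⟩
        count (λ x → ¬? (x ≟ 0#) ×-dec D? x) ℕ.+ count C?  ≡⟨ count-split (λ x → ¬? (x ≟ 0#)) D? ⟨
        count (λ x → ¬? (x ≟ 0#))                  <⟨ count-< (λ x → ¬? (x ≟ 0#)) (λ _ → yes tt) (λ _ _ → tt) 0# tt (λ neq → neq refl) ⟩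
        count {n = p} (λ _ → yes tt)               ≡⟨ count-all {n = p} (λ _ → yes tt) (λ _ → tt) ⟩
        p                                          ∎
        where open ℕ.≤-Reasoning
      C<D : count C? < count D?
      C<D = ℕ.+-cancelˡ-< (count D?) _ _ (ℕ.<-≤-trans total (ℕ.≮⇒≥ 2D≮p))
      2C<p : count C? ℕ.+ count C? < p
      2C<p = ℕ.≤-<-trans (ℕ.+-monoˡ-≤ (count C?) (ℕ.<⇒≤ C<D)) total

-- Ternary cyclic codes of length p and their monomial automorphisms.

module CyclicCode where

  open Counting using (count; count-<; count-cong; count-split; count-all; sum-bijection; injective⇒surjective; 𝟙)
  open Zmod
  open Muller
  open import Data.Fin using (Fin; zero; suc; toℕ; _≟_) renaming (_<_ to _<ᶠ_)
  open import Data.Fin.Properties using (any?)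
  open import Data.Fin.Permutation using (permutation)
  open import Data.Integer using () renaming (+_ to +ℤ_)
  open import Data.Nat using (ℕ; zero; suc; _<_; z≤n; s≤s)
  import Data.Nat as ℕ
  import Data.Nat.Properties as ℕ
  open import Data.Nat.Divisibility using (divides)
  open import Data.Nat.Induction using (<-wellFounded)
  open import Data.Nat.Primality using (Prime; prime?; prime⇒irreducible)
  open import Algebra.Properties.CommutativeSemigroup ℕ.+-commutativeSemigroup using (interchange)
  open import Data.Product using (∃; _,_; _×_; proj₁; proj₂)
  open import Data.Sum using (_⊎_; inj₁; inj₂)
  open import Data.Unit using (tt)
  open import Function using (_∘_)
  open import Induction.WellFounded using (Acc; acc)
  open import Relation.Binary.PropositionalEquality hiding ([_])
  open import Relation.Nullary using (Dec; yes; no; ¬_; contradiction; ¬?; _×-dec_)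
  open import Relation.Nullary.Decidable using (from-yes; map′)
  open import Relation.Unary using (Decidable)

  prime-3 : Prime 3
  prime-3 = from-yes (prime? 3)

  module Ternary (F : PrimeField 3) where
    open FieldTheory prime-3 F public

    1+1+1≡0 : 1# + 1# + 1# ≡ 0#
    1+1+1≡0 = trans (cong₂ _+_ (cong₂ _+_ (sym []-1) (sym []-1)) (sym []-1))
      (trans (cong (_+ [ 1 ]) (sym ([]-+ 1 1))) (trans (sym ([]-+ 2 1)) []-p))

    triple : ∀ x → x + x + x ≡ 0#
    triple x = trans (cong (λ y → y + y + y) (sym (*-identityˡ x)))
      (trans (solve 2 (λ o x → o :* x :+ o :* x :+ o :* x := (o :+ o :+ o) :* x) refl 1# x) (trans (cong (_* x) 1+1+1≡0) (zeroˡ x)))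

    -1≢1 : - 1# ≢ 1#
    -1≢1 e = 1≢0 (trans (solve 1 (λ o → o := (o :+ o :+ o) :- (o :- (:- o))) refl 1#)
      (trans (cong₂ (λ a b → a - (1# - b)) 1+1+1≡0 e) (solve 1 (λ o → con (+ℤ 0) :- (o :- o) := con (+ℤ 0)) refl 1#)))

    -1≢0 : - 1# ≢ 0#
    -1≢0 e = 1≢0 (trans (solve 1 (λ o → o := :- (:- o)) refl 1#) (trans (cong -_ e) (solve 0 (:- con (+ℤ 0) := con (+ℤ 0)) refl)))

    three-elements : ∀ x → x ≡ 0# ⊎ x ≡ 1# ⊎ x ≡ - 1#
    three-elements x with x | []-toℕ x
    ... | zero          | e = inj₁ (trans (sym e) [0])
    ... | suc zero      | e = inj₂ (inj₁ (trans (sym e) []-1))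
    ... | suc (suc zero) | e = inj₂ (inj₂ (trans (sym e) (trans ([]-+ 1 1) (trans (cong₂ _+_ []-1 []-1)
            (trans (solve 1 (λ o → o :+ o := (o :+ o :+ o) :- o) refl 1#) (trans (cong (_- 1#) 1+1+1≡0) (+-identityˡ _)))))))

    nonzero : ∀ {x} → x ≢ 0# → x ≡ 1# ⊎ x ≡ - 1#
    nonzero {x} x≢0 with three-elements x
    ... | inj₁ e = contradiction e x≢0
    ... | inj₂ e = e

    1*1 : 1# * 1# ≡ 1#
    1*1 = *-identityˡ 1#

    -1*-1 : - 1# * - 1# ≡ 1#
    -1*-1 = trans (solve 1 (λ o → (:- o) :* (:- o) := o :* o) refl 1#) 1*1

    square : ∀ {x} → x ≢ 0# → x * x ≡ 1#
    square x≢0 with nonzero x≢0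
    ... | inj₁ refl = 1*1
    ... | inj₂ refl = -1*-1

    double-nonzero : ∀ {x} → x ≢ 0# → x + x ≢ 0#
    double-nonzero {x} x≢0 e = x≢0 (trans (solve 1 (λ x → x := (x :+ x :+ x) :- (x :+ x)) refl x)
      (trans (cong₂ _-_ (triple x) e) (-‿inverseʳ 0#)))

    *-nonzeroˡ : ∀ {x y} → x * y ≢ 0# → x ≢ 0#
    *-nonzeroˡ {y = y} xy≢0 refl = xy≢0 (zeroˡ y)

    *-nonzeroʳ : ∀ {x y} → x * y ≢ 0# → y ≢ 0#
    *-nonzeroʳ {x = x} xy≢0 refl = xy≢0 (zeroʳ x)

    ±-sign : ∀ {x y} → x ≢ 0# → y ≢ 0# → x ≢ y → x * y ≡ - 1#
    ±-sign x≢0 y≢0 x≢y with nonzero x≢0 | nonzero y≢0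
    ... | inj₁ refl | inj₁ refl = contradiction refl x≢y
    ... | inj₁ refl | inj₂ refl = *-identityˡ _
    ... | inj₂ refl | inj₁ refl = *-identityʳ _
    ... | inj₂ refl | inj₂ refl = contradiction refl x≢y

  module _ (F : PrimeField 3) where
    open Ternary F

    -- Membership in `W` need not be decidable. Gaussian elimination only has to decide `pivot?`:
    -- whether some word has its first nonzero entry at i.
    record Subspace (n : ℕ) : Set₁ where
      field
        W       : (Fin n → K) → Set
        W-cong  : ∀ {u w} → (∀ x → u x ≡ w x) → W u → W w
        W-0     : W (λ _ → 0#)
        W-+     : ∀ {u w} → W u → W w → W (λ x → u x + w x)
        W-scale : ∀ a {w} → W w → W (λ x → a * w x)
        pivot?  : ∀ i → Dec (∃ λ w → W w × (∀ j → j <ᶠ i → w j ≡ 0#) × w i ≢ 0#)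

      W-sum : ∀ {m} (w : Fin m → Fin n → K) → (∀ i → W (w i)) → W (λ x → S.sum (λ i → w i x))
      W-sum {zero}  w h = W-0
      W-sum {suc m} w h = W-+ (h zero) (W-sum (w ∘ suc) (h ∘ suc))

      W-sub : ∀ {u w} → W u → W w → W (λ x → u x - w x)
      W-sub {u} {w} Wu Ww = W-cong (λ x → solve 2 (λ u w → u :+ (:- con (+ℤ 1)) :* w := u :- w) refl (u x) (w x))
        -- The scalar is written `1# + 0#` because this is the value of `con (+ℤ 1)`.
        (W-+ Wu (W-scale (- (1# + 0#)) Ww))

    cons : ∀ {n} → K → (Fin n → K) → Fin (suc n) → K
    cons a u zero    = a
    cons a u (suc x) = u x

    cons-cong : ∀ {n} {a b} {u w : Fin n → K} → a ≡ b → (∀ x → u x ≡ w x) → ∀ x → cons a u x ≡ cons b w x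
    cons-cong e h zero    = e
    cons-cong e h (suc x) = h x

    tailSpace : ∀ {n} → Subspace (suc n) → Subspace n
    tailSpace V = record
      { W       = λ u → W (cons 0# u)
      ; W-cong  = λ h → W-cong (cons-cong refl h)
      ; W-0     = W-cong (λ { zero → refl ; (suc x) → refl }) W-0
      ; W-+     = λ p q → W-cong (λ { zero → +-identityˡ 0# ; (suc x) → refl }) (W-+ p q)
      ; W-scale = λ a p → W-cong (λ { zero → zeroʳ a ; (suc x) → refl }) (W-scale a p)
      ; pivot?  = λ i → map′
          (λ (w , p , below , nz) → w ∘ suc , W-cong (λ { zero → below zero (s≤s z≤n) ; (suc x) → refl }) p , (λ j lt → below (suc j) (s≤s lt)) , nz)
          (λ (w , p , below , nz) → cons 0# w , p , (λ { zero _ → refl ; (suc j) (s≤s lt) → below j lt }) , nz)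
          (pivot? (suc i))
      }
      where open Subspace V

    record Projection {n} (V : Subspace n) : Set where
      open Subspace V
      field
        M       : Fin n → Fin n → K
        columns : ∀ j → W (λ x → M x j)
        fixes   : ∀ {w} → W w → ∀ x → S.sum (λ a → M x a * w a) ≡ w x

    -- Elimination of the first coordinate. If all words vanish there, the projection of the tail
    -- space is padded by zeros. Otherwise a word v with first entry 1 splits each w into (w 0) v
    -- and a word of the tail space; the first column is v minus the tail projection applied to v,
    -- which makes the combined matrix return w.
    projection : ∀ n (V : Subspace n) → Projection V
    projection zero V = record { M = λ () ; columns = λ () ; fixes = λ _ () }
    projection (suc n) V with Subspace.pivot? V zero | projection n (tailSpace V)
    ... | no none | P = record
      { M = λ { zero _ → 0# ; (suc x) zero → 0# ; (suc x) (suc y) → M x y }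
      ; columns = λ { zero → W-cong (λ { zero → refl ; (suc x) → refl }) W-0
                    ; (suc y) → W-cong (λ { zero → refl ; (suc x) → refl }) (columns y) }
      ; fixes = λ { {w} Ww zero → trans (S.sum-cong-≗ (λ a → zeroˡ (w a))) (trans (S.sum-replicate-zero (suc n)) (sym (first Ww)))
                  ; {w} Ww (suc x) → trans (trans (cong (_+ S.sum (λ a → M x a * w (suc a))) (zeroˡ (w zero))) (+-identityˡ _))
                      (fixes (W-cong (λ { zero → first Ww ; (suc x) → refl }) Ww) x) }
      }
      where
      open Subspace V
      open Projection P
      first : ∀ {w} → W w → w zero ≡ 0#
      first {w} Ww with w zero ≟ 0#
      ... | yes e = e
      ... | no nz = contradiction (w , Ww , (λ _ ()) , nz) none
    ... | yes (v′ , Wv′ , _ , nz) | P = record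
      { M = λ { zero zero → 1# ; zero (suc y) → 0# ; (suc x) zero → v (suc x) - correction x ; (suc x) (suc y) → M x y }
      ; columns = λ { zero → W-cong (λ { zero → trans (cong (_- 0#) v₀) (solve 1 (λ o → o :- con (+ℤ 0) := o) refl 1#) ; (suc x) → refl }) (W-sub Wv Wcorrection)
                    ; (suc y) → W-cong (λ { zero → refl ; (suc x) → refl }) (columns y) }
      ; fixes = λ { {w} Ww zero → trans (cong₂ _+_ (*-identityˡ (w zero)) (trans (S.sum-cong-≗ (λ a → zeroˡ (w (suc a)))) (S.sum-replicate-zero n))) (+-identityʳ _)
                  ; {w} Ww (suc x) → reproduce Ww x }
      }
      where
      open Subspace V
      open Projection P
      v : Fin (suc n) → K
      v x = v′ zero * v′ x
      Wv : W v
      Wv = W-scale (v′ zero) Wv′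
      v₀ : v zero ≡ 1#
      v₀ = square nz
      correction : Fin n → K
      correction x = S.sum (λ a → M x a * v (suc a))
      Wcorrection : W (cons 0# correction)
      Wcorrection = Subspace.W-cong (tailSpace V) (λ x → S.sum-cong-≗ λ a → *-comm (v (suc a)) (M x a))
        (Subspace.W-sum (tailSpace V) (λ a x → v (suc a) * M x a) (λ a → Subspace.W-scale (tailSpace V) (v (suc a)) (columns a)))
      reproduce : ∀ {w} → W w → ∀ x → (v (suc x) - correction x) * w zero + S.sum (λ a → M x a * w (suc a)) ≡ w (suc x)
      reproduce {w} Ww x = begin
        (v (suc x) - correction x) * w zero + S.sum (λ a → M x a * w (suc a))
          ≡⟨ cong ((v (suc x) - correction x) * w zero +_) (trans (S.sum-cong-≗ λ a → solve 4 (λ m w v c → m :* w := m :* (w :- c :* v) :+ c :* (m :* v)) refl (M x a) (w (suc a)) (v (suc a)) (w zero))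
               (trans (S.∑-distrib-+ (λ a → M x a * (w (suc a) - w zero * v (suc a))) _)
                 (cong₂ _+_ (fixes W-residue x) (sym (S.*-distribˡ-sum (w zero) (λ a → M x a * v (suc a))))))) ⟩
        (v (suc x) - correction x) * w zero + ((w (suc x) - w zero * v (suc x)) + w zero * correction x)
          ≡⟨ solve 4 (λ v c w w′ → (v :- c) :* w :+ ((w′ :- w :* v) :+ w :* c) := w′) refl (v (suc x)) (correction x) (w zero) (w (suc x)) ⟩
        w (suc x) ∎
        where
        open ≡-Reasoning
        W-residue : W (cons 0# (λ y → w (suc y) - w zero * v (suc y)))
        W-residue = W-cong (λ { zero → trans (cong (λ a → w zero - w zero * a) v₀) (trans (cong (λ a → w zero - a) (*-identityʳ (w zero))) (-‿inverseʳ (w zero))) ; (suc y) → refl })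
          (W-sub Ww (W-scale (w zero) Wv))

  record Code {p} (pr : Prime p) (P : PrimeField p) (F : PrimeField 3) : Set₁ where
    module I = FieldTheory pr P
    open Ternary F
    open I using () renaming (_+_ to _⊕_)
    field
      3<p      : 3 < p
      space    : Subspace F p
    open Subspace space public
    field
      shift    : ∀ a {w} → W w → W (λ x → w (x ⊕ a))
      word     : Fin p → K
      W-word   : W word
      support  : Fin p
      word≢0   : word support ≢ 0#
      no-full  : ∀ {w} → W w → ¬ (∀ x → w x ≢ 0#)

  module CodeTheory {p} {pr : Prime p} {P : PrimeField p} {F : PrimeField 3} (C : Code pr P F) where
    open Code C
    open Ternary F
    open I using () renaming (_+_ to _⊕_; _-_ to _⊖_; -_ to ⊖_; _*_ to _⊛_; 0# to 𝟎; 1# to 𝟏; solve to solveᴵ; _:+_ to _⊹_; _:-_ to _∸∸_; _:=_ to _≔_; :-_ to neg_)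

    Index : Set
    Index = Fin p

    ⊕⊖ : ∀ x a → (x ⊕ a) ⊖ a ≡ x
    ⊕⊖ = solveᴵ 2 (λ x a → (x ⊹ a) ∸∸ a ≔ x) refl

    ⊖⊕ : ∀ x a → (x ⊖ a) ⊕ a ≡ x
    ⊖⊕ = solveᴵ 2 (λ x a → (x ∸∸ a) ⊹ a ≔ x) refl

    ⊕⊖⊕ : ∀ x a → a ⊕ (x ⊖ a) ≡ x
    ⊕⊖⊕ = solveᴵ 2 (λ x a → a ⊹ (x ∸∸ a) ≔ x) refl

    sum-shiftᴷ : (f : Index → K) (a : Index) → S.sum f ≡ S.sum (λ x → f (x ⊕ a))
    sum-shiftᴷ f a = S.sum-permute f (permutation (_⊕ a) (_⊖ a) (λ x → ⊖⊕ x a) (λ x → ⊕⊖ x a))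

    -- The translates of a word of weight one sum to a word of full weight.
    weight≢1 : ∀ {w} → W w → ∀ a → w a ≢ 0# → (∀ x → x ≢ a → w x ≡ 0#) → ∀ {A : Set} → A
    weight≢1 {w} Ww a wa≢0 else0 = contradiction
      (λ x → subst (_≢ 0#) (sym (total x)) wa≢0)
      (no-full (W-sum (λ d x → w (x ⊕ d)) (λ d → shift d Ww)))
      where
      total : ∀ x → S.sum (λ d → w (x ⊕ d)) ≡ w a
      total x = trans (sumᴷ-single (λ d → w (x ⊕ d)) (a ⊖ x) λ d d≢ → else0 _ λ e → d≢
          (trans (sym (trans (cong (_⊖ x) (solveᴵ 2 (λ x d → x ⊹ d ≔ d ⊹ x) refl x d)) (⊕⊖ d x))) (cong (_⊖ x) e)))
        (cong w (⊕⊖⊕ a x))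

    Multiplier : (Index → K) → Set
    Multiplier m = ∀ {w} → W w → W (λ x → m x * w x)

    -- Multiplying a multiplier by its translates shrinks its support to a single point.
    multiplier-vanishes-nowhere : ∀ {m} → Multiplier m → ∀ a → m a ≢ 0# → ∀ b → m b ≢ 0#
    multiplier-vanishes-nowhere {m} mult = shrink mult (<-wellFounded _)
      where
      supp? : (m : Index → K) → Decidable (λ x → m x ≢ 0#)
      supp? m x = ¬? (m x ≟ 0#)

      shrink : ∀ {m} → Multiplier m → Acc _<_ (count (supp? m)) → ∀ a → m a ≢ 0# → ∀ b → m b ≢ 0#
      shrink {m} mult (acc smaller) a ma≢0 b mb≡0 with any? (λ x → supp? m x ×-dec ¬? (x ≟ a))
      ... | no none = weight≢1 (mult (shift (support ⊖ a) W-word)) a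
              (*-nonzero ma≢0 (subst (λ x → word x ≢ 0#) (sym (⊕⊖⊕ support a)) word≢0))
              λ x x≢a → trans (cong (_* _) (zero-off x x≢a)) (zeroˡ _)
        where
        zero-off : ∀ x → x ≢ a → m x ≡ 0#
        zero-off x x≢a with m x ≟ 0#
        ... | yes e = e
        ... | no nz = contradiction (x , nz , x≢a) none
      ... | yes (a′ , ma′≢0 , a′≢a) = shrink mult′ (smaller less) a (*-nonzero ma≢0 (subst (λ x → m x ≢ 0#) (sym (⊕⊖⊕ a′ a)) ma′≢0)) b
              (trans (cong (_* m (b ⊕ (a′ ⊖ a))) mb≡0) (zeroˡ _))
        where
        d = a′ ⊖ a
        mult′ : Multiplier (λ x → m x * m (x ⊕ d))
        mult′ {w} Ww = W-cong (λ x → trans (cong (λ y → m x * (m (x ⊕ d) * w y)) (⊕⊖ x d)) (sym (*-assoc (m x) (m (x ⊕ d)) (w x))))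
          (mult (shift d (mult (W-cong (λ x → refl) (shift (⊖ d) Ww)))))
        escape : ∃ λ x → m x ≢ 0# × m (x ⊕ d) ≡ 0#
        escape with any? (λ x → supp? m x ×-dec (m (x ⊕ d) ≟ 0#))
        ... | yes found = found
        ... | no none   = contradiction mb≡0 (subst (λ x → m x ≢ 0#) reach (walk ((b ⊖ a) ⊛ d⁻¹)))
          where
          d≢0 : d ≢ 𝟎
          d≢0 e = a′≢a (I.x-y≡0⇒x≡y e)
          d⁻¹ = proj₁ (I.inverse d d≢0)
          walk : ∀ t → m (a ⊕ t ⊛ d) ≢ 0#
          walk t = subst (λ t → m (a ⊕ t ⊛ d) ≢ 0#) (I.[]-toℕ t) (steps (toℕ t))
            where
            steps : ∀ k → m (a ⊕ I.[ k ] ⊛ d) ≢ 0#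
            steps zero e = ma≢0 (trans (cong m (sym (trans (cong (λ z → a ⊕ z ⊛ d) I.[0]) (trans (cong (a ⊕_) (I.zeroˡ d)) (I.+-identityʳ a))))) e)
            steps (suc k) e = none (a ⊕ I.[ k ] ⊛ d , steps k , trans (cong m (sym (trans (cong (λ z → a ⊕ z ⊛ d) (I.[suc] k))
              (trans (cong (a ⊕_) (trans (I.distribʳ d I.[ k ] 𝟏) (cong (I.[ k ] ⊛ d ⊕_) (I.*-identityˡ d)))) (sym (I.+-assoc a _ d)))))) e)
          reach : a ⊕ ((b ⊖ a) ⊛ d⁻¹) ⊛ d ≡ b
          reach = trans (cong (a ⊕_) (trans (I.*-assoc _ d⁻¹ d) (trans (cong ((b ⊖ a) ⊛_) (trans (I.*-comm d⁻¹ d) (proj₂ (I.inverse d d≢0)))) (I.*-identityʳ _)))) (⊕⊖⊕ b a)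
        less : count (supp? (λ x → m x * m (x ⊕ d))) < count (supp? m)
        less = let x , mx≢0 , e = escape in count-< (supp? (λ x → m x * m (x ⊕ d))) (supp? m) (λ x → *-nonzeroˡ) x mx≢0
                 λ nz → nz (trans (cong (m x *_) e) (zeroʳ _))

    -- The matrices of linear projections onto the code.
    Kernel : (Index → Index → K) → Set
    Kernel V = (∀ j → W (λ x → V x j)) × (∀ {w} → W w → ∀ x → S.sum (λ a → V x a * w a) ≡ w x)

    -- Projections onto the same space satisfy U = V U and V = U V. For symmetric matrices the
    -- transpose of the first equation reads U = U V, and so U = V.
    kernel-unique : ∀ {U V} → Kernel U → Kernel V → (∀ x y → U x y ≡ U y x) → (∀ x y → V x y ≡ V y x) → ∀ x y → U x y ≡ V x y
    kernel-unique {U} {V} (Ucol , Ufix) (Vcol , Vfix) Usym Vsym x y = begin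
      U x y                            ≡⟨ Vfix (Ucol y) x ⟨
      S.sum (λ a → V x a * U a y)      ≡⟨ S.sum-cong-≗ (λ a → trans (*-comm (V x a) (U a y)) (cong₂ _*_ (Usym a y) (Vsym x a))) ⟩
      S.sum (λ a → U y a * V a x)      ≡⟨ Ufix (Vcol x) y ⟩
      V y x                            ≡⟨ Vsym y x ⟩
      V x y                            ∎
      where open ≡-Reasoning

    -- Averaging over the p translations divides by p in ℤ/3, which is possible as the prime p
    -- exceeds 3.
    p≢0ᴷ : [ p ] ≢ 0#
    p≢0ᴷ e with prime⇒irreducible pr ([]-0 p e)
    ... | inj₂ refl = ℕ.<-irrefl refl 3<p

    private
      module Π = Projection (projection F p space)

      p⁻¹ : K
      p⁻¹ = proj₁ (inverse [ p ] p≢0ᴷ)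

      sum-const : ∀ n c → S.sum {n} (λ _ → c) ≡ [ n ] * c
      sum-const zero    c = sym (trans (cong (_* c) [0]) (zeroˡ c))
      sum-const (suc n) c = trans (cong (c +_) (sum-const n c))
        (sym (trans (cong (_* c) ([suc] n)) (trans (distribʳ c [ n ] 1#) (trans (cong ([ n ] * c +_) (*-identityˡ c)) (+-comm _ c)))))

    -- Averaging a projection over all translations makes it a convolution (Maschke).
    abstract
      e : Index → K
      e x = p⁻¹ * S.sum (λ i → Π.M (x ⊕ i) i)

      We : W e
      We = W-scale p⁻¹ (W-sum (λ i x → Π.M (x ⊕ i) i) (λ i → shift i (Π.columns i)))

      e-fixes : ∀ {w} → W w → ∀ x → S.sum (λ a → e (x ⊖ a) * w a) ≡ w x
      e-fixes {w} Ww x = begin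
        S.sum (λ a → e (x ⊖ a) * w a)
          ≡⟨ S.sum-cong-≗ (λ a → trans (*-assoc p⁻¹ _ (w a)) (cong (p⁻¹ *_) (trans (cong (_* w a) (recentre a)) (S.*-distribʳ-sum (w a) (λ i → Π.M (x ⊕ i) (a ⊕ i)))))) ⟩
        S.sum (λ a → p⁻¹ * S.sum (λ i → Π.M (x ⊕ i) (a ⊕ i) * w a))
          ≡⟨ S.*-distribˡ-sum p⁻¹ (λ a → S.sum (λ i → Π.M (x ⊕ i) (a ⊕ i) * w a)) ⟨
        p⁻¹ * S.sum (λ a → S.sum (λ i → Π.M (x ⊕ i) (a ⊕ i) * w a))
          ≡⟨ cong (p⁻¹ *_) (S.∑-comm (λ a i → Π.M (x ⊕ i) (a ⊕ i) * w a)) ⟩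
        p⁻¹ * S.sum (λ i → S.sum (λ a → Π.M (x ⊕ i) (a ⊕ i) * w a))
          ≡⟨ cong (p⁻¹ *_) (S.sum-cong-≗ average) ⟩
        p⁻¹ * S.sum {p} (λ i → w x)
          ≡⟨ cong (p⁻¹ *_) (sum-const p (w x)) ⟩
        p⁻¹ * ([ p ] * w x)
          ≡⟨ solve 3 (λ a b c → a :* (b :* c) := (b :* a) :* c) refl p⁻¹ [ p ] (w x) ⟩
        ([ p ] * p⁻¹) * w x
          ≡⟨ trans (cong (_* w x) (proj₂ (inverse [ p ] p≢0ᴷ))) (*-identityˡ (w x)) ⟩
        w x ∎
        where
        open ≡-Reasoning
        recentre : ∀ a → S.sum (λ i → Π.M ((x ⊖ a) ⊕ i) i) ≡ S.sum (λ i → Π.M (x ⊕ i) (a ⊕ i))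
        recentre a = trans (sum-shiftᴷ (λ i → Π.M ((x ⊖ a) ⊕ i) i) a) (S.sum-cong-≗ λ i → cong₂ Π.M
          (solveᴵ 3 (λ x a i → (x ∸∸ a) ⊹ (i ⊹ a) ≔ x ⊹ i) refl x a i) (solveᴵ 2 (λ a i → i ⊹ a ≔ a ⊹ i) refl a i))
        average : ∀ i → S.sum (λ a → Π.M (x ⊕ i) (a ⊕ i) * w a) ≡ w x
        average i = begin
          S.sum (λ a → Π.M (x ⊕ i) (a ⊕ i) * w a)              ≡⟨ S.sum-cong-≗ (λ a → cong (λ y → Π.M (x ⊕ i) (a ⊕ i) * w y) (sym (⊕⊖ a i))) ⟩
          S.sum (λ a → Π.M (x ⊕ i) (a ⊕ i) * w ((a ⊕ i) ⊖ i))  ≡⟨ sum-shiftᴷ (λ a → Π.M (x ⊕ i) a * w (a ⊖ i)) i ⟨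
          S.sum (λ a → Π.M (x ⊕ i) a * w (a ⊖ i))              ≡⟨ Π.fixes (shift (⊖ i) Ww) (x ⊕ i) ⟩
          w ((x ⊕ i) ⊖ i)                                      ≡⟨ cong w (⊕⊖ x i) ⟩
          w x                                                  ∎

    e-kernel : Kernel (λ x y → e (x ⊖ y))
    e-kernel = (λ j → shift (⊖ j) We) , e-fixes

    module Reversible (reverse : ∀ {w} → W w → W (λ x → w (⊖ x))) where

      -- The convolution of e with its reversal is the reversal, since e reproduces every word. The
      -- substitution a ↦ a - x shows that this convolution is even, hence so is e.
      e-even : ∀ x → e (⊖ x) ≡ e x
      e-even x = trans (sym (f-is x)) (trans (f-even x) (trans (f-is (⊖ x)) (cong e (solveᴵ 1 (λ x → neg (neg x) ≔ x) refl x))))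
        where
        f : Index → K
        f x = S.sum (λ a → e (x ⊖ a) * e (⊖ a))
        f-is : ∀ x → f x ≡ e (⊖ x)
        f-is x = e-fixes (reverse We) x
        f-even : ∀ x → f x ≡ f (⊖ x)
        f-even x = sym (trans (sum-shiftᴷ (λ a → e ((⊖ x) ⊖ a) * e (⊖ a)) (⊖ x)) (S.sum-cong-≗ λ a → trans (cong₂ _*_
          (cong e (solveᴵ 2 (λ x a → (neg x) ∸∸ (a ⊹ (neg x)) ≔ neg a) refl x a))
          (cong e (solveᴵ 2 (λ x a → neg (a ⊹ (neg x)) ≔ x ∸∸ a) refl x a))) (*-comm _ _)))

      e-symmetric : ∀ x y → e (x ⊖ y) ≡ e (y ⊖ x)
      e-symmetric x y = trans (sym (e-even (x ⊖ y))) (cong e (solveᴵ 2 (λ x y → neg (x ∸∸ y) ≔ y ∸∸ x) refl x y))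

      -- A monomial automorphism of the code: the coordinates are permuted by π and changed by the
      -- signs s. Conjugation by a group element has this form, and `pull` and `push` are its two
      -- directions.
      module Monomial (π : Index → Index) (π-injective : ∀ i j → π i ≡ π j → i ≡ j)
                      (s : Index → K) (s≢0 : ∀ x → s x ≢ 0#)
                      (pull : ∀ {w} → W w → W (λ x → s x * w (π x)))
                      (push : ∀ {w} → W w → ∃ λ u → W u × ∀ x → u (π x) ≡ s x * w x) where

        π⁻¹ : Index → Index
        π⁻¹ y = proj₁ (injective⇒surjective π π-injective y)

        π-π⁻¹ : ∀ y → π (π⁻¹ y) ≡ y
        π-π⁻¹ y = proj₂ (injective⇒surjective π π-injective y)

        sum-π : (f : Index → K) → S.sum f ≡ S.sum (f ∘ π)
        sum-π f = S.sum-permute f (permutation π π⁻¹ π-π⁻¹ (λ x → π-injective _ _ (π-π⁻¹ (π x))))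

        -- Transporting the convolution kernel along the automorphism gives another symmetric
        -- projection onto the code, and there is only one.
        e-monomial : ∀ x y → s x * s y * e (π x ⊖ π y) ≡ e (x ⊖ y)
        e-monomial = kernel-unique (columns , fixes) e-kernel
          (λ x y → cong₂ _*_ (*-comm (s x) (s y)) (e-symmetric (π x) (π y))) e-symmetric
          where
          columns : ∀ j → W (λ x → s x * s j * e (π x ⊖ π j))
          columns j = W-cong (λ x → solve 3 (λ a b c → b :* (a :* c) := a :* b :* c) refl (s x) (s j) (e (π x ⊖ π j)))
            (W-scale (s j) (pull (shift (⊖ π j) We)))
          fixes : ∀ {w} → W w → ∀ x → S.sum (λ a → s x * s a * e (π x ⊖ π a) * w a) ≡ w x
          fixes {w} Ww x with u , Wu , u∘π ← push Ww = begin
            S.sum (λ a → s x * s a * e (π x ⊖ π a) * w a)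
              ≡⟨ S.sum-cong-≗ (λ a → trans (solve 4 (λ x a e w → x :* a :* e :* w := x :* (e :* (a :* w))) refl (s x) (s a) (e (π x ⊖ π a)) (w a))
                   (cong (λ z → s x * (e (π x ⊖ π a) * z)) (sym (u∘π a)))) ⟩
            S.sum (λ a → s x * (e (π x ⊖ π a) * u (π a)))      ≡⟨ S.*-distribˡ-sum (s x) (λ a → e (π x ⊖ π a) * u (π a)) ⟨
            s x * S.sum (λ a → e (π x ⊖ π a) * u (π a))        ≡⟨ cong (s x *_) (sum-π (λ b → e (π x ⊖ b) * u b)) ⟨
            s x * S.sum (λ b → e (π x ⊖ b) * u b)              ≡⟨ cong (s x *_) (trans (e-fixes Wu (π x)) (u∘π x)) ⟩
            s x * (s x * w x)                                  ≡⟨ *-assoc (s x) (s x) (w x) ⟨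
            (s x * s x) * w x                                  ≡⟨ trans (cong (_* w x) (square (s≢0 x))) (*-identityˡ (w x)) ⟩
            w x ∎
            where open ≡-Reasoning

        Affine : Set
        Affine = ∃ λ a → ∀ x → π x ≡ a ⊛ x ⊕ π 𝟎

        e-≢0-invariant : ∀ i j → (e (i ⊖ j) ≢ 0# → e (π i ⊖ π j) ≢ 0#) × (e (π i ⊖ π j) ≢ 0# → e (i ⊖ j) ≢ 0#)
        e-≢0-invariant i j = (λ nz → *-nonzeroʳ (subst (_≢ 0#) (sym (e-monomial i j)) nz))
                           , λ nz → subst (_≢ 0#) (e-monomial i j) (*-nonzero (*-nonzero (s≢0 i) (s≢0 j)) nz)

        ≢-invariant : ∀ i j → (i ⊖ j ≢ 𝟎 → π i ⊖ π j ≢ 𝟎) × (π i ⊖ π j ≢ 𝟎 → i ⊖ j ≢ 𝟎)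
        ≢-invariant i j = (λ neq eq → neq (trans (cong (_⊖ j) (π-injective i j (I.x-y≡0⇒x≡y eq))) (I.-‿inverseʳ j)))
                        , λ neq eq → neq (trans (cong (λ k → π k ⊖ π j) (I.x-y≡0⇒x≡y eq)) (I.-‿inverseʳ (π j)))

        differing? : ∀ x → Decidable (λ j → s j ≢ s x)
        differing? x j = ¬? (s j ≟ s x)

        -- Here the support of e is the set of all nonzero elements and carries no information about
        -- π. The finer set on which e is 1 does, once the signs are known to be constant.
        module OffDiagonal (e0 : e 𝟎 ≡ 0#) (full : ∀ d → d ≢ 𝟎 → e d ≢ 0#) where

          -- Comparing the numbers of entries -1 in a row of e before and after the sign change.
          differing-even : ∀ x → ∃ λ h → count (differing? x) ≡ h ℕ.+ h
          differing-even x = count (λ j → differing? x j ×-dec ¬? (A? j)) , trans (count-split (differing? x) A?)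
            (cong (ℕ._+ count (λ j → differing? x j ×-dec ¬? (A? j))) (ℕ.+-cancelʳ-≡ (count (λ j → A? j ×-dec ¬? (differing? x j))) _ _ (begin
              count (λ j → differing? x j ×-dec A? j) ℕ.+ count (λ j → A? j ×-dec ¬? (differing? x j))
                ≡⟨ cong (ℕ._+ count (λ j → A? j ×-dec ¬? (differing? x j))) (count-cong (λ j → differing? x j ×-dec A? j) (λ j → A? j ×-dec differing? x j) (λ _ (p , q) → q , p) (λ _ (p , q) → q , p)) ⟩
              count (λ j → A? j ×-dec differing? x j) ℕ.+ count (λ j → A? j ×-dec ¬? (differing? x j))
                ≡⟨ count-split A? (differing? x) ⟨
              count A?
                ≡⟨ trans (sym A-count) A′-count ⟩
              count A′?
                ≡⟨ count-split A′? (differing? x) ⟩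
              count (λ j → A′? j ×-dec differing? x j) ℕ.+ count (λ j → A′? j ×-dec ¬? (differing? x j))
                ≡⟨ cong₂ ℕ._+_ (count-cong (λ j → A′? j ×-dec differing? x j) (λ j → differing? x j ×-dec ¬? (A? j)) (λ j (a′ , b) → b , flip j b a′) (λ j (b , ¬a) → flip⁻ j b ¬a , b))
                               (count-cong (λ j → A′? j ×-dec ¬? (differing? x j)) (λ j → A? j ×-dec ¬? (differing? x j)) (λ j (a′ , ¬b) → trans (sym (keep j ¬b)) a′ , ¬b) (λ j (a , ¬b) → trans (keep j ¬b) a , ¬b)) ⟩
              count (λ j → differing? x j ×-dec ¬? (A? j)) ℕ.+ count (λ j → A? j ×-dec ¬? (differing? x j)) ∎)))
            where
            open ≡-Reasoning
            A? : Decidable (λ j → e (x ⊖ j) ≡ - 1#)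
            A? j = e (x ⊖ j) ≟ - 1#
            A′? : Decidable (λ j → e (π x ⊖ π j) ≡ - 1#)
            A′? j = e (π x ⊖ π j) ≟ - 1#
            involution : ∀ a y → a ⊖ (a ⊖ y) ≡ y
            involution = solveᴵ 2 (λ a y → a ∸∸ (a ∸∸ y) ≔ y) refl
            A-count : count (λ d → e d ≟ - 1#) ≡ count A?
            A-count = sum-bijection (λ d → 𝟙 (e d ≟ - 1#)) (λ j → x ⊖ j) (λ j → x ⊖ j) (involution x) (involution x)
            A′-count : count (λ d → e d ≟ - 1#) ≡ count A′?
            A′-count = sum-bijection (λ d → 𝟙 (e d ≟ - 1#)) (λ j → π x ⊖ π j) (λ d → π⁻¹ (π x ⊖ d))
              (λ d → trans (cong (λ d → π x ⊖ d) (π-π⁻¹ _)) (involution (π x) d))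
              (λ j → π-injective _ _ (trans (π-π⁻¹ _) (involution (π x) (π j))))
            keep : ∀ j → ¬ (s j ≢ s x) → e (π x ⊖ π j) ≡ e (x ⊖ j)
            keep j ¬b with s j ≟ s x
            ... | no b = contradiction b ¬b
            ... | yes eq = trans (sym (*-identityˡ _)) (trans (cong (_* e (π x ⊖ π j)) (sym (trans (cong (s x *_) eq) (square (s≢0 x))))) (e-monomial x j))
            negate : ∀ j → s j ≢ s x → - 1# * e (π x ⊖ π j) ≡ e (x ⊖ j)
            negate j b = trans (cong (_* e (π x ⊖ π j)) (sym (±-sign (s≢0 x) (s≢0 j) (b ∘ sym)))) (e-monomial x j)
            flip : ∀ j → s j ≢ s x → e (π x ⊖ π j) ≡ - 1# → e (x ⊖ j) ≢ - 1#
            flip j b a′ a = -1≢1 (trans (sym a) (trans (sym (negate j b)) (trans (cong (- 1# *_) a′) -1*-1)))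
            flip⁻ : ∀ j → s j ≢ s x → e (x ⊖ j) ≢ - 1# → e (π x ⊖ π j) ≡ - 1#
            flip⁻ j b ¬a with nonzero (proj₁ (e-≢0-invariant x j) (full _ λ eq → b (cong s (sym (I.x-y≡0⇒x≡y eq)))))
            ... | inj₂ eq = eq
            ... | inj₁ eq = contradiction (trans (sym (negate j b)) (trans (cong (- 1# *_) eq) (*-identityʳ _))) ¬a

          odd : ∀ h → p ≢ h ℕ.+ h
          odd h eq with prime⇒irreducible pr {2} (divides h (trans eq (sym (trans (ℕ.*-comm h 2) (cong (h ℕ.+_) (ℕ.+-identityʳ h))))))
          ... | inj₂ refl = contradiction 3<p λ { (s≤s (s≤s ())) }

          -- If both signs occurred, the indices with sign other than s x and those with sign other
          -- than s y would partition the p indices into two sets of even size.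
          s-constant : ∀ x y → s x ≡ s y
          s-constant x y with s x ≟ s y
          ... | yes eq = eq
          ... | no neq = contradiction total (odd (h ℕ.+ h′))
            where
            open ≡-Reasoning
            h = proj₁ (differing-even x)
            h′ = proj₁ (differing-even y)
            third : ∀ {a b c} → a ≢ 0# → b ≢ 0# → c ≢ 0# → a ≢ b → c ≢ b → c ≡ a
            third a≢0 b≢0 c≢0 a≢b c≢b with nonzero a≢0 | nonzero b≢0 | nonzero c≢0
            ... | inj₁ refl | inj₁ refl | _ = contradiction refl a≢b
            ... | inj₂ refl | inj₂ refl | _ = contradiction refl a≢b
            ... | _ | inj₁ refl | inj₁ refl = contradiction refl c≢b
            ... | _ | inj₂ refl | inj₂ refl = contradiction refl c≢b
            ... | inj₁ refl | _ | inj₁ refl = refl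
            ... | inj₂ refl | _ | inj₂ refl = refl
            total : p ≡ (h ℕ.+ h′) ℕ.+ (h ℕ.+ h′)
            total = begin
              p                                                     ≡⟨ count-all {n = p} (λ _ → yes tt) (λ _ → tt) ⟨
              count {n = p} (λ _ → yes tt)                          ≡⟨ count-split {n = p} (λ _ → yes tt) (differing? x) ⟩
              count (λ j → yes tt ×-dec differing? x j) ℕ.+ count (λ j → yes tt ×-dec ¬? (differing? x j))
                ≡⟨ cong₂ ℕ._+_ (count-cong (λ j → yes tt ×-dec differing? x j) (differing? x) (λ _ → proj₂) (λ _ b → tt , b))
                               (count-cong (λ j → yes tt ×-dec ¬? (differing? x j)) (differing? y) (λ j (_ , ¬b) → λ eq → ¬b λ eq′ → neq (trans (sym eq′) eq))
                                 (λ j b → tt , λ b′ → b′ (third (s≢0 x) (s≢0 y) (s≢0 j) neq b))) ⟩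
              count (differing? x) ℕ.+ count (differing? y)         ≡⟨ cong₂ ℕ._+_ (proj₂ (differing-even x)) (proj₂ (differing-even y)) ⟩
              (h ℕ.+ h) ℕ.+ (h′ ℕ.+ h′)                             ≡⟨ interchange h h h′ h′ ⟩
              (h ℕ.+ h′) ℕ.+ (h ℕ.+ h′)                             ∎

          e-invariant : ∀ i j → e (π i ⊖ π j) ≡ e (i ⊖ j)
          e-invariant i j = trans (sym (*-identityˡ _)) (trans (cong (_* e (π i ⊖ π j)) (sym (trans (cong (s i *_) (s-constant j i)) (square (s≢0 i))))) (e-monomial i j))

          -- If e is constant off 0, then e plus its first translate has full weight.
          not-constant : ∀ {v} → v ≢ 0# → ¬ (∀ d → d ≢ 𝟎 → e d ≡ v)
          not-constant {v} v≢0 const = no-full (W-+ We (shift (⊖ 𝟏) We)) sum≢0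
            where
            sum≢0 : ∀ x → e x + e (x ⊖ 𝟏) ≢ 0#
            sum≢0 x eq with x ≟ 𝟎 | x ⊖ 𝟏 ≟ 𝟎
            ... | yes refl | yes eq′ = I.1≢0 (sym (I.x-y≡0⇒x≡y eq′))
            ... | yes refl | no neq′ = v≢0 (trans (sym (+-identityˡ v)) (trans (cong₂ _+_ (sym e0) (sym (const _ neq′))) eq))
            ... | no neq | yes eq′ = v≢0 (trans (sym (+-identityʳ v)) (trans (cong₂ _+_ (sym (const _ neq)) (sym (trans (cong e eq′) e0))) eq))
            ... | no neq | no neq′ = double-nonzero v≢0 (trans (cong₂ _+_ (sym (const _ neq)) (sym (const _ neq′))) eq)

          affine : Affine
          affine with any? (λ d → ¬? (d ≟ 𝟎) ×-dec (e d ≟ 1#)) | any? (λ d → ¬? (d ≟ 𝟎) ×-dec ¬? (e d ≟ 1#))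
          ... | yes (d , _ , ed) | yes (d′ , d′≢0 , ed′) = affine-of-invariant pr P (λ d → e d ≟ 1#) (λ eq → 1≢0 (trans (sym eq) e0)) (d , ed) (d′ , d′≢0 , ed′) π π-injective
                  (λ i j eq → trans (e-invariant i j) eq) (λ i j eq → trans (sym (e-invariant i j)) eq)
          ... | no none | _ = contradiction (λ d d≢0 → is--1 d d≢0) (not-constant -1≢0)
            where
            is--1 : ∀ d → d ≢ 𝟎 → e d ≡ - 1#
            is--1 d d≢0 with nonzero (full d d≢0)
            ... | inj₁ eq = contradiction (d , d≢0 , eq) none
            ... | inj₂ eq = eq
          ... | yes _ | no none = contradiction (λ d d≢0 → is-1 d d≢0) (not-constant 1≢0)
            where
            is-1 : ∀ d → d ≢ 𝟎 → e d ≡ 1#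
            is-1 d d≢0 with e d ≟ 1#
            ... | yes eq = eq
            ... | no neq = contradiction (d , d≢0 , neq) none

        -- If e takes zero and nonzero values off 0, its support there is a proper invariant set.
        -- The extreme cases: a support inside the single point 0 gives a word of weight one, a
        -- support of all indices a word of full weight, and a support missing only 0 is left to
        -- `OffDiagonal`.
        monomial-affine : Affine
        monomial-affine with any? (λ d → ¬? (d ≟ 𝟎) ×-dec ¬? (e d ≟ 0#)) | any? (λ d → ¬? (d ≟ 𝟎) ×-dec (e d ≟ 0#))
        ... | yes (d , d≢0 , ed≢0) | yes (d′ , d′≢0 , ed′) =
                affine-of-invariant pr P (λ d → ¬? (d ≟ 𝟎) ×-dec ¬? (e d ≟ 0#)) (λ (neq , _) → neq refl) (d , d≢0 , ed≢0) (d′ , d′≢0 , λ (_ , nz) → nz ed′) π π-injective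
                  (λ i j (neq , nz) → proj₁ (≢-invariant i j) neq , proj₁ (e-≢0-invariant i j) nz)
                  (λ i j (neq , nz) → proj₂ (≢-invariant i j) neq , proj₂ (e-≢0-invariant i j) nz)
        ... | no none | _ = weight≢1 We 𝟎 e0≢0 off
          where
          off : ∀ d → d ≢ 𝟎 → e d ≡ 0#
          off d d≢0 with e d ≟ 0#
          ... | yes eq = eq
          ... | no nz = contradiction (d , d≢0 , nz) none
          e0≢0 : e 𝟎 ≢ 0#
          e0≢0 e0 = word≢0 (trans (sym (e-fixes W-word support)) (trans (S.sum-cong-≗ λ a → trans (cong (_* word a) (zero-everywhere _)) (zeroˡ _)) (S.sum-replicate-zero p)))
            where
            zero-everywhere : ∀ d → e d ≡ 0#
            zero-everywhere d with d ≟ 𝟎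
            ... | yes refl = e0
            ... | no d≢0 = off d d≢0
        ... | yes _ | no none with e 𝟎 ≟ 0#
        ... | yes e0 = OffDiagonal.affine e0 λ d d≢0 eq → none (d , d≢0 , eq)
        ... | no e0≢0 = contradiction everywhere (no-full We)
          where
          everywhere : ∀ d → e d ≢ 0#
          everywhere d with d ≟ 𝟎
          ... | yes refl = e0≢0
          ... | no d≢0 = λ eq → none (d , d≢0 , eq)

-- Groups with p blocks of size three.

module WreathProducts where

  open Counting
  open Zmod
  open FinGroup
  open Muller
  open CyclicCode
  open import Data.Fin using (Fin; zero; suc; toℕ; _≟_; combine; remQuot) renaming (_<?_ to _<ᶠ?_)
  open import Data.Fin.Properties using (any?; all?; remQuot-combine; combine-remQuot)
  open import Data.Integer using () renaming (+_ to +ℤ_)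
  open import Data.Nat using (ℕ; zero; suc; _≤_; _<_; z≤n; s≤s; NonZero; >-nonZero)
  import Data.Nat as ℕ
  import Data.Nat.Properties as ℕ
  open import Data.Nat.Primality using (Prime; prime⇒nonZero)
  open import Data.Product using (∃; _,_; _×_; proj₁; proj₂)
  open import Data.Sum using (_⊎_; inj₁; inj₂)
  open import Data.Unit using (tt)
  open import Function using (_∘_)
  open import Level using (0ℓ)
  open import Relation.Binary.PropositionalEquality hiding ([_])
  open import Relation.Nullary using (Dec; yes; no; ¬_; contradiction; ¬?; _×-dec_; _→-dec_; _⊎-dec_)
  open import Relation.Nullary.Decidable using (map′)
  open import Relation.Unary using (Pred; Decidable)

  -- A single positive term is at most c. Once two terms are positive, each positive term is at most
  -- c / 3, and there are at most three terms.
  sum-of-few : ∀ {l c} (T : Fin l → ℕ) → l ≤ 3 → (∀ j → T j ≤ c) → (∀ i j → i ≢ j → 0 < T i → 0 < T j → 3 ℕ.* T j ≤ c) → sum T ≤ c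
  sum-of-few {l} {c} T l≤3 single pair with any? (λ i → 0 ℕ.<? T i)
  ... | no none = ℕ.≤-trans (ℕ.≤-reflexive (trans (sum-cong-≗ λ i → ℕ.n≤0⇒n≡0 (ℕ.≮⇒≥ λ pos → none (i , pos))) (sum-replicate-zero l))) z≤n
  ... | yes (i , Ti>0) with any? (λ j → ¬? (j ≟ i) ×-dec (0 ℕ.<? T j))
  ... | no none = ℕ.≤-trans (ℕ.≤-reflexive (sum-single T i λ j j≢i → ℕ.n≤0⇒n≡0 (ℕ.≮⇒≥ λ pos → none (j , j≢i , pos)))) (single i)
  ... | yes (j , j≢i , Tj>0) = ℕ.*-cancelˡ-≤ 3 (begin
    3 ℕ.* sum T             ≡⟨ *-distribˡ-sum 3 T ⟩
    sum (λ k → 3 ℕ.* T k)   ≤⟨ sum-≤-const third ⟩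
    l ℕ.* c                 ≤⟨ ℕ.*-monoˡ-≤ c l≤3 ⟩
    3 ℕ.* c                 ∎)
    where
    open ℕ.≤-Reasoning
    third : ∀ k → 3 ℕ.* T k ≤ c
    third k with 0 ℕ.<? T k
    ... | no Tk≯0 = subst (λ m → 3 ℕ.* m ≤ c) (sym (ℕ.n≤0⇒n≡0 (ℕ.≮⇒≥ Tk≯0))) z≤n
    ... | yes Tk>0 with i ≟ k
    ...   | no i≢k   = pair i k i≢k Ti>0 Tk>0
    ...   | yes refl = pair j k j≢i Tj>0 Tk>0

  -- Blocks of size three, indexed by ℤ/p and carrying coordinates in ℤ/3; permutations of a block are affine maps.
  record Wreath {p} (pr : Prime p) (P : PrimeField p) (F : PrimeField 3) {N} (G : FiniteAction N (3 ℕ.* p)) : Set where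
    module I = FieldTheory pr P
    open Ternary F
    open I using () renaming (_+_ to _⊕_; 0# to 0ᴵ; 1# to 𝟏)
    open FiniteAction G
    field
      3<p        : 3 < p
      transitive : Transitiveᵃ
      coord      : Fin p → K → Fin (3 ℕ.* p)
      coord-injective  : ∀ {x x′ y y′} → coord x y ≡ coord x′ y′ → x ≡ x′ × y ≡ y′
      coord-surjective : ∀ ω → ∃ λ x → ∃ λ y → coord x y ≡ ω
      π          : El → Fin p → Fin p
      τ s        : El → Fin p → K
      s≢0        : ∀ g x → s g x ≢ 0#
      act-coord  : ∀ g x y → act g (coord x y) ≡ coord (π g x) (τ g x + s g x * y)
      t          : El
      π-t        : ∀ x → π t x ≡ x ⊕ 𝟏
      τ-t        : ∀ x → τ t x ≡ 0#
      s-t        : ∀ x → s t x ≡ 1#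
      links      : ∀ y → ∃ λ g → (∀ x → π g x ≡ x) × τ g 0ᴵ ≡ y

  module WreathTheory {p} {pr : Prime p} {P : PrimeField p} {F : PrimeField 3} {N} {G : FiniteAction N (3 ℕ.* p)} (A : Wreath pr P F G) where
    open Wreath A
    open Ternary F
    open I using () renaming (_+_ to _⊕_; _-_ to _⊖_; -_ to ⊖_; _*_ to _⊛_; 0# to 𝟎; 1# to 𝟏; solve to solveᴵ; con to conᴵ; _:+_ to _⊹_; _:-_ to _∸∸_; _:=_ to _≔_; :-_ to neg_; _:*_ to _∗_)
    open FiniteAction G

    private instance
      p≢0 : NonZero p
      p≢0 = prime⇒nonZero pr

    Index : Set
    Index = Fin p

    affine-unique : ∀ {a b c d} → (∀ y → a + b * y ≡ c + d * y) → a ≡ c × b ≡ d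
    affine-unique {a} {b} {c} {d} h = a≡c , trans (sym (slope a b)) (trans (cong₂ _-_ (h 1#) a≡c) (slope c d))
      where
      a≡c : a ≡ c
      a≡c = trans (sym (trans (cong (a +_) (zeroʳ b)) (+-identityʳ a))) (trans (h 0#) (trans (cong (c +_) (zeroʳ d)) (+-identityʳ c)))
      slope : ∀ a b → a + b * 1# - a ≡ b
      slope a b = trans (cong (λ z → a + z - a) (*-identityʳ b)) (solve 2 (λ a b → a :+ b :- a := b) refl a b)

    private
      compose : ∀ g h x y → π (g ∙ h) x ≡ π h (π g x) × τ (g ∙ h) x + s (g ∙ h) x * y ≡ τ h (π g x) + s h (π g x) * (τ g x + s g x * y)
      compose g h x y = coord-injective (trans (sym (act-coord (g ∙ h) x y)) (trans (act-∙ g h _) (trans (cong (act h) (act-coord g x y)) (act-coord h _ _))))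

      unit : ∀ x y → π ε x ≡ x × τ ε x + s ε x * y ≡ y
      unit x y = coord-injective (trans (sym (act-coord ε x y)) (act-ε _))

    π-∙ : ∀ g h x → π (g ∙ h) x ≡ π h (π g x)
    π-∙ g h x = proj₁ (compose g h x 0#)

    τs-∙ : ∀ g h x → τ (g ∙ h) x ≡ τ h (π g x) + s h (π g x) * τ g x × s (g ∙ h) x ≡ s h (π g x) * s g x
    τs-∙ g h x = affine-unique λ y → trans (proj₂ (compose g h x y))
      (solve 5 (λ a b c d y → a :+ b :* (c :+ d :* y) := (a :+ b :* c) :+ (b :* d) :* y) refl (τ h (π g x)) (s h (π g x)) (τ g x) (s g x) y)

    τ-∙ : ∀ g h x → τ (g ∙ h) x ≡ τ h (π g x) + s h (π g x) * τ g x
    τ-∙ g h x = proj₁ (τs-∙ g h x)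

    s-∙ : ∀ g h x → s (g ∙ h) x ≡ s h (π g x) * s g x
    s-∙ g h x = proj₂ (τs-∙ g h x)

    π-ε : ∀ x → π ε x ≡ x
    π-ε x = proj₁ (unit x 0#)

    τs-ε : ∀ x → τ ε x ≡ 0# × s ε x ≡ 1#
    τs-ε x = affine-unique λ y → trans (proj₂ (unit x y)) (sym (trans (+-identityˡ _) (*-identityˡ y)))

    τ-ε : ∀ x → τ ε x ≡ 0#
    τ-ε x = proj₁ (τs-ε x)

    s-ε : ∀ x → s ε x ≡ 1#
    s-ε x = proj₂ (τs-ε x)

    π-⁻¹ˡ : ∀ g x → π (g ⁻¹) (π g x) ≡ x
    π-⁻¹ˡ g x = trans (sym (π-∙ g (g ⁻¹) x)) (trans (cong (λ h → π h x) (inverseʳ g)) (π-ε x))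

    π-⁻¹ʳ : ∀ g x → π g (π (g ⁻¹) x) ≡ x
    π-⁻¹ʳ g x = trans (sym (π-∙ (g ⁻¹) g x)) (trans (cong (λ h → π h x) (inverseˡ g)) (π-ε x))

    π-injective : ∀ g x y → π g x ≡ π g y → x ≡ y
    π-injective g x y e = trans (sym (π-⁻¹ˡ g x)) (trans (cong (π (g ⁻¹)) e) (π-⁻¹ˡ g y))

    s-⁻¹ : ∀ g x → s (g ⁻¹) (π g x) ≡ s g x
    s-⁻¹ g x = begin
      s (g ⁻¹) (π g x)                        ≡⟨ *-identityʳ _ ⟨
      s (g ⁻¹) (π g x) * 1#                   ≡⟨ cong (s (g ⁻¹) (π g x) *_) (square (s≢0 g x)) ⟨
      s (g ⁻¹) (π g x) * (s g x * s g x)      ≡⟨ *-assoc _ _ _ ⟨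
      s (g ⁻¹) (π g x) * s g x * s g x        ≡⟨ cong (_* s g x) (trans (sym (s-∙ g (g ⁻¹) x)) (trans (cong (λ h → s h x) (inverseʳ g)) (s-ε x))) ⟩
      1# * s g x                              ≡⟨ *-identityˡ _ ⟩
      s g x                                   ∎
      where open ≡-Reasoning

    private
      -- Among the elements with τ = 1, with τ = -1 and their product, one has sign 1 at the block 0.
      orientable : ∃ λ g → (∀ x → π g x ≡ x) × s g 𝟎 ≡ 1# × τ g 𝟎 ≢ 0#
      orientable with links 1# | links (- 1#)
      ... | g , πg , τg | h , πh , τh with nonzero (s≢0 g 𝟎) | nonzero (s≢0 h 𝟎)
      ...   | inj₁ e | _      = g , πg , e , subst (_≢ 0#) (sym τg) 1≢0
      ...   | inj₂ _ | inj₁ e = h , πh , e , subst (_≢ 0#) (sym τh) -1≢0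
      ...   | inj₂ e | inj₂ e′ = g ∙ h , (λ x → trans (π-∙ g h x) (trans (πh _) (πg x)))
              , trans (s-∙ g h 𝟎) (trans (cong₂ _*_ (trans (cong (s h) (πg 𝟎)) e′) e) -1*-1)
              , subst (_≢ 0#) (sym (trans (τ-∙ g h 𝟎) (cong₂ _+_ (trans (cong (τ h) (πg 𝟎)) τh)
                  (trans (cong₂ _*_ (trans (cong (s h) (πg 𝟎)) e′) τg) (*-identityʳ _))))) (double-nonzero -1≢0)

    -- Squaring makes every sign 1. At the block 0 the sign was already 1, so the nonzero
    -- displacement is doubled and stays nonzero.
    c₀ : El
    c₀ = proj₁ orientable ∙ proj₁ orientable

    π-c₀ : ∀ x → π c₀ x ≡ x
    π-c₀ x = let g , πg , _ = orientable in trans (π-∙ g g x) (trans (πg _) (πg x))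

    s-c₀ : ∀ x → s c₀ x ≡ 1#
    s-c₀ x = let g , πg , _ = orientable in trans (s-∙ g g x) (trans (cong (λ z → s g z * s g x) (πg x)) (square (s≢0 g x)))

    x₀ : Index
    x₀ = 𝟎

    τ-c₀ : τ c₀ x₀ ≢ 0#
    τ-c₀ = let g , πg , sg , τg = orientable in
      subst (_≢ 0#) (sym (trans (τ-∙ g g 𝟎) (cong₂ _+_ (cong (τ g) (πg 𝟎)) (trans (cong (_* τ g 𝟎) (trans (cong (s g) (πg 𝟎)) sg)) (*-identityˡ _))))) (double-nonzero τg)

    agree-coord : ∀ {g h} → Agree g h → ∃ λ x → ∃ λ y → π g x ≡ π h x × τ g x + s g x * y ≡ τ h x + s h x * y
    agree-coord {g} {h} (ω , e) with x , y , refl ← coord-surjective ω =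
      x , y , coord-injective (trans (sym (act-coord g x y)) (trans e (act-coord h x y)))

    coord-agree : ∀ {g h} x y → π g x ≡ π h x → τ g x + s g x * y ≡ τ h x + s h x * y → Agree g h
    coord-agree {g} {h} x y e e′ = coord x y , trans (act-coord g x y) (trans (cong₂ coord e e′) (sym (act-coord h x y)))

    π-t^ : ∀ k x → π (t ^ k) x ≡ x ⊕ I.[ k ]
    π-t^ zero    x = trans (π-ε x) (sym (trans (cong (x ⊕_) I.[0]) (I.+-identityʳ x)))
    π-t^ (suc k) x = trans (π-∙ t (t ^ k) x) (trans (cong (π (t ^ k)) (π-t x)) (trans (π-t^ k (x ⊕ 𝟏))
      (trans (solveᴵ 3 (λ x o k → (x ⊹ o) ⊹ k ≔ x ⊹ (k ⊹ o)) refl x 𝟏 I.[ k ]) (cong (x ⊕_) (sym (I.[suc] k))))))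

    s-t^ : ∀ k x → s (t ^ k) x ≡ 1#
    s-t^ zero    x = s-ε x
    s-t^ (suc k) x = trans (s-∙ t (t ^ k) x) (trans (cong₂ _*_ (s-t^ k _) (s-t x)) 1*1)

    τ-t^ : ∀ k x → τ (t ^ k) x ≡ 0#
    τ-t^ zero    x = τ-ε x
    τ-t^ (suc k) x = trans (τ-∙ t (t ^ k) x) (trans (cong₂ _+_ (τ-t^ k _) (trans (cong (s (t ^ k) (π t x) *_) (τ-t x)) (zeroʳ _))) (+-identityˡ 0#))

    translation : Index → El
    translation a = t ^ toℕ a

    π-translation : ∀ a x → π (translation a) x ≡ x ⊕ a
    π-translation a x = trans (π-t^ (toℕ a) x) (cong (x ⊕_) (I.[]-toℕ a))

    π-∙translation : ∀ g a x → π (g ∙ translation a) x ≡ π g x ⊕ a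
    π-∙translation g a x = trans (π-∙ g _ x) (π-translation a _)

    s-∙translation : ∀ g a x → s (g ∙ translation a) x ≡ s g x
    s-∙translation g a x = trans (s-∙ g _ x) (trans (cong (_* s g x) (s-t^ (toℕ a) _)) (*-identityˡ _))

    τ-∙translation : ∀ g a x → τ (g ∙ translation a) x ≡ τ g x
    τ-∙translation g a x = trans (τ-∙ g _ x) (trans (cong₂ _+_ (τ-t^ (toℕ a) _) (trans (cong (_* τ g x) (s-t^ (toℕ a) _)) (*-identityˡ _))) (+-identityˡ _))

    C : Pred El 0ℓ
    C g = (∀ x → π g x ≡ x) × (∀ x → s g x ≡ 1#)

    C? : Decidable C
    C? g = all? (λ x → π g x ≟ x) ×-dec all? (λ x → s g x ≟ 1#)

    C-ε : C ε
    C-ε = π-ε , s-ε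

    C-∙ : ∀ {g h} → C g → C h → C (g ∙ h)
    C-∙ {g} {h} (πg , sg) (πh , sh) = (λ x → trans (π-∙ g h x) (trans (πh _) (πg x))) , λ x → trans (s-∙ g h x) (trans (cong₂ _*_ (sh _) (sg x)) 1*1)

    τ-∙C : ∀ g {c} → C c → ∀ x → τ (g ∙ c) x ≡ τ c (π g x) + τ g x
    τ-∙C g {c} (_ , sc) x = trans (τ-∙ g c x) (cong (τ c (π g x) +_) (trans (cong (_* τ g x) (sc _)) (*-identityˡ _)))

    C-^ : ∀ {c} → C c → ∀ k → C (c ^ k) × (∀ x → τ (c ^ k) x ≡ [ k ] * τ c x)
    C-^ {c} Cc zero    = C-ε , λ x → trans (τ-ε x) (sym (trans (cong (_* τ c x) [0]) (zeroˡ _)))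
    C-^ {c} Cc (suc k) = C-∙ Cc (proj₁ (C-^ Cc k)) , λ x → begin
      τ (c ∙ c ^ k) x                       ≡⟨ τ-∙C c (proj₁ (C-^ Cc k)) x ⟩
      τ (c ^ k) (π c x) + τ c x             ≡⟨ cong (_+ τ c x) (trans (cong (τ (c ^ k)) (proj₁ Cc x)) (proj₂ (C-^ Cc k) x)) ⟩
      [ k ] * τ c x + τ c x                 ≡⟨ cong ([ k ] * τ c x +_) (*-identityˡ _) ⟨
      [ k ] * τ c x + 1# * τ c x            ≡⟨ distribʳ (τ c x) [ k ] 1# ⟨
      ([ k ] + 1#) * τ c x                  ≡⟨ cong (_* τ c x) ([suc] k) ⟨
      [ suc k ] * τ c x                     ∎
      where open ≡-Reasoning

    *-cancelʳ : ∀ {a b c} → c ≢ 0# → a * c ≡ b * c → a ≡ b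
    *-cancelʳ {a} {b} {c} c≢0 e = trans (sym (*-identityʳ a)) (trans (cong (a *_) (sym (square c≢0))) (trans (sym (*-assoc a c c))
      (trans (cong (_* c) e) (trans (*-assoc b c c) (trans (cong (b *_) (square c≢0)) (*-identityʳ b))))))

    W : (Index → K) → Set
    W w = ∃ λ c → C c × ∀ x → τ c x ≡ w x

    W-neg : ∀ {w} → W w → W (λ x → - w x)
    W-neg {w} (c , Cc , τc) = c ∙ c , C-∙ Cc Cc , λ x → trans (τ-∙C c Cc x) (trans (cong₂ _+_ (trans (cong (τ c) (proj₁ Cc x)) (τc x)) (τc x))
      (trans (solve 1 (λ w → w :+ w := (w :+ w :+ w) :- w) refl (w x)) (trans (cong (_- w x) (triple (w x))) (+-identityˡ _))))

    W-cong : ∀ {u w} → (∀ x → u x ≡ w x) → W u → W w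
    W-cong h (c , Cc , τc) = c , Cc , λ x → trans (τc x) (h x)

    W-zero : W (λ _ → 0#)
    W-zero = ε , C-ε , τ-ε

    space : Subspace F p
    space = record
      { W = W
      ; W-cong = W-cong
      ; W-0 = W-zero
      ; W-+ = λ { {u} {w} (c , Cc , τc) (d , Cd , τd) → d ∙ c , C-∙ Cd Cc , λ x → trans (τ-∙C d Cc x) (cong₂ _+_ (trans (cong (τ c) (proj₁ Cd x)) (τc x)) (τd x)) }
      ; W-scale = scale
      ; pivot? = λ i → map′ (λ (c , Cc , below , nz) → τ c , (c , Cc , λ _ → refl) , below , nz)
          (λ (w , (c , Cc , τc) , below , nz) → c , Cc , (λ j lt → trans (τc j) (below j lt)) , subst (_≢ 0#) (sym (τc i)) nz)
          -- Words are displacement vectors of group elements, so the search for a pivot runs over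
          -- the finite group.
          (any? λ c → C? c ×-dec (all? (λ j → (j <ᶠ? i) →-dec (τ c j ≟ 0#)) ×-dec ¬? (τ c i ≟ 0#)))
      }
      where
      scale : ∀ a {w} → W w → W (λ x → a * w x)
      scale a {w} Ww with three-elements a
      ... | inj₁ refl        = W-cong (λ x → sym (zeroˡ (w x))) W-zero
      ... | inj₂ (inj₁ refl) = W-cong (λ x → sym (*-identityˡ (w x))) Ww
      ... | inj₂ (inj₂ refl) = W-cong (λ x → trans (cong -_ (sym (*-identityˡ (w x)))) (solve 2 (λ o w → :- (o :* w) := (:- o) :* w) refl 1# (w x))) (W-neg Ww)

    -- The word is that of the conjugate of c by g: conjugation carries block x to block π x and
    -- multiplies the displacement by the sign of g at x.
    push : ∀ g {w} → W w → ∃ λ u → W u × ∀ x → u (π g x) ≡ s g x * w x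
    push g {w} (c , (πc , sc) , τc) = τ k , (k , (πk , sk) , λ _ → refl) , λ x → trans (value x) (cong (s g x *_) (τc x))
      where
      k = conj g c
      g∙k : g ∙ k ≡ c ∙ g
      g∙k = trans (sym (assoc g _ g)) (cong (_∙ g) (trans (sym (assoc g (g ⁻¹) c)) (trans (cong (_∙ c) (inverseʳ g)) (identityˡ c))))
      at : ∀ {Q : Index → Set} → (∀ x → Q (π g x)) → ∀ z → Q z
      at {Q} h z = subst Q (π-⁻¹ʳ g z) (h (π (g ⁻¹) z))
      πk : ∀ z → π k z ≡ z
      πk = at λ x → trans (sym (π-∙ g k x)) (trans (cong (λ h → π h x) g∙k) (trans (π-∙ c g x) (cong (π g) (πc x))))
      sk : ∀ z → s k z ≡ 1#
      sk = at λ x → *-cancelʳ (s≢0 g x) (trans (sym (s-∙ g k x)) (trans (cong (λ h → s h x) g∙k) (trans (s-∙ c g x)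
             (trans (cong₂ _*_ (cong (s g) (πc x)) (sc x)) (*-comm _ 1#)))))
      value : ∀ x → τ k (π g x) ≡ s g x * τ c x
      value x = begin
        τ k (π g x)                                ≡⟨ solve 2 (λ a b → a := a :+ b :- b) refl (τ k (π g x)) (τ g x) ⟩
        τ k (π g x) + τ g x - τ g x                ≡⟨ cong (_- τ g x) (trans (sym (τ-∙C g (πk , sk) x)) (trans (cong (λ h → τ h x) g∙k) (τ-∙ c g x))) ⟩
        τ g (π c x) + s g (π c x) * τ c x - τ g x  ≡⟨ cong (λ z → τ g z + s g z * τ c x - τ g x) (πc x) ⟩
        τ g x + s g x * τ c x - τ g x              ≡⟨ solve 2 (λ a b → a :+ b :- a := b) refl (τ g x) (s g x * τ c x) ⟩
        s g x * τ c x                              ∎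
        where open ≡-Reasoning

    pull : ∀ g {w} → W w → W (λ x → s g x * w (π g x))
    pull g {w} Ww = let u , Wu , eq = push (g ⁻¹) {w} Ww in
      W-cong (λ x → trans (cong u (sym (π-⁻¹ˡ g x))) (trans (eq (π g x)) (cong (_* w (π g x)) (s-⁻¹ g x)))) Wu

    shift : ∀ a {w} → W w → W (λ x → w (x ⊕ a))
    shift a {w} Ww = W-cong (λ x → trans (cong₂ _*_ (s-t^ (toℕ a) x) (cong w (π-translation a x))) (*-identityˡ _)) (pull (translation a) Ww)

    origin : Fin (3 ℕ.* p)
    origin = coord 𝟎 0#

    -- The clique consists of t^i c^j for i in ℤ/p and j in ℤ/3. The image of one block determines
    -- i; after that the displacement j τ determines j, because no entry τ of c is zero.
    full-weight-clique : ∀ {c} → C c → (∀ x → τ c x ≢ 0#) → Density 1 1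
    full-weight-clique {c} Cc full = clique-density transitive {{ℕ.m*n≢0 3 p}} origin element clique
      where
      g : Fin 3 → Index → El
      g j i = translation i ∙ c ^ toℕ j
      π-g : ∀ j i x → π (g j i) x ≡ x ⊕ i
      π-g j i x = trans (π-∙ _ _ x) (trans (proj₁ (proj₁ (C-^ Cc (toℕ j))) _) (π-translation i x))
      s-g : ∀ j i x → s (g j i) x ≡ 1#
      s-g j i x = trans (s-∙ _ _ x) (trans (cong₂ _*_ (proj₂ (proj₁ (C-^ Cc (toℕ j))) _) (s-t^ (toℕ i) x)) 1*1)
      τ-g : ∀ j i x → τ (g j i) x ≡ j * τ c (x ⊕ i)
      τ-g j i x = trans (τ-∙C _ (proj₁ (C-^ Cc (toℕ j))) x) (trans (cong₂ _+_ (proj₂ (C-^ Cc (toℕ j)) _) (τ-t^ (toℕ i) x))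
        (trans (+-identityʳ _) (cong₂ (λ a z → a * τ c z) ([]-toℕ j) (π-translation i x))))
      j : Fin (3 ℕ.* p) → Fin 3
      j k = proj₁ (remQuot {3} p k)
      i : Fin (3 ℕ.* p) → Index
      i k = proj₂ (remQuot {3} p k)
      element : Fin (3 ℕ.* p) → El
      element k = g (j k) (i k)
      same : ∀ {j i j′ i′} → Agree (g j i) (g j′ i′) → j ≡ j′ × i ≡ i′
      same {j} {i} {j′} {i′} agree with x , y , e , e′ ← agree-coord agree
        with refl ← trans (solveᴵ 2 (λ x i → i ≔ (x ⊹ i) ∸∸ x) refl x i) (trans (cong (_⊖ x) (trans (sym (π-g j i x)) (trans e (π-g j′ i′ x)))) (solveᴵ 2 (λ x i → (x ⊹ i) ∸∸ x ≔ i) refl x i′))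
        = *-cancelʳ (full (x ⊕ i)) (trans (solve 2 (λ a y → a := a :+ y :- y) refl (j * τ c (x ⊕ i)) y) (trans (cong (_- y)
            (trans (sym (value j)) (trans e′ (value j′)))) (solve 2 (λ a y → a :+ y :- y := a) refl (j′ * τ c (x ⊕ i)) y))) , refl
        where
        value : ∀ j → τ (g j i) x + s (g j i) x * y ≡ j * τ c (x ⊕ i) + y
        value j = cong₂ _+_ (τ-g j i x) (trans (cong (_* y) (s-g j i x)) (*-identityˡ y))
      clique : ∀ k k′ → Agree (element k) (element k′) → k ≡ k′
      clique k k′ agree = let e , e′ = same {j k} {i k} {j k′} {i k′} agree in trans (sym (combine-remQuot {3} p k)) (trans (cong₂ combine e e′) (combine-remQuot {3} p k′))

    nonzero-word : ∀ z → ∃ λ c → C c × τ c z ≢ 0#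
    nonzero-word z =
      let c , Cc , τc = shift (x₀ ⊖ z) (c₀ , (π-c₀ , s-c₀) , λ _ → refl)
      in  c , Cc , subst (_≢ 0#) (sym (trans (τc z) (cong (τ c₀) (solveᴵ 2 (λ z x → z ⊹ (x ∸∸ z) ≔ x) refl z x₀)))) τ-c₀

    fibre? : ∀ z v → Decidable (λ c → C c × τ c z ≡ v)
    fibre? z v c = C? c ×-dec (τ c z ≟ v)

    -- Take w in `C` with nonzero displacement at z. For each c in `C`, at most one of c, c w, c w²
    -- has the value v at z.
    fibre-size : ∀ z v → 3 ℕ.* count (fibre? z v) ≤ count C?
    fibre-size z v = begin
      3 ℕ.* count (fibre? z v)                                            ≡⟨ count-translates (fibre? z v) {c = 3} (λ k → w ^ toℕ k) ⟨
      ∑[ c < N ] (count {n = 3} λ k → fibre? z v (c ∙ w ^ toℕ k))         ≤⟨ sum-mono pointwise ⟩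
      count C?                                                            ∎
      where
      open ℕ.≤-Reasoning
      w : El
      w = proj₁ (nonzero-word z)
      Cw^ : ∀ k → C (w ^ k) × (∀ x → τ (w ^ k) x ≡ [ k ] * τ w x)
      Cw^ = C-^ (proj₁ (proj₂ (nonzero-word z)))
      C⁻ : ∀ {c d} → C d → C (c ∙ d) → C c
      C⁻ {c} {d} (πd , sd) (πcd , scd) = (λ x → trans (sym (πd _)) (trans (sym (π-∙ c d x)) (πcd x)))
        , λ x → trans (sym (*-identityˡ _)) (trans (cong (_* s c x) (sym (sd _))) (trans (sym (s-∙ c d x)) (scd x)))
      τ-value : ∀ {c} k → C c → τ (c ∙ w ^ k) z ≡ [ k ] * τ w z + τ c z
      τ-value {c} k Cc = trans (τ-∙C c (proj₁ (Cw^ k)) z) (cong (_+ τ c z) (trans (cong (τ (w ^ k)) (proj₁ Cc z)) (proj₂ (Cw^ k) z)))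
      pointwise : ∀ c → count {n = 3} (λ k → fibre? z v (c ∙ w ^ toℕ k)) ≤ 𝟙 (C? c)
      pointwise c = by-cases (C? c)
        where
        by-cases : (d : Dec (C c)) → count {n = 3} (λ k → fibre? z v (c ∙ w ^ toℕ k)) ≤ 𝟙 d
        by-cases (no ¬Cc) = ℕ.≤-reflexive (count-none {n = 3} (λ k → fibre? z v (c ∙ w ^ toℕ k)) λ k (Ccw , _) → ¬Cc (C⁻ (proj₁ (Cw^ (toℕ k))) Ccw))
        by-cases (yes Cc) = count-≤1 {n = 3} (λ k → fibre? z v (c ∙ w ^ toℕ k)) λ k l (_ , e) (_ , e′) →
          trans (sym ([]-toℕ k)) (trans (*-cancelʳ (proj₂ (proj₂ (nonzero-word z)))
            (trans (solve 2 (λ a b → a := a :+ b :- b) refl _ (τ c z)) (trans (cong (_- τ c z)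
              (trans (sym (τ-value (toℕ k) Cc)) (trans e (trans (sym e′) (τ-value (toℕ l) Cc)))))
              (solve 2 (λ a b → a :+ b :- b := a) refl _ (τ c z))))) ([]-toℕ l))

    -- Orientation-keeping representatives of different multipliers. In the absence of full-weight
    -- words they take over the role of a clique: l of them bound intersecting families by N / (l
    -- p).
    record Multipliers (l : ℕ) : Set where
      field
        element    : Fin l → El
        multiplier : Fin l → Index
        π-element  : ∀ j x → π (element j) x ≡ multiplier j ⊛ x
        s-element  : ∀ j x → s (element j) x ≡ 1#
        distinct   : ∀ i j → i ≢ j → multiplier i ≢ multiplier j

    -- Groups without a codeword of full weight.

    module NoFullWeight (no-full : ∀ {c} → C c → ¬ (∀ x → τ c x ≢ 0#)) where

      code : Code pr P F
      code = record
        { 3<p = 3<p ; space = space ; shift = shift ; word = τ c₀ ; W-word = c₀ , (π-c₀ , s-c₀) , λ _ → refl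
        ; support = x₀ ; word≢0 = τ-c₀ ; no-full = λ { (c , Cc , τc) full → no-full Cc λ x → subst (_≢ 0#) (sym (τc x)) (full x) } }

      module T = CodeTheory code

      zero-of : ∀ {c} → C c → ∃ λ x → τ c x ≡ 0#
      zero-of {c} Cc with any? (λ x → τ c x ≟ 0#)
      ... | yes found = found
      ... | no none   = contradiction (λ x e → none (x , e)) (no-full Cc)

      -- The quotient of g by h lies in `C`, and its codeword has a zero; on that block g and h
      -- coincide.
      agree-of : ∀ {g h} → (∀ x → π g x ≡ π h x) → (∀ x → s g x ≡ s h x) → Agree g h
      agree-of {g} {h} πe se = coord x₁ 0# , (begin
        act g (coord x₁ 0#)              ≡⟨ cong (λ f → act f (coord x₁ 0#)) (x∙y⁻¹∙y g h) ⟨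
        act (k ∙ h) (coord x₁ 0#)        ≡⟨ act-∙ k h _ ⟩
        act h (act k (coord x₁ 0#))      ≡⟨ cong (act h) (trans (act-coord k x₁ 0#) (cong₂ coord (proj₁ Ck x₁) (trans (cong₂ _+_ τk (zeroʳ _)) (+-identityˡ 0#)))) ⟩
        act h (coord x₁ 0#)              ∎)
        where
        open ≡-Reasoning
        k = g ∙ h ⁻¹
        Ck : C k
        Ck = (λ x → trans (π-∙ g _ x) (trans (cong (π (h ⁻¹)) (πe x)) (π-⁻¹ˡ h x)))
           , λ x → trans (s-∙ g _ x) (trans (cong₂ _*_ (trans (cong (s (h ⁻¹)) (πe x)) (s-⁻¹ h x)) (se x)) (square (s≢0 h x)))
        x₁ = proj₁ (zero-of Ck)
        τk = proj₂ (zero-of Ck)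

      -- For each multiplier at most one translate meets an intersecting family, and if two multipliers occur then
      -- the codewords used with either of them agree in a coordinate.
      module Bound {l} (M : Multipliers l) (l≤3 : l ≤ 3) {Q : Pred El 0ℓ} (Q? : Decidable Q) (intersecting : Intersectingᵃ Q) where
        open Multipliers M

        f : Fin l → Index → El → El
        f j i c = element j ∙ translation i ∙ c

        π-f : ∀ j i {c} → C c → ∀ x → π (f j i c) x ≡ multiplier j ⊛ x ⊕ i
        π-f j i {c} Cc x = trans (π-∙ _ c x) (trans (proj₁ Cc _) (trans (π-∙translation _ i x) (cong (_⊕ i) (π-element j x))))

        s-f : ∀ j i {c} → C c → ∀ x → s (f j i c) x ≡ 1#
        s-f j i {c} Cc x = trans (s-∙ _ c x) (trans (cong₂ _*_ (proj₂ Cc _) (trans (s-∙translation _ i x) (s-element j x))) 1*1)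

        τ-f : ∀ j i {c} → C c → ∀ x → τ (f j i c) x ≡ τ c (multiplier j ⊛ x ⊕ i) + τ (element j) x
        τ-f j i {c} Cc x = trans (τ-∙C _ Cc x) (cong₂ _+_ (cong (τ c) (trans (π-∙translation _ i x) (cong (_⊕ i) (π-element j x)))) (τ-∙translation _ i x))

        Hit : El → Fin l → Index → Pred El 0ℓ
        Hit g j i c = C c × Q (g ∙ f j i c)

        hit? : ∀ g j i → Decidable (Hit g j i)
        hit? g j i c = C? c ×-dec Q? (g ∙ f j i c)

        meet : ∀ g j i c j′ i′ c′ → Hit g j i c → Hit g j′ i′ c′ → ∃ λ x →
               multiplier j ⊛ x ⊕ i ≡ multiplier j′ ⊛ x ⊕ i′ ×
               τ c (multiplier j ⊛ x ⊕ i) + τ (element j) x ≡ τ c′ (multiplier j′ ⊛ x ⊕ i′) + τ (element j′) x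
        meet g j i c j′ i′ c′ (Cc , q) (Cc′ , q′) =
          let x , y , e , e′ = agree-coord (agree-cancel g (intersecting _ _ q q′))
              value : ∀ j i {c} → C c → τ (f j i c) x + s (f j i c) x * y - y ≡ τ c (multiplier j ⊛ x ⊕ i) + τ (element j) x
              value j i {c} Cc = trans (cong (λ z → τ (f j i c) x + z - y) (trans (cong (_* y) (s-f j i Cc x)) (*-identityˡ y)))
                (trans (solve 2 (λ a y → a :+ y :- y := a) refl (τ (f j i c) x) y) (τ-f j i Cc x))
          in  x , trans (sym (π-f j i Cc x)) (trans e (π-f j′ i′ Cc′ x))
                , trans (sym (value j i Cc)) (trans (cong (_- y) e′) (value j′ i′ Cc′))

        cancelˡ : ∀ a {i i′} → a ⊕ i ≡ a ⊕ i′ → i ≡ i′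
        cancelˡ a {i} {i′} e = trans (solveᴵ 2 (λ a i → i ≔ (a ⊹ i) ∸∸ a) refl a i) (trans (cong (_⊖ a) e) (solveᴵ 2 (λ a i → (a ⊹ i) ∸∸ a ≔ i) refl a i′))

        one-translate : ∀ g j i i′ → 0 < count (hit? g j i) → 0 < count (hit? g j i′) → i ≡ i′
        one-translate g j i i′ pos pos′ =
          let x , e , _ = meet g j i _ j i′ _ (proj₂ (count-witness (hit? g j i) pos)) (proj₂ (count-witness (hit? g j i′) pos′))
          in  cancelˡ (multiplier j ⊛ x) e

        unique-solution : ∀ {a b i i′ x y} → a ≢ b → a ⊛ x ⊕ i ≡ b ⊛ x ⊕ i′ → a ⊛ y ⊕ i ≡ b ⊛ y ⊕ i′ → x ≡ y
        unique-solution {a} {b} {i} {i′} {x} {y} a≢b e e′ with x ⊖ y ≟ 𝟎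
        ... | yes eq = I.x-y≡0⇒x≡y eq
        ... | no neq = contradiction (trans
          (solveᴵ 6 (λ a b i i′ x y → (a ∸∸ b) ∗ (x ∸∸ y) ≔ ((a ∗ x) ⊹ i) ∸∸ ((b ∗ x) ⊹ i′) ∸∸ (((a ∗ y) ⊹ i) ∸∸ ((b ∗ y) ⊹ i′))) refl a b i i′ x y)
          (trans (cong₂ _⊖_ (trans (cong (_⊖ (b ⊛ x ⊕ i′)) e) (I.-‿inverseʳ _)) (trans (cong (_⊖ (b ⊛ y ⊕ i′)) e′) (I.-‿inverseʳ _))) (I.-‿inverseʳ 𝟎)))
          (I.*-nonzero (λ eq → a≢b (I.x-y≡0⇒x≡y eq)) neq)

        -- Maps with different multipliers send exactly one block, here x₁, to a common image z.
        -- Comparison with the fixed c′ therefore pins down the displacement at z of every codeword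
        -- used with j, leaving a single fibre of `C`.
        two-multipliers : ∀ g j j′ i i′ → j′ ≢ j → 0 < count (hit? g j′ i′) → 0 < count (hit? g j i) → 3 ℕ.* count (hit? g j i) ≤ count C?
        two-multipliers g j j′ i i′ j′≢j pos′ pos = ℕ.≤-trans (ℕ.*-monoʳ-≤ 3 (count-mono (hit? g j i) (fibre? z (τ c₁ z)) λ c h → proj₁ h , same c h)) (fibre-size z (τ c₁ z))
          where
          c₁ = proj₁ (count-witness (hit? g j i) pos)
          h₁ = proj₂ (count-witness (hit? g j i) pos)
          c′ = proj₁ (count-witness (hit? g j′ i′) pos′)
          h′ = proj₂ (count-witness (hit? g j′ i′) pos′)
          x₁ = proj₁ (meet g j i c₁ j′ i′ c′ h₁ h′)
          e₁ = proj₂ (meet g j i c₁ j′ i′ c′ h₁ h′)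
          z = multiplier j ⊛ x₁ ⊕ i
          same : ∀ c → Hit g j i c → τ c z ≡ τ c₁ z
          same c h =
            let x , e , e′ = meet g j i c j′ i′ c′ h h′
                x≡ = unique-solution (distinct j j′ (j′≢j ∘ sym)) e (proj₁ e₁)
                e″ = subst (λ x → τ c (multiplier j ⊛ x ⊕ i) + τ (element j) x ≡ τ c′ (multiplier j′ ⊛ x ⊕ i′) + τ (element j′) x) x≡ e′
            in  trans (solve 2 (λ a b → a := a :+ b :- b) refl (τ c z) (τ (element j) x₁))
                  (trans (cong (_- τ (element j) x₁) (trans e″ (sym (proj₂ e₁)))) (solve 2 (λ a b → a :+ b :- b := a) refl (τ c₁ z) (τ (element j) x₁)))

        T# : El → Fin l → ℕ
        T# g j = sum λ i → count (hit? g j i)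

        T#-positive : ∀ g j → 0 < T# g j → ∃ λ i → 0 < count (hit? g j i) × T# g j ≡ count (hit? g j i)
        T#-positive g j pos =
          let i , q = sum-positive (λ i → count (hit? g j i)) pos
          in  i , q , sum-single (λ i → count (hit? g j i)) i λ i′ i′≢i → ℕ.n≤0⇒n≡0 (ℕ.≮⇒≥ λ q′ → i′≢i (one-translate g j i′ i q′ q))

        per-element : ∀ g → sum (T# g) ≤ count C?
        per-element g = sum-of-few (T# g) l≤3 single pair
          where
          single : ∀ j → T# g j ≤ count C?
          single j = by-cases (0 ℕ.<? T# g j)
            where
            by-cases : Dec (0 < T# g j) → T# g j ≤ count C?
            by-cases (no ¬pos) = ℕ.≤-trans (ℕ.≮⇒≥ ¬pos) z≤n
            by-cases (yes pos) = let i , _ , e = T#-positive g j pos in ℕ.≤-trans (ℕ.≤-reflexive e) (count-mono (hit? g j i) C? λ _ → proj₁)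
          pair : ∀ j′ j → j′ ≢ j → 0 < T# g j′ → 0 < T# g j → 3 ℕ.* T# g j ≤ count C?
          pair j′ j j′≢j pos′ pos =
            let i′ , q′ , _ = T#-positive g j′ pos′
                i , q , e   = T#-positive g j pos
            in  subst (λ m → 3 ℕ.* m ≤ count C?) (sym e) (two-multipliers g j j′ i i′ j′≢j q′ q)

        -- Counts the quadruples (g, j, i, c) with c in `C` and g · `f j i c` in Q: they number l p
        -- |C| |Q|, and each g takes part in at most |C| of them.
        bound : (l ℕ.* p) ℕ.* count Q? ≤ N
        bound = ℕ.*-cancelˡ-≤ (count C?) {{>-nonZero (count-positive C? ε C-ε)}} (begin
          count C? ℕ.* ((l ℕ.* p) ℕ.* count Q?)                           ≡⟨ reorder ⟩
          l ℕ.* (p ℕ.* (count C? ℕ.* count Q?))                           ≡⟨ trans (sum-const l (p ℕ.* (count C? ℕ.* count Q?))) refl ⟨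
          (∑[ j < l ] (p ℕ.* (count C? ℕ.* count Q?)))                    ≡⟨ sum-cong-≗ {l} (λ j → sym (sum-const p (count C? ℕ.* count Q?))) ⟩
          (∑[ j < l ] ∑[ i < p ] (count C? ℕ.* count Q?))                 ≡⟨ sum-cong-≗ {l} (λ j → sum-cong-≗ {p} (total j)) ⟩
          (∑[ j < l ] ∑[ i < p ] ∑[ g < N ] count (hit? g j i))           ≡⟨ sum-cong-≗ {l} (λ j → ∑-comm (λ i g → count (hit? g j i))) ⟩
          (∑[ j < l ] ∑[ g < N ] T# g j)                                  ≡⟨ ∑-comm (λ j g → T# g j) ⟩
          (∑[ g < N ] sum (T# g))                                         ≤⟨ sum-≤-const per-element ⟩
          N ℕ.* count C?                                                  ≡⟨ ℕ.*-comm N _ ⟩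
          count C? ℕ.* N                                                  ∎)
          where
          open ℕ.≤-Reasoning
          reorder : count C? ℕ.* ((l ℕ.* p) ℕ.* count Q?) ≡ l ℕ.* (p ℕ.* (count C? ℕ.* count Q?))
          reorder = trans (cong (count C? ℕ.*_) (ℕ.*-assoc l p (count Q?)))
            (trans (x∙yz≈y∙xz (count C?) l (p ℕ.* count Q?)) (cong (l ℕ.*_) (x∙yz≈y∙xz (count C?) p (count Q?))))
            where open import Algebra.Properties.CommutativeSemigroup ℕ.*-commutativeSemigroup using (x∙yz≈y∙xz)
          total : ∀ j i → count C? ℕ.* count Q? ≡ ∑[ g < N ] count (hit? g j i)
          total j i = trans (*-distribʳ-sum (count Q?) (λ c → 𝟙 (C? c))) (trans (sum-cong-≗ {N} inner) (∑-comm (λ c g → 𝟙 (hit? g j i c))))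
            where
            inner : ∀ c → 𝟙 (C? c) ℕ.* count Q? ≡ ∑[ g < N ] 𝟙 (hit? g j i c)
            inner c = trans (cong (𝟙 (C? c) ℕ.*_) (sym (count-translate Q? (f j i c)))) (trans (*-distribˡ-sum (𝟙 (C? c)) (λ g → 𝟙 (Q? (g ∙ f j i c))))
              (sum-cong-≗ {N} λ g → sym (𝟙-× (C? c) (Q? (g ∙ f j i c)))))

      -- 1 + s g multiplies the code into itself, so it vanishes nowhere or everywhere.
      kernel-sign : ∀ g → (∀ x → π g x ≡ x) → ∀ x y → s g x ≡ s g y
      kernel-sign g πg x y with s g x ≟ s g y
      ... | yes e = e
      ... | no neq = contradiction′ (nonzero (s≢0 g x)) (nonzero (s≢0 g y))
        where
        multiplier : T.Multiplier (λ z → 1# + s g z)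
        multiplier {w} Ww = W-cong (λ z → trans (cong (λ u → w z + s g z * w u) (πg z))
          (trans (cong (_+ s g z * w z) (sym (*-identityˡ (w z)))) (sym (distribʳ (w z) 1# (s g z))))) (Subspace.W-+ space {w} {λ x → s g x * w (π g x)} Ww (pull g Ww))
        clash : ∀ a b → s g a ≡ 1# → s g b ≡ - 1# → s g x ≡ s g y
        clash a b ea eb = contradiction (trans (cong (1# +_) eb) (-‿inverseʳ 1#))
          (T.multiplier-vanishes-nowhere multiplier a (λ e → double-nonzero 1≢0 (trans (cong (1# +_) (sym ea)) e)) b)
        contradiction′ : s g x ≡ 1# ⊎ s g x ≡ - 1# → s g y ≡ 1# ⊎ s g y ≡ - 1# → s g x ≡ s g y
        contradiction′ (inj₁ e) (inj₁ e′) = trans e (sym e′)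
        contradiction′ (inj₂ e) (inj₂ e′) = trans e (sym e′)
        contradiction′ (inj₁ e) (inj₂ e′) = clash x y e e′
        contradiction′ (inj₂ e) (inj₁ e′) = clash y x e′ e

      -- The quotient of g by h fixes all blocks, so its sign, which is the product of the two
      -- signs, is the same on every block.
      same-π-sign : ∀ g h → (∀ x → π g x ≡ π h x) → ∀ x y → s g x * s h x ≡ s g y * s h y
      same-π-sign g h πe x y = trans (sym (ratio x)) (trans (kernel-sign (g ∙ h ⁻¹) trivial x y) (ratio y))
        where
        trivial : ∀ x → π (g ∙ h ⁻¹) x ≡ x
        trivial x = trans (π-∙ g _ x) (trans (cong (π (h ⁻¹)) (πe x)) (π-⁻¹ˡ h x))
        ratio : ∀ x → s (g ∙ h ⁻¹) x ≡ s g x * s h x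
        ratio x = trans (s-∙ g _ x) (trans (cong (_* s g x) (trans (cong (s (h ⁻¹)) (πe x)) (s-⁻¹ h x))) (*-comm _ _))

      -- s g (x + 1) s g x is independent of x, so s g has period 2 and hence, p being odd, period 1.
      affine-sign : ∀ g a b → (∀ x → π g x ≡ a ⊛ x ⊕ b) → ∀ x → s g x ≡ s g 𝟎
      affine-sign g a b πg x = trans (cong (s g) (sym halve)) (trans (I.step-invariant (λ z → s g (z ⊕ z)) period-2 (half ⊛ x)) (cong (s g) (I.+-identityʳ 𝟎)))
        where
        2≢0 : 𝟏 ⊕ 𝟏 ≢ 𝟎
        2≢0 e = I.[]-nonzero {2} (s≤s z≤n) (ℕ.<⇒≤ 3<p) (trans (I.[suc] 1) (trans (cong (_⊕ 𝟏) I.[]-1) e))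
        half = proj₁ (I.inverse (𝟏 ⊕ 𝟏) 2≢0)
        halve : half ⊛ x ⊕ half ⊛ x ≡ x
        halve = trans (trans (cong₂ _⊕_ (sym (I.*-identityˡ (half ⊛ x))) (sym (I.*-identityˡ (half ⊛ x)))) (trans (sym (I.distribʳ (half ⊛ x) 𝟏 𝟏)) (sym (I.*-assoc _ half x)))) (trans (cong (_⊛ x) (proj₂ (I.inverse (𝟏 ⊕ 𝟏) 2≢0))) (I.*-identityˡ x))
        commute : ∀ x → π (t ∙ g) x ≡ π (g ∙ translation a) x
        commute x = trans (π-∙ t g x) (trans (cong (π g) (π-t x)) (trans (πg (x ⊕ 𝟏)) (sym (trans (π-∙translation g a x) (trans (cong (_⊕ a) (πg x))
          (trans (cong (λ z → a ⊛ x ⊕ b ⊕ z) (sym (I.*-identityʳ a))) (solveᴵ 4 (λ a x b o → (((a ∗ x) ⊹ b) ⊹ (a ∗ o)) ≔ (a ∗ (x ⊹ o)) ⊹ b) refl a x b 𝟏)))))))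
        product : ∀ x y → s g (x ⊕ 𝟏) * s g x ≡ s g (y ⊕ 𝟏) * s g y
        product x y = trans (sym (value x)) (trans (same-π-sign (t ∙ g) (g ∙ translation a) commute x y) (value y))
          where
          value : ∀ x → s (t ∙ g) x * s (g ∙ translation a) x ≡ s g (x ⊕ 𝟏) * s g x
          value x = cong₂ _*_ (trans (s-∙ t g x) (trans (cong₂ _*_ (cong (s g) (π-t x)) (s-t x)) (*-identityʳ _))) (s-∙translation g a x)
        period-2 : ∀ z → s g ((z ⊕ 𝟏) ⊕ (z ⊕ 𝟏)) ≡ s g (z ⊕ z)
        period-2 z = trans (cong (s g) (solveᴵ 2 (λ z o → (z ⊹ o) ⊹ (z ⊹ o) ≔ ((z ⊹ z) ⊹ o) ⊹ o) refl z 𝟏))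
          (*-cancelʳ (s≢0 g (z ⊕ z ⊕ 𝟏)) (trans (product (z ⊕ z ⊕ 𝟏) (z ⊕ z)) (*-comm _ _)))

      Affine : El → Set
      Affine g = ∃ λ a → ∀ x → π g x ≡ a ⊛ x ⊕ π g 𝟎

      -- The element r has constant sign by `affine-sign`, so pulling a word back along r reverses
      -- it up to a scalar; the code is reversible and `monomial-affine` applies.
      affine-if-reversible : ∀ r → (∀ x → π r x ≡ ⊖ x) → ∀ g → Affine g
      affine-if-reversible r πr g = T.Reversible.Monomial.monomial-affine reverse (π g) (π-injective g) (s g) (s≢0 g) (pull g) (push g)
        where
        linear : ∀ x → π r x ≡ (⊖ 𝟏) ⊛ x ⊕ 𝟎
        linear x = trans (πr x) (trans (cong ⊖_ (sym (I.*-identityˡ x))) (solveᴵ 2 (λ o x → neg (o ∗ x) ≔ ((neg o) ∗ x) ⊹ conᴵ (+ℤ 0)) refl 𝟏 x))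
        reverse : ∀ {w} → W w → W (λ x → w (⊖ x))
        reverse {w} Ww = W-cong (λ x → begin
          s r 𝟎 * (s r x * w (π r x))   ≡⟨ *-assoc _ _ _ ⟨
          (s r 𝟎 * s r x) * w (π r x)   ≡⟨ cong₂ _*_ (trans (cong (s r 𝟎 *_) (affine-sign r (⊖ 𝟏) 𝟎 linear x)) (square (s≢0 r 𝟎))) (cong w (πr x)) ⟩
          1# * w (⊖ x)                  ≡⟨ *-identityˡ _ ⟩
          w (⊖ x)                       ∎) (Subspace.W-scale space (s r 𝟎) {λ x → s r x * w (π r x)} (pull r Ww))
          where open ≡-Reasoning

      -- If every element normalising the translations acts on the blocks as a translation, then the conjugates of the
      -- translations leave room for no elements with fixed blocks besides those fixing all blocks (as for Frobenius groups).
      module Rigid (rigid : ∀ g a → (∀ x → π g x ≡ a ⊛ x) → a ≡ 𝟏) where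

        S? : Decidable (λ g → π g 𝟎 ≡ 𝟎)
        S? g = π g 𝟎 ≟ 𝟎

        Kernel? : Decidable (λ g → ∀ x → π g x ≡ x)
        Kernel? g = all? λ x → π g x ≟ x

        Free? : Decidable (λ g → ∀ x → π g x ≢ x)
        Free? g = all? λ x → ¬? (π g x ≟ x)

        -- On the blocks, h is the conjugate by g of the translation by i, where i is nonzero and g
        -- fixes the block 0.
        Conj : El → Index → El → Set
        Conj g i h = (π g 𝟎 ≡ 𝟎 × i ≢ 𝟎) × ∀ z → π h (π g z) ≡ π g (z ⊕ i)

        conj? : ∀ g i h → Dec (Conj g i h)
        conj? g i h = (S? g ×-dec ¬? (i ≟ 𝟎)) ×-dec all? λ z → π h (π g z) ≟ π g (z ⊕ i)

        -- One suitable h is an actual conjugate of a translation; multiplying it by elements that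
        -- fix all blocks gives the others.
        row : ∀ g i → 𝟙 (S? g) ℕ.* (𝟙 (¬? (i ≟ 𝟎)) ℕ.* count Kernel?) ≤ count (conj? g i)
        row g i = subst (_≤ count (conj? g i)) (trans (cong (ℕ._* count Kernel?) (𝟙-× (S? g) (¬? (i ≟ 𝟎)))) (ℕ.*-assoc (𝟙 (S? g)) _ _)) (by-cases (S? g ×-dec ¬? (i ≟ 𝟎)))
          where
          by-cases : (d : Dec (π g 𝟎 ≡ 𝟎 × i ≢ 𝟎)) → 𝟙 d ℕ.* count Kernel? ≤ count (conj? g i)
          by-cases (no _)  = z≤n
          by-cases (yes q) = ℕ.≤-trans (ℕ.≤-reflexive (ℕ.*-identityˡ _)) (count-image Kernel? (conj? g i) (_∙ h₀)
              (λ k πk → q , λ z → trans (π-∙ k h₀ _) (trans (cong (π h₀) (πk _)) (h₀-conj z)))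
              λ k k′ _ _ → ∙-cancelʳ h₀ k k′)
            where
            h₀ = conj g (translation i)
            h₀-conj : ∀ z → π h₀ (π g z) ≡ π g (z ⊕ i)
            h₀-conj z = trans (π-∙ _ g _) (cong (π g) (trans (π-∙ _ _ _) (trans (cong (π (translation i)) (π-⁻¹ˡ g z)) (π-translation i z))))

        -- The element g g′⁻¹ fixes the block 0 and conjugates the translation by i into that by i′,
        -- so it is linear on the blocks with multiplier i′ / i, and rigidity makes this multiplier
        -- 1.
        conj-unique : ∀ {h g i g′ i′} → Conj g i h → Conj g′ i′ h → i ≡ i′ × (∀ z → π g z ≡ π g′ z)
        conj-unique {h} {g} {i} {g′} {i′} ((S-g , i≢0) , e) ((S-g′ , i′≢0) , e′) = i≡i′ , λ z → trans (sym (φ-eq z)) (cong (π g′) (φ-id z))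
          where
          φ : Index → Index
          φ z = π (g ∙ g′ ⁻¹) z
          φ-eq : ∀ z → π g′ (φ z) ≡ π g z
          φ-eq z = trans (cong (π g′) (π-∙ g _ z)) (π-⁻¹ʳ g′ _)
          φ-0 : φ 𝟎 ≡ 𝟎
          φ-0 = π-injective g′ _ _ (trans (φ-eq 𝟎) (trans S-g (sym S-g′)))
          φ-step : ∀ z → φ (z ⊕ i) ≡ φ z ⊕ i′
          φ-step z = π-injective g′ _ _ (trans (φ-eq (z ⊕ i)) (trans (sym (e z)) (trans (cong (π h) (sym (φ-eq z))) (e′ (φ z)))))
          i⁻¹ = proj₁ (I.inverse i i≢0)
          multiple : ∀ k → φ (I.[ k ] ⊛ i) ≡ I.[ k ] ⊛ i′
          multiple zero    = trans (cong φ (trans (cong (_⊛ i) I.[0]) (I.zeroˡ i))) (trans φ-0 (sym (trans (cong (_⊛ i′) I.[0]) (I.zeroˡ i′))))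
          multiple (suc k) = trans (cong φ (next i)) (trans (φ-step _) (trans (cong (_⊕ i′) (multiple k)) (sym (next i′))))
            where
            next : ∀ j → I.[ suc k ] ⊛ j ≡ I.[ k ] ⊛ j ⊕ j
            next j = trans (cong (_⊛ j) (I.[suc] k)) (trans (I.distribʳ j I.[ k ] 𝟏) (cong (I.[ k ] ⊛ j ⊕_) (I.*-identityˡ j)))
          φ-linear : ∀ x → φ x ≡ (i⁻¹ ⊛ i′) ⊛ x
          φ-linear x = begin
            φ x                                   ≡⟨ cong φ (trans (cong (x ⊛_) (trans (I.*-comm i⁻¹ i) (proj₂ (I.inverse i i≢0)))) (I.*-identityʳ x)) ⟨
            φ (x ⊛ (i⁻¹ ⊛ i))                     ≡⟨ cong φ (trans (sym (I.*-assoc x i⁻¹ i)) (cong (_⊛ i) (sym (I.[]-toℕ (x ⊛ i⁻¹))))) ⟩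
            φ (I.[ toℕ (x ⊛ i⁻¹) ] ⊛ i)           ≡⟨ multiple (toℕ (x ⊛ i⁻¹)) ⟩
            I.[ toℕ (x ⊛ i⁻¹) ] ⊛ i′              ≡⟨ cong (_⊛ i′) (I.[]-toℕ (x ⊛ i⁻¹)) ⟩
            (x ⊛ i⁻¹) ⊛ i′                        ≡⟨ solveᴵ 3 (λ x a b → (x ∗ a) ∗ b ≔ (a ∗ b) ∗ x) refl x i⁻¹ i′ ⟩
            (i⁻¹ ⊛ i′) ⊛ x                        ∎
            where open ≡-Reasoning
          φ-id : ∀ x → φ x ≡ x
          φ-id x = trans (φ-linear x) (trans (cong (_⊛ x) (rigid (g ∙ g′ ⁻¹) _ φ-linear)) (I.*-identityˡ x))
          i≡i′ : i ≡ i′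
          i≡i′ = trans (sym (trans (φ-id _) (I.+-identityˡ i))) (trans (φ-step 𝟎) (trans (cong (_⊕ i′) φ-0) (I.+-identityˡ i′)))

        conj-free : ∀ {h g i} → Conj g i h → ∀ x → π h x ≢ x
        conj-free {h} {g} {i} ((_ , i≢0) , e) x fixed = i≢0 (trans (solveᴵ 2 (λ z i → i ≔ (z ⊹ i) ∸∸ z) refl z i) (trans (cong (_⊖ z) z-fixed) (I.-‿inverseʳ z)))
          where
          z = π (g ⁻¹) x
          z-fixed : z ⊕ i ≡ z
          z-fixed = π-injective g _ _ (trans (sym (e z)) (trans (cong (π h) (π-⁻¹ʳ g x)) (trans fixed (sym (π-⁻¹ʳ g x)))))

        column : ∀ h → ∑[ i < p ] count (λ g → conj? g i h) ≤ 𝟙 (Free? h) ℕ.* count Kernel?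
        column h = by-cases (any? λ i → any? λ g → conj? g i h)
          where
          by-cases : Dec (∃ λ i → ∃ λ g → Conj g i h) → ∑[ i < p ] count (λ g → conj? g i h) ≤ 𝟙 (Free? h) ℕ.* count Kernel?
          by-cases (no none) = ℕ.≤-trans (ℕ.≤-reflexive (trans (sum-cong-≗ {p} λ i → count-none (λ g → conj? g i h) λ g r → none (i , g , r)) (sum-replicate-zero p))) z≤n
          by-cases (yes (i , g , r)) = begin
            ∑[ i < p ] count (λ g → conj? g i h)    ≡⟨ sum-single (λ i → count (λ g → conj? g i h)) i (λ i′ i′≢i → count-none (λ g → conj? g i′ h) λ g′ r′ → i′≢i (proj₁ (conj-unique r′ r))) ⟩
            count (λ g → conj? g i h)               ≤⟨ count-image (λ g → conj? g i h) Kernel? (_∙ g ⁻¹)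
                                                         (λ g′ r′ x → trans (π-∙ g′ _ x) (trans (cong (π (g ⁻¹)) (proj₂ (conj-unique r′ r) x)) (π-⁻¹ˡ g x)))
                                                         (λ a b _ _ → ∙-cancelʳ (g ⁻¹) a b) ⟩
            count Kernel?                           ≡⟨ ℕ.*-identityˡ _ ⟨
            1 ℕ.* count Kernel?                     ≡⟨ cong (ℕ._* count Kernel?) (sym (𝟙-yes (Free? h) (conj-free r))) ⟩
            𝟙 (Free? h) ℕ.* count Kernel?           ∎
            where open ℕ.≤-Reasoning

        nonzero-count : suc (count (λ (i : Index) → ¬? (i ≟ 𝟎))) ≡ p
        nonzero-count = begin
          1 ℕ.+ count (λ (i : Index) → ¬? (i ≟ 𝟎))
            ≡⟨ cong₂ ℕ._+_ (sym (count-unique (λ i → yes tt ×-dec (i ≟ 𝟎)) 𝟎 (tt , refl) λ j (_ , e) → e)) (count-cong (λ i → ¬? (i ≟ 𝟎)) (λ i → yes tt ×-dec ¬? (i ≟ 𝟎)) (λ _ q → tt , q) λ _ → proj₂) ⟩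
          count (λ (i : Index) → yes tt ×-dec (i ≟ 𝟎)) ℕ.+ count (λ (i : Index) → yes tt ×-dec ¬? (i ≟ 𝟎))
            ≡⟨ count-split {n = p} (λ _ → yes tt) (λ i → i ≟ 𝟎) ⟨
          count {n = p} (λ _ → yes tt)
            ≡⟨ count-all {n = p} (λ _ → yes tt) (λ _ → tt) ⟩
          p ∎
          where open ≡-Reasoning

        -- Triples (g, i, h) satisfying `Conj` are counted by (g, i) and by h. Both counts carry the
        -- factor |Kernel|, which cancels.
        many-free : count S? ℕ.* count (λ (i : Index) → ¬? (i ≟ 𝟎)) ≤ count Free?
        many-free = ℕ.*-cancelʳ-≤ _ _ (count Kernel?) {{>-nonZero (count-positive Kernel? ε π-ε)}} (begin
          count S? ℕ.* n₀ ℕ.* count Kernel?                                          ≡⟨ ℕ.*-assoc (count S?) n₀ _ ⟩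
          count S? ℕ.* (n₀ ℕ.* count Kernel?)                                        ≡⟨ *-distribʳ-sum (n₀ ℕ.* count Kernel?) (λ g → 𝟙 (S? g)) ⟩
          (∑[ g < N ] (𝟙 (S? g) ℕ.* (n₀ ℕ.* count Kernel?)))                         ≡⟨ sum-cong-≗ {N} (λ g → trans (cong (𝟙 (S? g) ℕ.*_) (*-distribʳ-sum (count Kernel?) (λ i → 𝟙 (¬? (i ≟ 𝟎)))))
                                                                                        (*-distribˡ-sum (𝟙 (S? g)) (λ i → 𝟙 (¬? (i ≟ 𝟎)) ℕ.* count Kernel?))) ⟩
          (∑[ g < N ] ∑[ i < p ] (𝟙 (S? g) ℕ.* (𝟙 (¬? (i ≟ 𝟎)) ℕ.* count Kernel?)))  ≤⟨ sum-mono {N} (λ g → sum-mono {p} (row g)) ⟩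
          (∑[ g < N ] ∑[ i < p ] ∑[ h < N ] 𝟙 (conj? g i h))                         ≡⟨ sum-cong-≗ {N} (λ g → ∑-comm (λ i h → 𝟙 (conj? g i h))) ⟩
          (∑[ g < N ] ∑[ h < N ] ∑[ i < p ] 𝟙 (conj? g i h))                         ≡⟨ ∑-comm (λ g h → ∑[ i < p ] 𝟙 (conj? g i h)) ⟩
          (∑[ h < N ] ∑[ g < N ] ∑[ i < p ] 𝟙 (conj? g i h))                         ≡⟨ sum-cong-≗ {N} (λ h → ∑-comm (λ g i → 𝟙 (conj? g i h))) ⟩
          (∑[ h < N ] ∑[ i < p ] count (λ g → conj? g i h))                          ≤⟨ sum-mono {N} column ⟩
          (∑[ h < N ] (𝟙 (Free? h) ℕ.* count Kernel?))                               ≡⟨ *-distribʳ-sum (count Kernel?) (λ h → 𝟙 (Free? h)) ⟨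
          count Free? ℕ.* count Kernel?                                              ∎)
          where
          open ℕ.≤-Reasoning
          n₀ = count (λ (i : Index) → ¬? (i ≟ 𝟎))

        -- Translations bring any image of the block 0 back to 0, so N ≤ p |S|. At least (p - 1) |S|
        -- elements fix no block, which leaves at most |S| others.
        few-fixing : count (λ g → ¬? (Free? g)) ≤ count S?
        few-fixing = ℕ.+-cancelˡ-≤ (count Free?) _ _ (begin
          count Free? ℕ.+ count (λ g → ¬? (Free? g))      ≡⟨ cong₂ ℕ._+_ (count-cong Free? (λ g → yes tt ×-dec Free? g) (λ _ q → tt , q) (λ _ → proj₂)) (count-cong (λ g → ¬? (Free? g)) (λ g → yes tt ×-dec ¬? (Free? g)) (λ _ q → tt , q) (λ _ → proj₂)) ⟩
          count (λ g → yes tt ×-dec Free? g) ℕ.+ count (λ g → yes tt ×-dec ¬? (Free? g))  ≡⟨ count-split {n = N} (λ _ → yes tt) Free? ⟨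
          count {n = N} (λ _ → yes tt)                    ≡⟨ count-all {n = N} (λ _ → yes tt) (λ _ → tt) ⟩
          N                                               ≤⟨ translates-cover S? translation (λ g → ⊖ π g 𝟎 , trans (π-∙translation g _ 𝟎) (I.-‿inverseʳ _)) ⟩
          p ℕ.* count S?                                  ≡⟨ cong (ℕ._* count S?) nonzero-count ⟨
          count S? ℕ.+ n₀ ℕ.* count S?                    ≡⟨ cong (count S? ℕ.+_) (ℕ.*-comm n₀ _) ⟩
          count S? ℕ.+ count S? ℕ.* n₀                    ≤⟨ ℕ.+-monoʳ-≤ (count S?) many-free ⟩
          count S? ℕ.+ count Free?                        ≡⟨ ℕ.+-comm (count S?) _ ⟩
          count Free? ℕ.+ count S?                        ∎)
          where
          open ℕ.≤-Reasoning
          n₀ = count (λ (i : Index) → ¬? (i ≟ 𝟎))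

        -- S is contained in the set of elements with a fixed block, and that set is no larger than
        -- S.
        fixing⇒S : ∀ g x → π g x ≡ x → π g 𝟎 ≡ 𝟎
        fixing⇒S g x e = subset-of-smaller S? (λ g → ¬? (Free? g)) (λ g S-g free → free 𝟎 S-g) few-fixing g λ free → free x e

        -- The conjugate h of g by a translation fixes the block -x and hence also the block 0,
        -- which says that g fixes x.
        S⇒kernel : ∀ g → π g 𝟎 ≡ 𝟎 → ∀ x → π g x ≡ x
        S⇒kernel g S-g x = trans (solveᴵ 2 (λ a x → a ≔ (a ⊹ (neg x)) ⊹ x) refl (π g x) x) (trans (cong (_⊕ x) at-0) (I.+-identityˡ x))
          where
          h = translation x ∙ g ∙ translation (⊖ x)
          π-h : ∀ z → π h z ≡ π g (z ⊕ x) ⊕ (⊖ x)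
          π-h z = trans (π-∙translation _ _ z) (cong (_⊕ (⊖ x)) (trans (π-∙ _ g z) (cong (π g) (π-translation x z))))
          at-0 : π g x ⊕ (⊖ x) ≡ 𝟎
          at-0 = trans (sym (trans (π-h 𝟎) (cong (λ z → π g z ⊕ (⊖ x)) (I.+-identityˡ x))))
            (fixing⇒S h (⊖ x) (trans (π-h (⊖ x)) (trans (cong (_⊕ (⊖ x)) (trans (cong (π g) (I.-‿inverseˡ x)) S-g)) (I.+-identityˡ _))))

        affine : ∀ g → Affine g
        affine g = 𝟏 , λ x → trans (solveᴵ 2 (λ a b → a ≔ (a ⊹ (neg b)) ⊹ b) refl (π g x) (π g 𝟎)) (cong (_⊕ π g 𝟎) (trans (sym (π-∙translation g (⊖ π g 𝟎) x))
          (trans (S⇒kernel (g ∙ translation (⊖ π g 𝟎)) (trans (π-∙translation g _ 𝟎) (I.-‿inverseʳ _)) x) (sym (I.*-identityˡ x)))))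

      Λ : Index → Set
      Λ a = ∃ λ g → (∀ x → π g x ≡ a ⊛ x) × (∀ x → s g x ≡ 1#)

      Λ? : Decidable Λ
      Λ? a = any? λ g → all? (λ x → π g x ≟ a ⊛ x) ×-dec all? (λ x → s g x ≟ 1#)

      multiplier-nonzero : ∀ {g a} → (∀ x → π g x ≡ a ⊛ x) → a ≢ 𝟎
      multiplier-nonzero {g} πg refl = I.1≢0 (π-injective g 𝟏 𝟎 (trans (πg 𝟏) (trans (I.zeroˡ 𝟏) (sym (trans (πg 𝟎) (I.zeroˡ 𝟎))))))

      π-product : ∀ {g h a b} → (∀ x → π g x ≡ a ⊛ x) → (∀ x → π h x ≡ b ⊛ x) → ∀ x → π (g ∙ h) x ≡ (b ⊛ a) ⊛ x
      π-product {g} {h} {a} {b} πg πh x = trans (π-∙ g h x) (trans (πh _) (trans (cong (b ⊛_) (πg x)) (sym (I.*-assoc b a x))))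

      π-inverse : ∀ {g a b} → (∀ x → π g x ≡ a ⊛ x) → b ⊛ a ≡ 𝟏 → ∀ x → π (g ⁻¹) x ≡ b ⊛ x
      π-inverse {g} {a} {b} πg ba≡1 x = begin
        π (g ⁻¹) x                      ≡⟨ I.*-identityˡ _ ⟨
        𝟏 ⊛ π (g ⁻¹) x                  ≡⟨ cong (_⊛ π (g ⁻¹) x) ba≡1 ⟨
        (b ⊛ a) ⊛ π (g ⁻¹) x            ≡⟨ I.*-assoc b a _ ⟩
        b ⊛ (a ⊛ π (g ⁻¹) x)            ≡⟨ cong (b ⊛_) (trans (sym (πg _)) (π-⁻¹ʳ g x)) ⟩
        b ⊛ x                           ∎
        where open ≡-Reasoning

      s-product : ∀ {g h} → (∀ x → s g x ≡ s g 𝟎) → (∀ x → s h x ≡ s g 𝟎) → ∀ x → s (g ∙ h) x ≡ 1#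
      s-product {g} {h} sg sh x = trans (s-∙ g h x) (trans (cong₂ _*_ (sh _) (sg x)) (square (s≢0 g 𝟎)))

      s-inverse : ∀ {g e} → (∀ x → s g x ≡ e) → ∀ x → s (g ⁻¹) x ≡ e
      s-inverse {g} sg x = trans (cong (s (g ⁻¹)) (sym (π-⁻¹ʳ g x))) (trans (s-⁻¹ g _) (sg _))

      linear-sign : ∀ {g a} → (∀ x → π g x ≡ a ⊛ x) → ∀ x → s g x ≡ s g 𝟎
      linear-sign {g} {a} πg = affine-sign g a 𝟎 λ x → trans (πg x) (sym (I.+-identityʳ _))

      trivial-element : Multipliers 1
      trivial-element = record
        { element = λ _ → ε ; multiplier = λ _ → 𝟏 ; π-element = λ _ x → trans (π-ε x) (sym (I.*-identityˡ x)) ; s-element = λ _ → s-ε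
        ; distinct = λ { zero zero neq → contradiction refl neq } }

      1≢-1 : 𝟏 ≢ ⊖ 𝟏
      1≢-1 e = I.[]-nonzero {2} (s≤s z≤n) (ℕ.<⇒≤ 3<p) (trans (I.[suc] 1) (trans (cong₂ _⊕_ (trans I.[]-1 e) refl) (I.-‿inverseˡ 𝟏)))

      reflection : Λ (⊖ 𝟏) → Multipliers 2
      reflection (g , πg , sg) = record
        { element = λ { zero → ε ; (suc zero) → g } ; multiplier = λ { zero → 𝟏 ; (suc zero) → ⊖ 𝟏 }
        ; π-element = λ { zero x → trans (π-ε x) (sym (I.*-identityˡ x)) ; (suc zero) → πg } ; s-element = λ { zero → s-ε ; (suc zero) → sg }
        ; distinct = λ { zero zero neq → contradiction refl neq ; (suc zero) (suc zero) neq → contradiction refl neq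
                       ; zero (suc zero) _ → 1≢-1 ; (suc zero) zero _ → 1≢-1 ∘ sym } }

      square-≢1 : ∀ {a} → a ≢ 𝟏 → a ≢ ⊖ 𝟏 → a ⊛ a ≢ 𝟏
      square-≢1 {a} a≢1 a≢-1 e = I.*-nonzero {a ⊖ 𝟏} {a ⊖ (⊖ 𝟏)} (a≢1 ∘ I.x-y≡0⇒x≡y) (a≢-1 ∘ I.x-y≡0⇒x≡y)
        (trans (solveᴵ 2 (λ a o → (a ∸∸ o) ∗ (a ∸∸ (neg o)) ≔ (a ∗ a) ∸∸ (o ∗ o)) refl a 𝟏) (trans (cong₂ _⊖_ e (I.*-identityˡ 𝟏)) (I.-‿inverseʳ 𝟏)))

      -- The multipliers are 1, a and a²; they are distinct because a² = 1 has only the solutions ±1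
      -- in a field.
      powers : ∀ a → Λ a → a ≢ 𝟏 → a ≢ ⊖ 𝟏 → Multipliers 3
      powers a (g , πg , sg) a≢1 a≢-1 = record
        { element = λ { zero → ε ; (suc zero) → g ; (suc (suc zero)) → g ∙ g }
        ; multiplier = λ { zero → 𝟏 ; (suc zero) → a ; (suc (suc zero)) → a ⊛ a }
        ; π-element = λ { zero x → trans (π-ε x) (sym (I.*-identityˡ x)) ; (suc zero) → πg ; (suc (suc zero)) → π-product πg πg }
        ; s-element = λ { zero → s-ε ; (suc zero) → sg ; (suc (suc zero)) x → trans (s-∙ g g x) (trans (cong₂ _*_ (sg _) (sg x)) 1*1) }
        ; distinct = λ { zero zero neq → contradiction refl neq ; (suc zero) (suc zero) neq → contradiction refl neq ; (suc (suc zero)) (suc (suc zero)) neq → contradiction refl neq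
                       ; zero (suc zero) _ → a≢1 ∘ sym ; (suc zero) zero _ → a≢1
                       ; zero (suc (suc zero)) _ → square-≢1 a≢1 a≢-1 ∘ sym ; (suc (suc zero)) zero _ → square-≢1 a≢1 a≢-1
                       ; (suc zero) (suc (suc zero)) _ → a≢a² ; (suc (suc zero)) (suc zero) _ → a≢a² ∘ sym } }
        where
        a≢a² : a ≢ a ⊛ a
        a≢a² e = I.*-nonzero (multiplier-nonzero πg) (λ e′ → a≢1 (sym (I.x-y≡0⇒x≡y e′)))
          (trans (I.distribˡ a 𝟏 (⊖ a)) (trans (cong₂ _⊕_ (trans (I.*-identityʳ a) e) (solveᴵ 2 (λ a b → a ∗ (neg b) ≔ neg (a ∗ b)) refl a a)) (I.-‿inverseʳ (a ⊛ a))))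

      -- For l = 3 the upper bound N / (3 p) is the order of a point stabiliser.
      three-multipliers : Multipliers 3 → Density 1 1
      three-multipliers M = density transitive (3 ℕ.* p) {{ℕ.m*n≢0 3 p}} (fixes? origin) (stabiliser-intersecting origin)
        (ℕ.≤-reflexive (sym (orbit-stabiliser transitive origin))) (λ Q? int → Bound.bound M ℕ.≤-refl Q? int) 1 1
        λ k st e → trans (ℕ.*-identityʳ k) (trans (ℕ.*-cancelˡ-≡ k st (3 ℕ.* p) {{ℕ.m*n≢0 3 p}} e) (sym (ℕ.*-identityˡ st)))

      module FewMultipliers (only-± : ∀ a → Λ a → a ≡ 𝟏 ⊎ a ≡ ⊖ 𝟏) where

        all-affine : ∀ g → Affine g
        all-affine = by-cases (any? λ r → all? λ x → π r x ≟ ⊖ x)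
          where
          by-cases : Dec (∃ λ r → ∀ x → π r x ≡ ⊖ x) → ∀ g → Affine g
          by-cases (yes (r , πr)) = affine-if-reversible r πr
          by-cases (no none)      = Rigid.affine rigid
            where
            no-reflection : ∀ g a → (∀ x → π g x ≡ a ⊛ x) → a ≢ ⊖ 𝟏
            no-reflection g a πg refl = none (g , λ x → trans (πg x) (trans (solveᴵ 2 (λ o x → (neg o) ∗ x ≔ neg (o ∗ x)) refl 𝟏 x) (cong ⊖_ (I.*-identityˡ x))))
            -- The square of a linear element keeps the orientation, so a² is 1 or -1. Both a² = -1
            -- and a = -1 would provide an element acting as the reflection.
            rigid : ∀ g a → (∀ x → π g x ≡ a ⊛ x) → a ≡ 𝟏
            rigid g a πg = from-square (only-± (a ⊛ a) (g ∙ g , π-product πg πg , s-product (linear-sign πg) (linear-sign πg)))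
              where
              from-square : a ⊛ a ≡ 𝟏 ⊎ a ⊛ a ≡ ⊖ 𝟏 → a ≡ 𝟏
              from-square (inj₂ e) = contradiction e (no-reflection (g ∙ g) (a ⊛ a) (π-product πg πg))
              from-square (inj₁ e) with a ≟ 𝟏
              ... | yes a≡1 = a≡1
              ... | no a≢1  = contradiction e (square-≢1 a≢1 (no-reflection g a πg))

        Negative : Index → Pred El 0ℓ
        Negative b g = (∀ x → π g x ≡ b ⊛ x) × (∀ x → s g x ≡ - 1#)

        negative? : ∀ b → Decidable (Negative b)
        negative? b g = all? (λ x → π g x ≟ b ⊛ x) ×-dec all? (λ x → s g x ≟ - 1#)

        chosen : ∃ λ b → ∀ a → (∃ λ g → Negative a g) → ∃ λ g → Negative b g
        chosen with any? (λ b → any? (negative? b))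
        ... | yes (b , found) = b , λ _ _ → found
        -- Every `Negative a` is empty in this case, so any value may be chosen.
        ... | no none         = 𝟏 , λ a (g , Ng) → contradiction (a , g , Ng) none

        β : Index
        β = proj₁ chosen

        -- The extremal family. Orientation-reversing elements of one multiplier β suffice, since
        -- any other such multiplier differs from β by a factor in `Λ`.
        Witness : Pred El 0ℓ
        Witness g = C g ⊎ Negative β g

        witness? : Decidable Witness
        witness? g = C? g ⊎-dec negative? β g

        witness-intersecting : Intersectingᵃ Witness
        witness-intersecting g h (inj₁ (πg , sg)) (inj₁ (πh , sh)) = agree-of (λ x → trans (πg x) (sym (πh x))) λ x → trans (sg x) (sym (sh x))
        witness-intersecting g h (inj₂ (πg , sg)) (inj₂ (πh , sh)) = agree-of (λ x → trans (πg x) (sym (πh x))) λ x → trans (sg x) (sym (sh x))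
        witness-intersecting g h (inj₁ Cg) (inj₂ Nh) = mixed Cg Nh
          where
          mixed : ∀ {g h} → C g → Negative β h → Agree g h
          -- Both elements fix the block 0, with signs 1 and -1 there. In ℤ/3, where 2 = -1, the
          -- equation τ g + y = τ h - y has the solution y = τ g - τ h.
          mixed {g} {h} (πg , sg) (πh , sh) = coord-agree 𝟎 (τ g 𝟎 - τ h 𝟎) (trans (πg 𝟎) (sym (trans (πh 𝟎) (I.zeroʳ β))))
            (trans (cong (λ z → τ g 𝟎 + z * (τ g 𝟎 - τ h 𝟎)) (sg 𝟎)) (trans (I-eq (τ g 𝟎) (τ h 𝟎)) (cong (λ z → τ h 𝟎 + z * (τ g 𝟎 - τ h 𝟎)) (sym (sh 𝟎)))))
            where
            I-eq : ∀ a b → a + 1# * (a - b) ≡ b + (- 1#) * (a - b)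
            I-eq a b = begin
              a + 1# * (a - b)                                       ≡⟨ solve 3 (λ a b o → a :+ o :* (a :- b) := (b :+ (:- o) :* (a :- b)) :+ ((o :* a :+ o :* a :+ a) :- (o :* b :+ o :* b :+ b))) refl a b 1# ⟩
              (b + (- 1#) * (a - b)) + ((1# * a + 1# * a + a) - (1# * b + 1# * b + b))  ≡⟨ cong₂ (λ u v → (b + (- 1#) * (a - b)) + (u - v)) (thrice a) (thrice b) ⟩
              (b + (- 1#) * (a - b)) + (0# - 0#)                     ≡⟨ trans (cong ((b + (- 1#) * (a - b)) +_) (-‿inverseʳ 0#)) (+-identityʳ _) ⟩
              b + (- 1#) * (a - b)                                   ∎
              where
              open ≡-Reasoning
              thrice : ∀ a → 1# * a + 1# * a + a ≡ 0#
              thrice a = trans (cong₂ (λ u v → u + v + a) (*-identityˡ a) (*-identityˡ a)) (triple a)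
        witness-intersecting g h (inj₂ Ng) (inj₁ Ch) = let ω , e = witness-intersecting h g (inj₁ Ch) (inj₂ Ng) in ω , sym e

        module Covering {l} (M : Multipliers l) (l≤3 : l ≤ 3) (complete : ∀ a → Λ a → ∃ λ j → Multipliers.multiplier M j ≡ a) where
          open Multipliers M

          s-∙element : ∀ g j x → s (g ∙ element j) x ≡ s g x
          s-∙element g j x = trans (s-∙ g _ x) (trans (cong (_* s g x) (s-element j _)) (*-identityˡ _))

          -- A translation makes g linear on the blocks, with multiplier a. If the result keeps the
          -- orientation, a representative of a⁻¹ brings it into `C`; if not, a representative of β
          -- a⁻¹ brings it into `Negative β`. Both multipliers lie in `Λ`, hence in the list M.
          cover : ∀ g → ∃ λ j → ∃ λ i → Witness (g ∙ (translation i ∙ element j))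
          cover g = j , ⊖ π g 𝟎 , subst Witness (assoc g _ _) witness
            where
            h = g ∙ translation (⊖ π g 𝟎)
            a = proj₁ (all-affine g)
            πh : ∀ x → π h x ≡ a ⊛ x
            πh x = trans (π-∙translation g _ x) (trans (cong (_⊕ (⊖ π g 𝟎)) (proj₂ (all-affine g) x)) (solveᴵ 2 (λ a b → (a ⊹ b) ⊹ (neg b) ≔ a) refl (a ⊛ x) (π g 𝟎)))
            sh : ∀ x → s h x ≡ s h 𝟎
            sh = linear-sign πh
            a⁻¹ = proj₁ (I.inverse a (multiplier-nonzero πh))
            a⁻¹a : a⁻¹ ⊛ a ≡ 𝟏
            a⁻¹a = trans (I.*-comm a⁻¹ a) (proj₂ (I.inverse a (multiplier-nonzero πh)))
            found : ∃ λ j → Witness (h ∙ element j)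
            found = by-sign (nonzero (s≢0 h 𝟎))
              where
              by-sign : s h 𝟎 ≡ 1# ⊎ s h 𝟎 ≡ - 1# → ∃ λ j → Witness (h ∙ element j)
              by-sign (inj₁ e) =
                let j , mj = complete a⁻¹ (h ⁻¹ , π-inverse πh a⁻¹a , s-inverse λ x → trans (sh x) e)
                in  j , inj₁ ((λ x → trans (π-product πh (π-element j) x) (trans (cong (_⊛ x) (trans (cong (_⊛ a) mj) a⁻¹a)) (I.*-identityˡ x)))
                            , λ x → trans (s-∙element h j x) (trans (sh x) e))
              by-sign (inj₂ e) =
                let k , πk , sk = proj₂ chosen a (h , πh , λ x → trans (sh x) e)
                    sh⁻¹ = s-inverse (λ x → trans (sh x) e)
                    j , mj = complete (β ⊛ a⁻¹) (h ⁻¹ ∙ k , π-product (π-inverse πh a⁻¹a) πk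
                               , s-product (λ x → trans (sh⁻¹ x) (sym (sh⁻¹ 𝟎))) (λ x → trans (sk x) (sym (sh⁻¹ 𝟎))))
                in  j , inj₂ ((λ x → trans (π-product πh (π-element j) x) (cong (_⊛ x) (trans (cong (_⊛ a) mj) (trans (I.*-assoc β a⁻¹ a) (trans (cong (β ⊛_) a⁻¹a) (I.*-identityʳ β))))))
                            , λ x → trans (s-∙element h j x) (trans (sh x) e))
            j = proj₁ found
            witness : Witness (g ∙ translation (⊖ π g 𝟎) ∙ element j)
            witness = proj₂ found

          lower : N ≤ (l ℕ.* p) ℕ.* count witness?
          lower = translates-cover witness? (λ k → translation (proj₂ (remQuot {l} p k)) ∙ element (proj₁ (remQuot {l} p k)))
            λ g → let j , i , q = cover g in combine j i
                , subst (λ r → Witness (g ∙ (translation (proj₂ r) ∙ element (proj₁ r)))) (sym (remQuot-combine {l} {p} j i)) q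

          upper : ∀ {Q} (Q? : Decidable Q) → Intersectingᵃ Q → (l ℕ.* p) ℕ.* count Q? ≤ N
          upper Q? int = Bound.bound M l≤3 Q? int

          scale : ∀ k st → (l ℕ.* p) ℕ.* k ≡ (3 ℕ.* p) ℕ.* st → l ℕ.* k ≡ 3 ℕ.* st
          scale k st e = ℕ.*-cancelˡ-≡ _ _ p (trans (swap l k) (trans e (sym (swap 3 st))))
            where
            swap : ∀ l k → p ℕ.* (l ℕ.* k) ≡ (l ℕ.* p) ℕ.* k
            swap l k = trans (sym (ℕ.*-assoc p l k)) (cong (ℕ._* k) (ℕ.*-comm p l))

        few-multipliers : Density 3 2 ⊎ Density 3 1
        few-multipliers with Λ? (⊖ 𝟏)
        ... | yes λ-1 = inj₁ (density transitive (2 ℕ.* p) {{ℕ.m*n≢0 2 p}} witness? witness-intersecting lower upper 3 2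
                λ k st e → trans (ℕ.*-comm k 2) (scale k st e))
          where
          cases : ∀ {a} → a ≡ 𝟏 ⊎ a ≡ ⊖ 𝟏 → ∃ λ j → Multipliers.multiplier (reflection λ-1) j ≡ a
          cases (inj₁ e) = zero , sym e
          cases (inj₂ e) = suc zero , sym e
          complete : ∀ a → Λ a → ∃ λ j → Multipliers.multiplier (reflection λ-1) j ≡ a
          complete a λa = cases (only-± a λa)
          open Covering (reflection λ-1) (s≤s (s≤s z≤n)) complete
        ... | no ¬λ-1 = inj₂ (density transitive (1 ℕ.* p) {{ℕ.m*n≢0 1 p}} witness? witness-intersecting lower upper 3 1
                λ k st e → trans (ℕ.*-comm k 1) (scale k st e))
          where
          cases : ∀ {a} → a ≡ 𝟏 ⊎ a ≡ ⊖ 𝟏 → Λ a → 𝟏 ≡ a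
          cases (inj₁ e)    _  = sym e
          cases (inj₂ refl) λa = contradiction λa ¬λ-1
          complete : ∀ a → Λ a → ∃ λ j → Multipliers.multiplier trivial-element j ≡ a
          complete a λa = zero , cases (only-± a λa) λa
          open Covering trivial-element (s≤s z≤n) complete

      no-full-weight-density : Density1-3/2-3
      no-full-weight-density with any? (λ a → Λ? a ×-dec (¬? (a ≟ 𝟏) ×-dec ¬? (a ≟ ⊖ 𝟏)))
      ... | yes (a , λa , a≢1 , a≢-1) = inj₁ (three-multipliers (powers a λa a≢1 a≢-1))
      ... | no none = inj₂ (FewMultipliers.few-multipliers only-±)
        where
        only-± : ∀ a → Λ a → a ≡ 𝟏 ⊎ a ≡ ⊖ 𝟏
        only-± a λa with a ≟ 𝟏 | a ≟ ⊖ 𝟏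
        ... | yes e | _ = inj₁ e
        ... | no _  | yes e = inj₂ e
        ... | no a≢1 | no a≢-1 = contradiction (a , λa , a≢1 , a≢-1) none

    wreath-density : Density1-3/2-3
    wreath-density = by-cases (any? λ c → C? c ×-dec all? λ x → ¬? (τ c x ≟ 0#))
      where
      by-cases : Dec (∃ λ c → C c × ∀ x → τ c x ≢ 0#) → Density1-3/2-3
      by-cases (yes (c , Cc , full)) = inj₁ (full-weight-clique Cc full)
      by-cases (no none)             = NoFullWeight.no-full-weight-density λ Cc full → none (_ , Cc , full)

-- Block systems and their coordinates.

module BlockSystems where

  open Counting
  open Orbits
  open Zmod
  open FinGroup
  open Cauchy
  open Muller
  open CyclicCode
  open WreathProducts
  open import Data.Fin using (Fin; zero; suc; toℕ; _≟_; combine; remQuot)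
  open import Data.Fin.Properties using (any?; all?; combine-remQuot; injective⇒≤)
  open import Data.Integer using () renaming (+_ to +ℤ_)
  open import Data.Nat using (ℕ; zero; suc; _≤_; _<_; z≤n; s≤s; NonZero; _∸_)
  import Data.Nat as ℕ
  import Data.Nat.Properties as ℕ
  open import Data.Nat.Divisibility using (_∣_; divides; ∣-trans; m∣m*n; n∣m*n)
  open import Data.Nat.Primality using (Prime; prime⇒nonZero)
  open import Data.Product using (∃; _,_; _×_; proj₁; proj₂)
  open import Data.Sum using (_⊎_; inj₁; inj₂)
  open import Data.Unit using (tt)
  open import Function using (_∘_)
  open import Level using (0ℓ)
  open import Relation.Binary.Core using (Rel)
  open import Relation.Binary.Structures using (IsEquivalence)
  import Relation.Binary.Definitions as B
  open import Relation.Binary.PropositionalEquality hiding ([_])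
  open import Relation.Nullary using (Dec; yes; no; ¬_; contradiction; ¬?; _×-dec_)
  open import Relation.Unary using (Pred; Decidable)

  record Quotient {n} (_~_ : Rel (Fin n) 0ℓ) : Set where
    field
      classes   : ℕ
      label     : Fin n → Fin classes
      rep       : Fin classes → Fin n
      label-rep : ∀ b → label (rep b) ≡ b
      sound     : ∀ {x y} → x ~ y → label x ≡ label y
      exact     : ∀ {x y} → label x ≡ label y → x ~ y

  -- By induction on n: the first point either joins the class of an equivalent later point or opens
  -- a new class.
  quotient : ∀ {n} {_~_ : Rel (Fin n) 0ℓ} → IsEquivalence _~_ → B.Decidable _~_ → Quotient _~_
  quotient {zero} eq dec = record { classes = 0 ; label = λ () ; rep = λ () ; label-rep = λ () ; sound = λ { {()} } ; exact = λ { {()} } }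
  quotient {suc n} {_~_} eq dec = extend (any? λ y → dec zero (suc y))
    where
    open IsEquivalence eq renaming (refl to ~refl; sym to ~sym; trans to ~trans)
    Q = quotient {n} {λ x y → suc x ~ suc y} (record { refl = ~refl ; sym = ~sym ; trans = ~trans }) (λ x y → dec (suc x) (suc y))
    open Quotient Q
    extend : Dec (∃ λ y → zero ~ suc y) → Quotient _~_
    extend (yes (y , 0~y)) = record
      { classes = classes ; label = λ { zero → label y ; (suc x) → label x } ; rep = suc ∘ rep ; label-rep = label-rep
      ; sound = λ { {zero} {zero} _ → refl ; {zero} {suc x} r → sound (~trans (~sym 0~y) r)
                  ; {suc x} {zero} r → sound (~trans r 0~y) ; {suc x} {suc z} r → sound r }
      ; exact = λ { {zero} {zero} _ → ~refl ; {zero} {suc x} e → ~trans 0~y (exact e)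
                  ; {suc x} {zero} e → ~trans (exact e) (~sym 0~y) ; {suc x} {suc z} e → exact e } }
    extend (no none) = record
      { classes = suc classes ; label = λ { zero → zero ; (suc x) → suc (label x) } ; rep = λ { zero → zero ; (suc b) → suc (rep b) }
      ; label-rep = λ { zero → refl ; (suc b) → cong suc (label-rep b) }
      ; sound = λ { {zero} {zero} _ → refl ; {zero} {suc x} r → contradiction (x , r) none
                  ; {suc x} {zero} r → contradiction (x , ~sym r) none ; {suc x} {suc z} r → cong suc (sound r) }
      ; exact = λ { {zero} {zero} _ → ~refl ; {suc x} {suc z} e → exact (suc-injective e) } }
      where
      suc-injective : ∀ {m} {a b : Fin m} → Fin.suc a ≡ suc b → a ≡ b
      suc-injective refl = refl

  injection-bound : ∀ {m n} (f : Fin m → Fin n) → (∀ i j → f i ≡ f j → i ≡ j) → {P : Pred (Fin n) 0ℓ} (P? : Decidable P) → (∀ i → P (f i)) → m ≤ count P?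
  injection-bound {m} f inj P? h = subst (_≤ count P?) (count-all {n = m} (λ _ → yes tt) (λ _ → tt)) (count-image (λ _ → yes tt) P? f (λ i _ → h i) λ i j _ _ → inj i j)

  others : (a : Fin 3) → ∃ λ b → ∃ λ c → b ≢ a × c ≢ a × b ≢ c × ∀ d → d ≡ a ⊎ d ≡ b ⊎ d ≡ c
  others zero             = suc zero , suc (suc zero) , (λ ()) , (λ ()) , (λ ()) , λ { zero → inj₁ refl ; (suc zero) → inj₂ (inj₁ refl) ; (suc (suc zero)) → inj₂ (inj₂ refl) }
  others (suc zero)       = zero , suc (suc zero) , (λ ()) , (λ ()) , (λ ()) , λ { zero → inj₂ (inj₁ refl) ; (suc zero) → inj₁ refl ; (suc (suc zero)) → inj₂ (inj₂ refl) }
  others (suc (suc zero)) = zero , suc zero , (λ ()) , (λ ()) , (λ ()) , λ { zero → inj₂ (inj₁ refl) ; (suc zero) → inj₂ (inj₂ refl) ; (suc (suc zero)) → inj₁ refl }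

  module _ {f : Fin 3 → Fin 3} (f-injective : ∀ a b → f a ≡ f b → a ≡ b) where

    -- A 2-cycle on three points would leave the third point fixed.
    fixed-point-free² : (∀ a → f a ≢ a) → ∀ a → f (f a) ≢ a
    fixed-point-free² free a e =
      let b , c , b≢a , c≢a , b≢c , all = others a in
      outside b c b≢a c≢a b≢c all (all (f a))
      where
      outside : ∀ b c → b ≢ a → c ≢ a → b ≢ c → (∀ d → d ≡ a ⊎ d ≡ b ⊎ d ≡ c) → f a ≡ a ⊎ f a ≡ b ⊎ f a ≡ c → _
      swapped : ∀ b c → c ≢ a → b ≢ c → f a ≡ b → f c ≡ a ⊎ f c ≡ b ⊎ f c ≡ c → _
      swapped b c c≢a b≢c fa (inj₁ fc)        = b≢c (f-injective b c (trans (trans (cong f (sym fa)) e) (sym fc)))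
      swapped b c c≢a b≢c fa (inj₂ (inj₁ fc)) = c≢a (f-injective c a (trans fc (sym fa)))
      swapped b c c≢a b≢c fa (inj₂ (inj₂ fc)) = free c fc
      outside b c b≢a c≢a b≢c all (inj₁ fa)        = free a fa
      outside b c b≢a c≢a b≢c all (inj₂ (inj₁ fa)) = swapped b c c≢a b≢c fa (all (f c))
      outside b c b≢a c≢a b≢c all (inj₂ (inj₂ fa)) = swapped c b b≢a (b≢c ∘ sym) fa (reorder (all (f b)))
        where
        reorder : f b ≡ a ⊎ f b ≡ b ⊎ f b ≡ c → f b ≡ a ⊎ f b ≡ c ⊎ f b ≡ b
        reorder (inj₁ e)        = inj₁ e
        reorder (inj₂ (inj₁ e)) = inj₂ (inj₂ e)
        reorder (inj₂ (inj₂ e)) = inj₂ (inj₁ e)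

    moves⇒free⊎transposition : ∀ {a b c} → a ≢ b → a ≢ c → b ≢ c → (∀ d → d ≡ a ⊎ d ≡ b ⊎ d ≡ c) → f a ≡ b → (∀ d → f d ≢ d) ⊎ (f b ≡ a × f c ≡ c)
    moves⇒free⊎transposition {a} {b} {c} a≢b a≢c b≢c all fa = by (all (f b)) (all (f c))
      where
      by : f b ≡ a ⊎ f b ≡ b ⊎ f b ≡ c → f c ≡ a ⊎ f c ≡ b ⊎ f c ≡ c → (∀ d → f d ≢ d) ⊎ (f b ≡ a × f c ≡ c)
      by (inj₂ (inj₁ fb)) _                = contradiction (f-injective a b (trans fa (sym fb))) a≢b
      by _                (inj₂ (inj₁ fc)) = contradiction (f-injective a c (trans fa (sym fc))) a≢c
      by (inj₁ fb)        (inj₁ fc)        = contradiction (f-injective b c (trans fb (sym fc))) b≢c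
      by (inj₂ (inj₂ fb)) (inj₂ (inj₂ fc)) = contradiction (f-injective b c (trans fb (sym fc))) b≢c
      by (inj₁ fb)        (inj₂ (inj₂ fc)) = inj₂ (fb , fc)
      by (inj₂ (inj₂ fb)) (inj₁ fc)        = inj₁ λ d e → free d e (all d)
        where
        free : ∀ d → f d ≡ d → ¬ (d ≡ a ⊎ d ≡ b ⊎ d ≡ c)
        free d e (inj₁ refl)        = a≢b (trans (sym e) fa)
        free d e (inj₂ (inj₁ refl)) = b≢c (trans (sym e) fb)
        free d e (inj₂ (inj₂ refl)) = a≢c (sym (trans (sym e) fc))

  -- The field `link` is what orbits of a normal subgroup provide beyond an arbitrary block system:
  -- two points of a block are joined by an element that preserves every block.
  record Blocks {N n} (G : FiniteAction N n) (m k : ℕ) : Set where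
    open FiniteAction G
    field
      transitive : Transitiveᵃ
      label      : Fin n → Fin m
      rep        : Fin m → Fin n
      label-rep  : ∀ b → label (rep b) ≡ b
      invariant  : ∀ g {α β} → label α ≡ label β → label (act g α) ≡ label (act g β)
      block-size : ∀ b → count (λ α → label α ≟ b) ≡ k
      link       : ∀ {α β} → label α ≡ label β → ∃ λ g → (∀ ω → label (act g ω) ≡ label ω) × act g α ≡ β

  module BlockTheory {N n m k} {G : FiniteAction N n} (B : Blocks G m k) where
    open FiniteAction G
    open Blocks B

    blockAct : El → Fin m → Fin m
    blockAct g b = label (act g (rep b))

    label-act : ∀ g α → label (act g α) ≡ blockAct g (label α)
    label-act g α = invariant g (sym (label-rep (label α)))

    invariant⁻ : ∀ g {α β} → label (act g α) ≡ label (act g β) → label α ≡ label β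
    invariant⁻ g {α} {β} e = trans (cong label (sym (act-⁻¹ˡ g α))) (trans (invariant (g ⁻¹) e) (cong label (act-⁻¹ˡ g β)))

    blockAct-injective : ∀ g a b → blockAct g a ≡ blockAct g b → a ≡ b
    blockAct-injective g a b e = trans (sym (label-rep a)) (trans (invariant⁻ g e) (label-rep b))

    blockAct-∙ : ∀ g h b → blockAct (g ∙ h) b ≡ blockAct h (blockAct g b)
    blockAct-∙ g h b = trans (cong label (act-∙ g h _)) (label-act h _)

    blockAct-transitive : ∀ a b → ∃ λ g → blockAct g a ≡ b
    blockAct-transitive a b = let g , e = transitive (rep a) (rep b) in g , trans (cong label e) (label-rep b)

    label-iter : ∀ g j α → label (iter (act g) j α) ≡ iter (blockAct g) j (label α)
    label-iter g zero    α = refl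
    label-iter g (suc j) α = trans (label-iter g j (act g α)) (cong (iter (blockAct g) j) (label-act g α))

    label-^ : ∀ g j α → label (act (g ^ j) α) ≡ iter (blockAct g) j (label α)
    label-^ g j α = trans (cong label (act-^ g j α)) (label-iter g j α)

    block-period : ∀ g p → g ^ p ≡ ε → ∀ b → iter (blockAct g) p b ≡ b
    block-period g p e b = trans (cong (iter (blockAct g) p) (sym (label-rep b))) (trans (sym (label-iter g p (rep b)))
      (trans (cong label (period g p e (rep b))) (label-rep b)))

  -- Three blocks of size p.

  module ThreeBlocks {p} (pr : Prime p) (3<p : 3 < p) {N} {G : FiniteAction N (3 ℕ.* p)} (B : Blocks G 3 p) where
    open FiniteAction G
    open Blocks B
    open BlockTheory B

    private instance
      p≢0 : NonZero p
      p≢0 = prime⇒nonZero pr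

    -- A moved block would have p different images among three blocks.
    preserves-blocks : ∀ {x} → x ^ p ≡ ε → ∀ b → blockAct x b ≡ b
    preserves-blocks {x} e b with blockAct x b ≟ b
    ... | yes eq = eq
    ... | no neq = contradiction (injective⇒≤ {f = λ (i : Fin p) → iter (blockAct x) (toℕ i) b}
                     λ {i} {j} → Periodic.iterᶠ-injective (blockAct x) pr (block-period x p e) neq i j) (ℕ.<⇒≱ 3<p)

    preserves-label : ∀ {x} → x ^ p ≡ ε → ∀ ω → label (act x ω) ≡ label ω
    preserves-label e ω = trans (label-act _ ω) (preserves-blocks e _)

    Moves Fixes : El → Fin 3 → Set
    Moves x b = ∀ ω → label ω ≡ b → act x ω ≢ ω
    Fixes x b = ∀ ω → label ω ≡ b → act x ω ≡ ω

    -- A moved point has an orbit of length p, which fills its block.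
    moves-block : ∀ {x} → x ^ p ≡ ε → ∀ {ω} → act x ω ≢ ω → Moves x (label ω)
    moves-block {x} e {ω} moved ω′ same fixed =
      let i , ei = subset-of-smaller orbit? (λ α → label α ≟ label ω) in-block orbit-large ω′ same in
      moved (Per.iter-cancel (toℕ i) (trans (iter-suc (act x) (toℕ i) ω) (trans (cong (act x) ei) (trans fixed (sym ei)))))
      where
      module Per = Periodic (act x) pr (period x p e)
      orbit? : Decidable (λ α → ∃ λ (i : Fin p) → iter (act x) (toℕ i) ω ≡ α)
      orbit? α = any? λ i → iter (act x) (toℕ i) ω ≟ α
      in-block : ∀ α → (∃ λ (i : Fin p) → iter (act x) (toℕ i) ω ≡ α) → label α ≡ label ω
      in-block _ (i , refl) = iter-preserves (act x) (λ α → label α ≡ label ω) (λ α q → trans (preserves-label e α) q) (toℕ i) ω refl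
      orbit-large : count (λ α → label α ≟ label ω) ≤ count orbit?
      orbit-large = subst (_≤ count orbit?) (sym (block-size (label ω)))
        (injection-bound (λ (i : Fin p) → iter (act x) (toℕ i) ω) (Per.iterᶠ-injective moved) orbit? λ i → i , refl)

    dichotomy : ∀ {x} → x ^ p ≡ ε → ∀ b → Moves x b ⊎ Fixes x b
    dichotomy {x} e b with any? (λ ω → (label ω ≟ b) ×-dec ¬? (act x ω ≟ ω))
    ... | yes (ω , refl , moved) = inj₁ (moves-block e moved)
    ... | no none = inj₂ λ ω eq → fixed ω eq
      where
      fixed : Fixes x b
      fixed ω eq with act x ω ≟ ω
      ... | yes q = q
      ... | no neq = contradiction (ω , eq , neq) none

    Semiregular : El → Set
    Semiregular x = x ^ p ≡ ε × ∀ ω → act x ω ≢ ω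

    conj-order : ∀ g {x} → x ^ p ≡ ε → conj g x ^ p ≡ ε
    conj-order g {x} e = trans (sym (conj-^ g x p)) (trans (cong (conj g) e) (conj-ε g))

    transport : ∀ g x {R : Fin (3 ℕ.* p) → Fin (3 ℕ.* p) → Set} → (∀ {α β} → R α β → R (act g α) (act g β)) →
      ∀ {b} → (∀ ω → label ω ≡ b → R (act x ω) ω) → ∀ ω → label ω ≡ blockAct g b → R (act (conj g x) ω) ω
    transport g x {R} Rg {b} h ω eq = subst (λ ω → R (act (conj g x) ω) ω) (act-⁻¹ʳ g ω)
      (subst (λ α → R α (act g ω′)) (sym (act-conj g x ω′)) (Rg (h ω′ (blockAct-injective g _ _ (trans (sym (label-act g ω′)) (trans (cong label (act-⁻¹ʳ g ω)) eq))))))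
      where ω′ = act (g ⁻¹) ω

    conj-moves : ∀ g {x b} → Moves x b → Moves (conj g x) (blockAct g b)
    conj-moves g {x} h = transport g x {_≢_} (λ neq e → neq (act-injective g e)) h

    conj-fixes : ∀ g {x b} → Fixes x b → Fixes (conj g x) (blockAct g b)
    conj-fixes g {x} h = transport g x {_≡_} (cong (act g)) h

    -- Conjugates of x, one supported on each block, have disjoint supports, so on every block their
    -- product acts as a single conjugate and moves each point.
    single : ∀ {x a} → x ^ p ≡ ε → Moves x a → (∀ b → b ≢ a → Fixes x b) → ∃ Semiregular
    single {x} {a} e moves fixes = y , ^-from-action y p y-period , λ ω eq → xᵇ-moves (label ω) ω refl (trans (sym (y-act ω)) eq)
      where
      g : Fin 3 → El
      g b = proj₁ (blockAct-transitive a b)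
      g-act : ∀ b → blockAct (g b) a ≡ b
      g-act b = proj₂ (blockAct-transitive a b)
      xᵇ : Fin 3 → El
      xᵇ b = conj (g b) x
      xᵇ-moves : ∀ b → Moves (xᵇ b) b
      xᵇ-moves b = subst (Moves (xᵇ b)) (g-act b) (conj-moves (g b) moves)
      xᵇ-fixes : ∀ b c → c ≢ b → Fixes (xᵇ b) c
      xᵇ-fixes b c c≢b = let d , eq = injective⇒surjective (blockAct (g b)) (blockAct-injective (g b)) c in
        subst (Fixes (xᵇ b)) eq (conj-fixes (g b) (fixes d λ d≡a → c≢b (trans (sym eq) (trans (cong (blockAct (g b)) d≡a) (g-act b)))))
      xᵇ-label : ∀ b ω → label (act (xᵇ b) ω) ≡ label ω
      xᵇ-label b = preserves-label (conj-order (g b) e)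
      y = xᵇ zero ∙ xᵇ (suc zero) ∙ xᵇ (suc (suc zero))
      y-steps : ∀ ω → act y ω ≡ act (xᵇ (suc (suc zero))) (act (xᵇ (suc zero)) (act (xᵇ zero) ω))
      y-steps ω = trans (act-∙ _ _ ω) (cong (act (xᵇ (suc (suc zero)))) (act-∙ _ _ ω))
      y-on : ∀ b ω → label ω ≡ b → act y ω ≡ act (xᵇ b) ω
      y-on zero ω eq = trans (y-steps ω) (trans (cong (act _) (xᵇ-fixes (suc zero) zero (λ ()) _ (trans (xᵇ-label zero ω) eq)))
        (xᵇ-fixes (suc (suc zero)) zero (λ ()) _ (trans (xᵇ-label zero ω) eq)))
      y-on (suc zero) ω eq = trans (y-steps ω) (trans (cong (act _ ∘ act _) (xᵇ-fixes zero (suc zero) (λ ()) ω eq))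
        (xᵇ-fixes (suc (suc zero)) (suc zero) (λ ()) _ (trans (xᵇ-label (suc zero) ω) eq)))
      y-on (suc (suc zero)) ω eq = trans (y-steps ω) (cong (act _) (trans (cong (act _) (xᵇ-fixes zero (suc (suc zero)) (λ ()) ω eq))
        (xᵇ-fixes (suc zero) (suc (suc zero)) (λ ()) ω eq)))
      y-act : ∀ ω → act y ω ≡ act (xᵇ (label ω)) ω
      y-act ω = y-on (label ω) ω refl
      y-iter : ∀ b k ω → label ω ≡ b → iter (act y) k ω ≡ iter (act (xᵇ b)) k ω
      y-iter b zero    ω eq = refl
      y-iter b (suc k) ω eq = trans (cong (iter (act y) k) (y-on b ω eq)) (y-iter b k _ (trans (xᵇ-label b ω) eq))
      y-period : ∀ ω → iter (act y) p ω ≡ ω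
      y-period ω = trans (y-iter (label ω) p ω refl) (period (xᵇ (label ω)) p (conj-order (g (label ω)) e) ω)

    commuting-power : ∀ {x y} → x ∙ y ≡ y ∙ x → ∀ k → (x ∙ y) ^ k ≡ x ^ k ∙ y ^ k
    commuting-power {x} {y} xy zero    = sym (identityˡ ε)
    commuting-power {x} {y} xy (suc k) = begin
      x ∙ y ∙ (x ∙ y) ^ k            ≡⟨ cong (x ∙ y ∙_) (commuting-power xy k) ⟩
      x ∙ y ∙ (x ^ k ∙ y ^ k)        ≡⟨ assoc x y _ ⟩
      x ∙ (y ∙ (x ^ k ∙ y ^ k))      ≡⟨ cong (x ∙_) (sym (assoc y _ _)) ⟩
      x ∙ (y ∙ x ^ k ∙ y ^ k)        ≡⟨ cong (λ z → x ∙ (z ∙ y ^ k)) (slide k) ⟩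
      x ∙ (x ^ k ∙ y ∙ y ^ k)        ≡⟨ cong (x ∙_) (assoc _ y _) ⟩
      x ∙ (x ^ k ∙ (y ∙ y ^ k))      ≡⟨ assoc x _ _ ⟨
      x ∙ x ^ k ∙ (y ∙ y ^ k)        ∎
      where
      open ≡-Reasoning
      slide : ∀ k → y ∙ x ^ k ≡ x ^ k ∙ y
      slide zero    = trans (identityʳ y) (sym (identityˡ y))
      slide (suc k) = trans (sym (assoc y x _)) (trans (cong (_∙ x ^ k) (sym xy)) (trans (assoc x y _) (trans (cong (x ∙_) (slide k)) (sym (assoc x _ y)))))

    conj-conj : ∀ g h x → conj h (conj g x) ≡ conj (g ∙ h) x
    conj-conj g h x = faithful λ ω → trans (cong (act (conj h (conj g x))) (sym (back ω))) (trans (act-conj h _ _) (trans (cong (act h) (act-conj g x _))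
      (trans (sym (act-∙ g h _)) (trans (sym (act-conj (g ∙ h) x _)) (cong (act (conj (g ∙ h) x)) (act-⁻¹ʳ (g ∙ h) ω))))))
      where
      back : ∀ ω → act h (act g (act ((g ∙ h) ⁻¹) ω)) ≡ ω
      back ω = trans (sym (act-∙ g h _)) (act-⁻¹ʳ (g ∙ h) ω)

    conj-by-ε : ∀ x → conj ε x ≡ x
    conj-by-ε x = trans (identityʳ _) (trans (cong (_∙ x) ε⁻¹≈ε) (identityˡ x))

    iter-conj : ∀ g k x → iter (conj g) k x ≡ conj (g ^ k) x
    iter-conj g zero    x = sym (conj-by-ε x)
    iter-conj g (suc k) x = trans (iter-conj g k _) (conj-conj g (g ^ k) x)

    module TwoMoved {x a b c} (exhaust : ∀ d → d ≡ a ⊎ d ≡ b ⊎ d ≡ c) (a≢b : a ≢ b) (a≢c : a ≢ c) (b≢c : b ≢ c)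
                    (order : x ^ p ≡ ε) (moves-a : Moves x a) (moves-c : Moves x c) (fixes-b : Fixes x b) where

      H? : Decidable (λ h → Fixes h a)
      H? h = all? fixes-at?
        where
        fixes-at? : ∀ ω → Dec (label ω ≡ a → act h ω ≡ ω)
        fixes-at? ω with label ω ≟ a | act h ω ≟ ω
        ... | no neq | _     = yes λ e → contradiction e neq
        ... | yes _  | yes q = yes λ _ → q
        ... | yes e  | no q  = no λ f → q (f e)

      H-subgroup : Subgroup G (λ h → Fixes h a)
      H-subgroup = record
        { ε∈  = λ ω _ → act-ε ω
        ; ∙∈  = λ {g} {h} Hg Hh ω e → trans (act-∙ g h ω) (trans (cong (act h) (Hg ω e)) (Hh ω e))
        ; ⁻¹∈ = λ {g} Hg ω e → trans (cong (act (g ⁻¹)) (sym (Hg ω e))) (act-⁻¹ˡ g ω) }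

      Roots? : Decidable (λ h → Fixes h a × h ^ p ≡ ε)
      Roots? h = H? h ×-dec (h ^ p ≟ ε)

      -- A conjugate of x by an element carrying block b to block a fixes a pointwise and is not the
      -- identity, so p divides the order of the pointwise stabiliser of a.
      p∣roots : p ∣ count Roots?
      p∣roots = let g , eq = blockAct-transitive b a in ∣-roots G pr H? H-subgroup
        (∣-subgroup G pr H? H-subgroup {conj g x} (subst (Fixes (conj g x)) eq (conj-fixes g fixes-b))
          (λ e → conj-moves g moves-a (act g (rep a)) refl (trans (cong (λ h → act h (act g (rep a))) e) (act-ε _))) (conj-order g order))

      -- Conjugation by x permutes the roots in the pointwise stabiliser of a with period p. The
      -- number of roots commuting with x is then again divisible by p, and ε is one of them.
      commuting : ∃ λ u → ((Fixes u a × u ^ p ≡ ε) × conj x u ≡ u) × u ≢ ε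
      commuting = ∣-another G pr (λ h → Roots? h ×-dec (conj x h ≟ h))
        (∣-count-fixed pr (conj x) (λ h → trans (iter-conj x p h) (trans (cong (λ g → conj g h) order) (conj-by-ε h))) Roots?
          (λ h (fix , e) → subst (Fixes (conj x h)) (preserves-blocks order a) (conj-fixes x fix) , conj-order x e) p∣roots)
        (((λ ω _ → act-ε ω) , ε^ p) , conj-ε x)

      -- x moves a and c, u moves b and possibly c, so that x u or x u² moves all three blocks.
      semiregular : ∃ Semiregular
      semiregular = by-cases (dichotomy uᵖ b) (dichotomy uᵖ c)
        where
        u = proj₁ commuting
        fixes-a : Fixes u a
        fixes-a = proj₁ (proj₁ (proj₁ (proj₂ commuting)))
        uᵖ : u ^ p ≡ ε
        uᵖ = proj₂ (proj₁ (proj₁ (proj₂ commuting)))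
        xu≡ux : x ∙ u ≡ u ∙ x
        xu≡ux = trans (cong (x ∙_) (sym (proj₂ (proj₁ (proj₂ commuting))))) (trans (sym (assoc x _ x)) (cong (_∙ x) (trans (sym (assoc x _ u)) (trans (cong (_∙ u) (inverseʳ x)) (identityˡ u)))))
        rest : ∀ {d} → d ≢ a → d ≡ b ⊎ d ≡ c
        rest {d} neq with exhaust d
        ... | inj₁ e = contradiction e neq
        ... | inj₂ e = e
        xu : ∀ ω → act (x ∙ u) ω ≡ act u (act x ω)
        xu = act-∙ x u
        xu-on-a : ∀ ω → label ω ≡ a → act (x ∙ u) ω ≡ act x ω
        xu-on-a ω e = trans (xu ω) (fixes-a _ (trans (preserves-label order ω) e))
        xu-on-b : ∀ ω → label ω ≡ b → act (x ∙ u) ω ≡ act u ω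
        xu-on-b ω e = trans (xu ω) (cong (act u) (fixes-b ω e))
        xuᵖ : (x ∙ u) ^ p ≡ ε
        xuᵖ = trans (commuting-power xu≡ux p) (trans (cong₂ _∙_ order uᵖ) (identityˡ ε))
        full : ∀ {y} → y ^ p ≡ ε → Moves y a → Moves y b → Moves y c → ∃ Semiregular
        full {y} e ma mb mc = y , e , λ ω → at ω (exhaust (label ω))
          where
          at : ∀ ω → label ω ≡ a ⊎ label ω ≡ b ⊎ label ω ≡ c → act y ω ≢ ω
          at ω (inj₁ e)        = ma ω e
          at ω (inj₂ (inj₁ e)) = mb ω e
          at ω (inj₂ (inj₂ e)) = mc ω e
        by-cases : Moves u b ⊎ Fixes u b → Moves u c ⊎ Fixes u c → ∃ Semiregular
        by-cases (inj₂ fb) (inj₂ fc) = contradiction (faithful λ ω → trans (at ω (exhaust (label ω))) (sym (act-ε ω))) (proj₂ (proj₂ commuting))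
          where
          at : ∀ ω → label ω ≡ a ⊎ label ω ≡ b ⊎ label ω ≡ c → act u ω ≡ ω
          at ω (inj₁ e)        = fixes-a ω e
          at ω (inj₂ (inj₁ e)) = fb ω e
          at ω (inj₂ (inj₂ e)) = fc ω e
        by-cases (inj₁ mb) (inj₂ fc) = single uᵖ mb λ d d≢b → at d d≢b (exhaust d)
          where
          at : ∀ d → d ≢ b → d ≡ a ⊎ d ≡ b ⊎ d ≡ c → Fixes u d
          at d d≢b (inj₁ refl)        = fixes-a
          at d d≢b (inj₂ (inj₁ e))    = contradiction e d≢b
          at d d≢b (inj₂ (inj₂ refl)) = fc
        by-cases (inj₂ fb) (inj₁ mc) = single uᵖ mc λ d d≢c → at d d≢c (exhaust d)
          where
          at : ∀ d → d ≢ c → d ≡ a ⊎ d ≡ b ⊎ d ≡ c → Fixes u d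
          at d d≢c (inj₁ refl)        = fixes-a
          at d d≢c (inj₂ (inj₁ refl)) = fb
          at d d≢c (inj₂ (inj₂ e))    = contradiction e d≢c
        by-cases (inj₁ mb) (inj₁ mc) = by-xu (dichotomy xuᵖ c)
          where
          by-xu : Moves (x ∙ u) c ⊎ Fixes (x ∙ u) c → ∃ Semiregular
          by-xu (inj₁ m) = full xuᵖ (λ ω e q → moves-a ω e (trans (sym (xu-on-a ω e)) q)) (λ ω e q → mb ω e (trans (sym (xu-on-b ω e)) q)) m
          by-xu (inj₂ f) = full
            (trans (commuting-power (trans (cong (_∙ u) xu≡ux) (assoc u x u)) p)
              (trans (cong₂ _∙_ xuᵖ uᵖ) (identityˡ ε)))
            (λ ω e q → moves-a ω e (trans (sym (trans (act-∙ _ u ω) (trans (cong (act u) (xu-on-a ω e)) (fixes-a _ (trans (preserves-label order ω) e))))) q))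
            (λ ω e q → mb ω e (Periodic.iter-fixed⁻ (act u) pr (period u p uᵖ) {2} (s≤s z≤n) (ℕ.<⇒≤ 3<p) (trans (cong (act u) (sym (xu-on-b ω e))) (trans (sym (act-∙ _ u ω)) q))))
            (λ ω e q → mc ω e (trans (cong (act u) (sym (f ω e))) (trans (sym (act-∙ _ u ω)) q)))

    semiregular-element : ∃ Semiregular
    semiregular-element =
      let x , xᵖ , x≢ε = cauchy G pr (subst (p ∣_) (orbit-stabiliser transitive (rep zero)) (∣-trans (n∣m*n 3) (m∣m*n _)))
          ω , moved = moves x≢ε
          b , c , b≢a , c≢a , b≢c , exhaust = others (label ω)
      in  by-cases xᵖ (moves-block xᵖ moved) b≢a c≢a b≢c exhaust (dichotomy xᵖ b) (dichotomy xᵖ c)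
      where
      by-cases : ∀ {x a b c} → x ^ p ≡ ε → Moves x a → b ≢ a → c ≢ a → b ≢ c → (∀ d → d ≡ a ⊎ d ≡ b ⊎ d ≡ c) →
                 Moves x b ⊎ Fixes x b → Moves x c ⊎ Fixes x c → ∃ Semiregular
      by-cases {x} {a} {b} {c} e ma b≢a c≢a b≢c exhaust (inj₁ mb) (inj₁ mc) = x , e , λ ω → at ω (exhaust (label ω))
        where
        at : ∀ ω → label ω ≡ a ⊎ label ω ≡ b ⊎ label ω ≡ c → act x ω ≢ ω
        at ω (inj₁ e)        = ma ω e
        at ω (inj₂ (inj₁ e)) = mb ω e
        at ω (inj₂ (inj₂ e)) = mc ω e
      by-cases {x} {a} {b} {c} e ma b≢a c≢a b≢c exhaust (inj₂ fb) (inj₂ fc) = single e ma λ d d≢a → at d d≢a (exhaust d)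
        where
        at : ∀ d → d ≢ a → d ≡ a ⊎ d ≡ b ⊎ d ≡ c → Fixes x d
        at d d≢a (inj₁ e)           = contradiction e d≢a
        at d d≢a (inj₂ (inj₁ refl)) = fb
        at d d≢a (inj₂ (inj₂ refl)) = fc
      by-cases e ma b≢a c≢a b≢c exhaust (inj₂ fb) (inj₁ mc) = TwoMoved.semiregular exhaust (b≢a ∘ sym) (c≢a ∘ sym) b≢c e ma mc fb
      by-cases {a = a} {b} {c} e ma b≢a c≢a b≢c exhaust (inj₁ mb) (inj₂ fc) =
        TwoMoved.semiregular (λ d → swap (exhaust d)) (c≢a ∘ sym) (b≢a ∘ sym) (b≢c ∘ sym) e ma mb fc
        where
        swap : ∀ {d} → d ≡ a ⊎ d ≡ b ⊎ d ≡ c → d ≡ a ⊎ d ≡ c ⊎ d ≡ b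
        swap (inj₁ e)        = inj₁ e
        swap (inj₂ (inj₁ e)) = inj₂ (inj₂ e)
        swap (inj₂ (inj₂ e)) = inj₂ (inj₁ e)

    -- Take elements carrying the first block to the second and to the third. Unless one of them is
    -- already a 3-cycle on blocks, they are two transpositions sharing the first block, and their
    -- product is a 3-cycle.
    rotation : ∃ λ h → ∀ b → blockAct h b ≢ b
    rotation =
      let g , e  = blockAct-transitive zero (suc zero)
          h , e′ = blockAct-transitive zero (suc (suc zero))
      in  by-cases g h e (moves⇒free⊎transposition (blockAct-injective g) (λ ()) (λ ()) (λ ()) (proj₂ (proj₂ (proj₂ (proj₂ (proj₂ (others zero)))))) e)
                         e′ (moves⇒free⊎transposition (blockAct-injective h) {zero} {suc (suc zero)} {suc zero} (λ ()) (λ ()) (λ ())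
                               (λ { zero → inj₁ refl ; (suc zero) → inj₂ (inj₂ refl) ; (suc (suc zero)) → inj₂ (inj₁ refl) }) e′)
      where
      by-cases : ∀ g h → blockAct g zero ≡ suc zero → (∀ d → blockAct g d ≢ d) ⊎ (blockAct g (suc zero) ≡ zero × blockAct g (suc (suc zero)) ≡ suc (suc zero)) →
                 blockAct h zero ≡ suc (suc zero) → (∀ d → blockAct h d ≢ d) ⊎ (blockAct h (suc (suc zero)) ≡ zero × blockAct h (suc zero) ≡ suc zero) →
                 ∃ λ h → ∀ b → blockAct h b ≢ b
      by-cases g h _ (inj₁ free) _ _ = g , free
      by-cases g h _ (inj₂ _) _ (inj₁ free) = h , free
      by-cases g h g0 (inj₂ (g1 , g2)) h0 (inj₂ (h2 , h1)) = g ∙ h , λ b e → not-fixed b (trans (sym (blockAct-∙ g h b)) e)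
        where
        not-fixed : ∀ b → blockAct h (blockAct g b) ≢ b
        not-fixed zero             e with () ← trans (sym e) (trans (cong (blockAct h) g0) h1)
        not-fixed (suc zero)       e with () ← trans (sym e) (trans (cong (blockAct h) g1) h0)
        not-fixed (suc (suc zero)) e with () ← trans (sym e) (trans (cong (blockAct h) g2) h2)

    three-blocks-density : Density 1 1
    three-blocks-density = clique-density transitive {{ℕ.m*n≢0 3 p}} (rep zero) element clique
      where
      x = proj₁ semiregular-element
      xᵖ : x ^ p ≡ ε
      xᵖ = proj₁ (proj₂ semiregular-element)
      x-free : ∀ ω → act x ω ≢ ω
      x-free = proj₂ (proj₂ semiregular-element)
      h = proj₁ rotation
      h-free : ∀ b → blockAct h b ≢ b
      h-free = proj₂ rotation
      g : Fin 3 → Fin p → El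
      g j i = h ^ toℕ j ∙ x ^ toℕ i
      label-g : ∀ j i ω → label (act (g j i) ω) ≡ iter (blockAct h) (toℕ j) (label ω)
      label-g j i ω = trans (cong label (trans (act-∙ _ _ ω) (act-^ x (toℕ i) _)))
        (trans (iter-preserves (act x) (λ α → label α ≡ label (act (h ^ toℕ j) ω)) (λ α q → trans (preserves-label xᵖ α) q) (toℕ i) _ refl) (label-^ h (toℕ j) ω))
      rotations : ∀ (j j′ : Fin 3) b → iter (blockAct h) (toℕ j) b ≡ iter (blockAct h) (toℕ j′) b → j ≡ j′
      rotations zero zero b e = refl
      rotations zero (suc zero) b e = contradiction (sym e) (h-free b)
      rotations zero (suc (suc zero)) b e = contradiction (sym e) (fixed-point-free² (blockAct-injective h) h-free b)
      rotations (suc zero) zero b e = contradiction e (h-free b)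
      rotations (suc zero) (suc zero) b e = refl
      rotations (suc zero) (suc (suc zero)) b e = contradiction (sym e) (h-free _)
      rotations (suc (suc zero)) zero b e = contradiction e (fixed-point-free² (blockAct-injective h) h-free b)
      rotations (suc (suc zero)) (suc zero) b e = contradiction e (h-free _)
      rotations (suc (suc zero)) (suc (suc zero)) b e = refl
      same : ∀ j i j′ i′ → Agree (g j i) (g j′ i′) → j ≡ j′ × i ≡ i′
      same j i j′ i′ (ω , e) = j≡ , Periodic.iterᶠ-injective (act x) pr (period x p xᵖ) (x-free (act (h ^ toℕ j) ω)) i i′
          (trans (sym (value j i)) (trans e (trans (value j′ i′) (cong (λ j → iter (act x) (toℕ i′) (act (h ^ toℕ j) ω)) (sym j≡)))))
        where
        j≡ = rotations j j′ (label ω) (trans (sym (label-g j i ω)) (trans (cong label e) (label-g j′ i′ ω)))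
        value : ∀ j i → act (g j i) ω ≡ iter (act x) (toℕ i) (act (h ^ toℕ j) ω)
        value j i = trans (act-∙ _ _ ω) (act-^ x (toℕ i) _)
      j : Fin (3 ℕ.* p) → Fin 3
      j k = proj₁ (remQuot {3} p k)
      i : Fin (3 ℕ.* p) → Fin p
      i k = proj₂ (remQuot {3} p k)
      element : Fin (3 ℕ.* p) → El
      element k = g (j k) (i k)
      clique : ∀ k k′ → Agree (element k) (element k′) → k ≡ k′
      clique k k′ agree = let e , e′ = same (j k) (i k) (j k′) (i k′) agree in trans (sym (combine-remQuot {3} p k)) (trans (cong₂ combine e e′) (combine-remQuot {3} p k′))

  -- A translation of the blocks of prime order gives coordinates ℤ/p × ℤ/3.
  module ThreePointBlocks {p} (pr : Prime p) (3<p : 3 < p) {N} {G : FiniteAction N (3 ℕ.* p)} (B : Blocks G p 3) where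
    open FiniteAction G
    open Blocks B
    open BlockTheory B

    P : PrimeField p
    P = primeField pr

    F : PrimeField 3
    F = primeField prime-3

    -- The fields are parameters, so that the concrete modular arithmetic does not unfold in the
    -- goals.
    module Coordinates (P : PrimeField p) (F : PrimeField 3) (t : El) (tᵖ : t ^ p ≡ ε) (t≢ε : t ≢ ε) where
      open Ternary F
      module I = FieldTheory pr P
      open I using () renaming (_+_ to _⊕_; 0# to 𝟎; 1# to 𝟏)

      module Blk = Periodic (blockAct t) pr (block-period t p tᵖ)
      module Pt = Periodic (act t) pr (period t p tᵖ)

      -- A moved block would have p images, hence all p blocks, among them the fixed b. So one fixed
      -- block makes t fix all of them; then the p images of a moved point would lie in one block of
      -- size three.
      t-moves-blocks : ∀ b → blockAct t b ≢ b
      t-moves-blocks b fixed = let ω , moved = moves t≢ε in contradiction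
        (injection-bound (λ (i : Fin p) → iter (act t) (toℕ i) ω) (Pt.iterᶠ-injective moved) (λ α → label α ≟ label ω)
          λ i → trans (label-iter t (toℕ i) ω) (iter-fixed (blockAct t) (all-fixed (label ω)) (toℕ i)))
        (ℕ.<⇒≱ (subst (_< p) (sym (block-size (label ω))) 3<p))
        where
        all-fixed : ∀ c → blockAct t c ≡ c
        all-fixed c with blockAct t c ≟ c
        ... | yes e = e
        ... | no neq =
          let i , e = injective⇒surjective (λ i → iter (blockAct t) (toℕ i) c) (Blk.iterᶠ-injective neq) b
          in  contradiction (Blk.iter-cancel (toℕ i) (trans (iter-suc (blockAct t) (toℕ i) c) (trans (cong (blockAct t) e) (trans fixed (sym e))))) neq

      b₀ : Fin p
      b₀ = label (proj₁ (moves t≢ε))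

      point : Listing (λ α → label α ≡ b₀) 3
      point = subst (Listing (λ α → label α ≡ b₀)) (block-size b₀) (listing (λ α → label α ≟ b₀))

      open Listing point

      -- The points of `b₀` are numbered arbitrarily and t carries the numbering around, so that t
      -- becomes (x, y) ↦ (x + 1, y).
      coord : Fin p → Fin 3 → Fin (3 ℕ.* p)
      coord x y = act (t ^ toℕ x) (at y)

      blockAt : Fin p → Fin p
      blockAt x = iter (blockAct t) (toℕ x) b₀

      label-coord : ∀ x y → label (coord x y) ≡ blockAt x
      label-coord x y = trans (label-^ t (toℕ x) (at y)) (cong (iter (blockAct t) (toℕ x)) (member y))

      blockAt-injective : ∀ x x′ → blockAt x ≡ blockAt x′ → x ≡ x′
      blockAt-injective = Blk.iterᶠ-injective (t-moves-blocks b₀)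

      coord-injective : ∀ x x′ y y′ → coord x y ≡ coord x′ y′ → x ≡ x′ × y ≡ y′
      coord-injective x x′ y y′ e = x≡ , injective y y′ (act-injective (t ^ toℕ x) (trans e (cong (λ x → coord x y′) (sym x≡))))
        where
        x≡ : x ≡ x′
        x≡ = blockAt-injective x x′ (trans (sym (label-coord x y)) (trans (cong label e) (label-coord x′ y′)))

      coord-surjective : ∀ ω → ∃ λ x → ∃ λ y → coord x y ≡ ω
      coord-surjective ω =
        let x , e = injective⇒surjective blockAt blockAt-injective (label ω)
            α = act ((t ^ toℕ x) ⁻¹) ω
            in-b₀ : label α ≡ b₀
            in-b₀ = trans (invariant⁻ (t ^ toℕ x) (trans (cong label (act-⁻¹ʳ (t ^ toℕ x) ω)) (trans (sym e) (sym (label-coord x zero))))) (member zero)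
        in  x , index α in-b₀ , trans (cong (act (t ^ toℕ x)) (at-index α in-b₀)) (act-⁻¹ʳ (t ^ toℕ x) ω)

      X : Fin (3 ℕ.* p) → Fin p
      X ω = proj₁ (coord-surjective ω)

      Y : Fin (3 ℕ.* p) → Fin 3
      Y ω = proj₁ (proj₂ (coord-surjective ω))

      coord-XY : ∀ ω → coord (X ω) (Y ω) ≡ ω
      coord-XY ω = proj₂ (proj₂ (coord-surjective ω))

      X-coord : ∀ x y → X (coord x y) ≡ x
      X-coord x y = proj₁ (coord-injective (X (coord x y)) x (Y (coord x y)) y (coord-XY (coord x y)))

      Y-coord : ∀ x y → Y (coord x y) ≡ y
      Y-coord x y = proj₂ (coord-injective (X (coord x y)) x (Y (coord x y)) y (coord-XY (coord x y)))

      X-label : ∀ {ω ω′} → label ω ≡ label ω′ → X ω ≡ X ω′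
      X-label {ω} {ω′} e = blockAt-injective _ _ (trans (sym (label-coord (X ω) (Y ω))) (trans (cong label (coord-XY ω))
        (trans e (trans (cong label (sym (coord-XY ω′))) (label-coord (X ω′) (Y ω′))))))

      distinct-sum : ∀ x y z → x ≢ y → x ≢ z → y ≢ z → x + y + z ≡ 0#
      distinct-sum x y z x≢y x≢z y≢z = by-cases (three-elements x) (three-elements y) (three-elements z)
        where
        Value : Fin 3 → Set
        Value x = x ≡ 0# ⊎ x ≡ 1# ⊎ x ≡ - 1#
        o+i+m : 0# + 1# + - 1# ≡ 0#
        o+i+m = trans (cong (_+ - 1#) (+-identityˡ 1#)) (-‿inverseʳ 1#)
        by-cases : Value x → Value y → Value z → x + y + z ≡ 0#
        by-cases (inj₁ a)        (inj₁ b)        _ = contradiction (trans a (sym b)) x≢y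
        by-cases (inj₂ (inj₁ a)) (inj₂ (inj₁ b)) _ = contradiction (trans a (sym b)) x≢y
        by-cases (inj₂ (inj₂ a)) (inj₂ (inj₂ b)) _ = contradiction (trans a (sym b)) x≢y
        by-cases (inj₁ a)        _ (inj₁ b)        = contradiction (trans a (sym b)) x≢z
        by-cases (inj₂ (inj₁ a)) _ (inj₂ (inj₁ b)) = contradiction (trans a (sym b)) x≢z
        by-cases (inj₂ (inj₂ a)) _ (inj₂ (inj₂ b)) = contradiction (trans a (sym b)) x≢z
        by-cases _ (inj₁ a)        (inj₁ b)        = contradiction (trans a (sym b)) y≢z
        by-cases _ (inj₂ (inj₁ a)) (inj₂ (inj₁ b)) = contradiction (trans a (sym b)) y≢z
        by-cases _ (inj₂ (inj₂ a)) (inj₂ (inj₂ b)) = contradiction (trans a (sym b)) y≢z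
        by-cases (inj₁ a) (inj₂ (inj₁ b)) (inj₂ (inj₂ c)) = trans (cong₂ _+_ (cong₂ _+_ a b) c) o+i+m
        by-cases (inj₁ a) (inj₂ (inj₂ b)) (inj₂ (inj₁ c)) = trans (solve 3 (λ x y z → x :+ y :+ z := x :+ z :+ y) refl x y z) (trans (cong₂ _+_ (cong₂ _+_ a c) b) o+i+m)
        by-cases (inj₂ (inj₁ a)) (inj₁ b) (inj₂ (inj₂ c)) = trans (solve 3 (λ x y z → x :+ y :+ z := y :+ x :+ z) refl x y z) (trans (cong₂ _+_ (cong₂ _+_ b a) c) o+i+m)
        by-cases (inj₂ (inj₁ a)) (inj₂ (inj₂ b)) (inj₁ c) = trans (solve 3 (λ x y z → x :+ y :+ z := z :+ x :+ y) refl x y z) (trans (cong₂ _+_ (cong₂ _+_ c a) b) o+i+m)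
        by-cases (inj₂ (inj₂ a)) (inj₁ b) (inj₂ (inj₁ c)) = trans (solve 3 (λ x y z → x :+ y :+ z := y :+ z :+ x) refl x y z) (trans (cong₂ _+_ (cong₂ _+_ b c) a) o+i+m)
        by-cases (inj₂ (inj₂ a)) (inj₂ (inj₁ b)) (inj₁ c) = trans (solve 3 (λ x y z → x :+ y :+ z := z :+ y :+ x) refl x y z) (trans (cong₂ _+_ (cong₂ _+_ c b) a) o+i+m)

      -- The three values of σ are distinct and sum to 0. The value at -1 is thereby determined by
      -- those at 0 and 1, in the same way as for an affine map, since 3 = 0.
      permutation-affine : ∀ (σ : Fin 3 → Fin 3) → (∀ a b → σ a ≡ σ b → a ≡ b) → ∀ y → σ y ≡ σ 0# + (σ 1# - σ 0#) * y
      permutation-affine σ inj y = by-cases (three-elements y)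
        where
        at-0 : ∀ a b → a + (b - a) * 0# ≡ a
        at-0 a b = trans (cong (a +_) (zeroʳ _)) (+-identityʳ a)
        at-1 : ∀ a b → a + (b - a) * 1# ≡ b
        at-1 a b = trans (cong (a +_) (*-identityʳ _)) (solve 2 (λ a b → a :+ (b :- a) := b) refl a b)
        total : σ 0# + σ 1# + σ (- 1#) ≡ 0#
        total = distinct-sum _ _ _ (λ e → 1≢0 (sym (inj _ _ e))) (λ e → -1≢0 (sym (inj _ _ e))) (λ e → -1≢1 (sym (inj _ _ e)))
        at--1 : σ (- 1#) ≡ σ 0# + (σ 1# - σ 0#) * - 1#
        at--1 = begin
          σ (- 1#)
            ≡⟨ solve 3 (λ a b c → c := (a :+ b :+ c) :+ (a :- (b :- a)) :- (a :+ a :+ a)) refl (σ 0#) (σ 1#) (σ (- 1#)) ⟩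
          (σ 0# + σ 1# + σ (- 1#)) + (σ 0# - (σ 1# - σ 0#)) - (σ 0# + σ 0# + σ 0#)
            ≡⟨ cong₂ (λ u v → u + (σ 0# - (σ 1# - σ 0#)) - v) total (triple (σ 0#)) ⟩
          0# + (σ 0# - (σ 1# - σ 0#)) - 0#
            ≡⟨ trans (cong (_- 0#) (+-identityˡ _)) (solve 1 (λ a → a :- con (+ℤ 0) := a) refl _) ⟩
          σ 0# - (σ 1# - σ 0#)
            ≡⟨ cong (λ z → σ 0# - z) (*-identityʳ (σ 1# - σ 0#)) ⟨
          σ 0# - (σ 1# - σ 0#) * 1#
            ≡⟨ solve 3 (λ a b o → a :- b :* o := a :+ b :* (:- o)) refl (σ 0#) (σ 1# - σ 0#) 1# ⟩
          σ 0# + (σ 1# - σ 0#) * - 1# ∎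
          where open ≡-Reasoning
        by-cases : y ≡ 0# ⊎ y ≡ 1# ⊎ y ≡ - 1# → σ y ≡ σ 0# + (σ 1# - σ 0#) * y
        by-cases (inj₁ refl)        = sym (at-0 (σ 0#) (σ 1#))
        by-cases (inj₂ (inj₁ refl)) = sym (at-1 (σ 0#) (σ 1#))
        by-cases (inj₂ (inj₂ refl)) = at--1

      π : El → Fin p → Fin p
      π g x = X (act g (coord x 0#))

      σ : El → Fin p → Fin 3 → Fin 3
      σ g x y = Y (act g (coord x y))

      act-σ : ∀ g x y → act g (coord x y) ≡ coord (π g x) (σ g x y)
      act-σ g x y = trans (sym (coord-XY _)) (cong (λ x′ → coord x′ (σ g x y)) (X-label (invariant g (trans (label-coord x y) (sym (label-coord x 0#))))))

      σ-injective : ∀ g x a b → σ g x a ≡ σ g x b → a ≡ b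
      σ-injective g x a b e = proj₂ (coord-injective x x a b (act-injective g (trans (act-σ g x a) (trans (cong (coord (π g x)) e) (sym (act-σ g x b))))))

      private
        ordered : ∀ {a b ω} → a ≤ b → I.[ a ] ≡ I.[ b ] → iter (act t) b ω ≡ iter (act t) a ω
        ordered {a} {b} {ω} a≤b e = difference (I.[]-0 (b ∸ a) (begin
          I.[ b ∸ a ]                    ≡⟨ I.solve 2 (λ d a → d I.:= (a I.:+ d) I.:- a) refl I.[ b ∸ a ] I.[ a ] ⟩
          I.[ a ] ⊕ I.[ b ∸ a ] I.- I.[ a ]  ≡⟨ cong (I._- I.[ a ]) (trans (sym (I.[]-+ a (b ∸ a))) (trans (cong I.[_] (ℕ.m+[n∸m]≡n a≤b)) (sym e))) ⟩
          I.[ a ] I.- I.[ a ]            ≡⟨ I.-‿inverseʳ _ ⟩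
          𝟎                              ∎))
          where
          open ≡-Reasoning
          difference : p ∣ b ∸ a → iter (act t) b ω ≡ iter (act t) a ω
          difference (divides q eq) = trans (cong (λ k → iter (act t) k ω) (trans (sym (ℕ.m+[n∸m]≡n a≤b)) (cong (a ℕ.+_) eq)))
            (trans (iter-+ (act t) a (q ℕ.* p) ω) (iter-* (act t) (period t p tᵖ _) q))

      iter-mod : ∀ a b ω → I.[ a ] ≡ I.[ b ] → iter (act t) a ω ≡ iter (act t) b ω
      iter-mod a b ω e with ℕ.≤-total a b
      ... | inj₁ a≤b = sym (ordered a≤b e)
      ... | inj₂ b≤a = ordered b≤a (sym e)

      act-t : ∀ x y → act t (coord x y) ≡ coord (x ⊕ 𝟏) y
      act-t x y = begin
        act t (act (t ^ toℕ x) (at y))         ≡⟨ cong (act t) (act-^ t (toℕ x) (at y)) ⟩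
        act t (iter (act t) (toℕ x) (at y))    ≡⟨ iter-suc (act t) (toℕ x) (at y) ⟨
        iter (act t) (suc (toℕ x)) (at y)      ≡⟨ iter-mod (suc (toℕ x)) (toℕ (x ⊕ 𝟏)) (at y) (trans (I.[suc] (toℕ x)) (trans (cong (_⊕ 𝟏) (I.[]-toℕ x)) (sym (I.[]-toℕ (x ⊕ 𝟏))))) ⟩
        iter (act t) (toℕ (x ⊕ 𝟏)) (at y)      ≡⟨ act-^ t (toℕ (x ⊕ 𝟏)) (at y) ⟨
        coord (x ⊕ 𝟏) y                        ∎
        where open ≡-Reasoning

      σ-t : ∀ x y → σ t x y ≡ y
      σ-t x y = trans (cong Y (act-t x y)) (Y-coord (x ⊕ 𝟏) y)

      wreath : Wreath pr P F G
      wreath = record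
        { 3<p = 3<p
        ; transitive = transitive
        ; coord = coord ; coord-injective = λ {x} {x′} {y} {y′} → coord-injective x x′ y y′ ; coord-surjective = coord-surjective
        ; π = π
        ; τ = λ g x → σ g x 0#
        ; s = λ g x → σ g x 1# - σ g x 0#
        ; s≢0 = λ g x e → 1≢0 (σ-injective g x _ _ (x-y≡0⇒x≡y e))
        ; act-coord = λ g x y → trans (act-σ g x y) (cong (coord (π g x)) (permutation-affine (σ g x) (σ-injective g x) y))
        ; t = t
        ; π-t = λ x → trans (cong X (act-t x 0#)) (X-coord (x ⊕ 𝟏) 0#)
        ; τ-t = λ x → σ-t x 0#
        ; s-t = λ x → trans (cong₂ _-_ (σ-t x 1#) (σ-t x 0#)) (solve 1 (λ o → o :- con (+ℤ 0) := o) refl 1#)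
        ; links = λ y →
            let g , preserves , e = link (trans (label-coord 𝟎 0#) (sym (label-coord 𝟎 y)))
            in  g , (λ x → trans (X-label (preserves (coord x 0#))) (X-coord x 0#)) , trans (cong Y e) (Y-coord 𝟎 y)
        }

    three-point-blocks-density : Fin (3 ℕ.* p) → Density1-3/2-3
    three-point-blocks-density ω =
      let t , tᵖ , t≢ε = cauchy G pr (subst (p ∣_) (orbit-stabiliser transitive ω) (∣-trans (n∣m*n 3) (m∣m*n _)))
      in  WreathTheory.wreath-density (Coordinates.wreath P F t tᵖ t≢ε)

-- Orbits of an intransitive normal subgroup and the conclusion.

module NormalSubgroups where

  open import Defs
  open Counting
  open FinGroup
  open Cauchy
  open PermAction
  open CyclicCode using (prime-3)
  open BlockSystems
  open import Data.Fin using (Fin; zero; _≟_)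
  open import Data.Fin.Properties using (any?)
  open import Data.List.Membership.Propositional using (_∈_)
  open import Data.Nat using (ℕ; zero; _≤_; _<_; NonZero)
  import Data.Nat as ℕ
  import Data.Nat.Properties as ℕ
  open import Data.Nat.Divisibility using (_∣_; divides)
  open import Data.Nat.Primality using (Prime; prime⇒nonZero; euclidsLemma; prime⇒irreducible)
  open import Data.Product using (∃; _,_; _×_; proj₁; proj₂)
  open import Data.Sum using (_⊎_; inj₁; inj₂)
  open import Data.Vec using (lookup)
  open import Data.Vec.Properties using (≡-dec; lookup∘tabulate)
  open import Level using (0ℓ)
  open import Relation.Binary.Core using (Rel)
  open import Relation.Binary.Structures using (IsEquivalence)
  open import Relation.Binary.PropositionalEquality
  open import Relation.Nullary using (yes; no; ¬_; contradiction; ¬?; _×-dec_)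
  open import Relation.Unary using (Pred; Decidable)

  -- Euclid's lemma puts p into one of the two factors; the cofactor then divides 3 and is not 1.
  factorisations-of-3p : ∀ {p} → Prime p → ∀ m k → m ℕ.* k ≡ 3 ℕ.* p → m ≢ 1 → k ≢ 1 → (m ≡ 3 × k ≡ p) ⊎ (m ≡ p × k ≡ 3)
  factorisations-of-3p {p} pr m k e m≢1 k≢1 with euclidsLemma m k pr (divides 3 e)
  ... | inj₁ p∣m = inj₂ (factor k m (trans (ℕ.*-comm k m) e) k≢1 p∣m)
    where
    factor : ∀ k m → k ℕ.* m ≡ 3 ℕ.* p → k ≢ 1 → p ∣ m → m ≡ p × k ≡ 3
    factor k _ e k≢1 (divides q refl) = by-cases (prime⇒irreducible prime-3 {k} (divides q (trans (sym kq) (ℕ.*-comm k q))))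
      where
      instance
        p≢0 : NonZero p
        p≢0 = prime⇒nonZero pr
      kq : k ℕ.* q ≡ 3
      kq = ℕ.*-cancelʳ-≡ _ _ p (trans (ℕ.*-assoc k q p) e)
      by-cases : k ≡ 1 ⊎ k ≡ 3 → q ℕ.* p ≡ p × k ≡ 3
      by-cases (inj₁ k≡1)  = contradiction k≡1 k≢1
      by-cases (inj₂ refl) = trans (cong (ℕ._* p) (ℕ.*-cancelˡ-≡ q 1 3 kq)) (ℕ.*-identityˡ p) , refl
  ... | inj₂ (divides q refl) = inj₁ (by-cases (prime⇒irreducible prime-3 {m} (divides q (trans (sym mq) (ℕ.*-comm m q)))))
    where
    instance
      p≢0 : NonZero p
      p≢0 = prime⇒nonZero pr
    mq : m ℕ.* q ≡ 3
    mq = ℕ.*-cancelʳ-≡ _ _ p (trans (ℕ.*-assoc m q p) e)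
    by-cases : m ≡ 1 ⊎ m ≡ 3 → m ≡ 3 × q ℕ.* p ≡ p
    by-cases (inj₁ m≡1)  = contradiction m≡1 m≢1
    by-cases (inj₂ refl) = refl , trans (cong (ℕ._* p) (ℕ.*-cancelˡ-≡ q 1 3 mq)) (ℕ.*-identityˡ p)

  module NormalOrbits {N n} (G : FiniteAction N n) (transitive : FiniteAction.Transitiveᵃ G) {K : Pred (Fin N) 0ℓ} (K? : Decidable K)
    (subgroup : Subgroup G K) (normal : ∀ g {x} → K x → K (FiniteAction.conj G g x)) where

    open FiniteAction G
    open Subgroup subgroup

    _~_ : Rel (Fin n) 0ℓ
    α ~ β = ∃ λ x → K x × act x α ≡ β

    ~-equivalence : IsEquivalence _~_
    ~-equivalence = record
      { refl  = λ {α} → ε , ε∈ , act-ε α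
      ; sym   = λ { {α} (x , Kx , refl) → x ⁻¹ , ⁻¹∈ Kx , act-⁻¹ˡ x α }
      ; trans = λ { {α} (x , Kx , refl) (y , Ky , refl) → x ∙ y , ∙∈ Kx Ky , act-∙ x y α } }

    open Quotient (quotient ~-equivalence (λ α β → any? λ x → K? x ×-dec (act x α ≟ β))) public

    invariant : ∀ g {α β} → label α ≡ label β → label (act g α) ≡ label (act g β)
    invariant g {α} e = let x , Kx , eq = exact e in sound (conj g x , normal g Kx , trans (act-conj g x α) (cong (act g) eq))

    size-of : Fin classes → ℕ
    size-of b = count (λ α → label α ≟ b)

    -- Some element of the transitive group carries a point of b to a point of c, and by invariance
    -- it maps the whole of b injectively into c.
    size-≤ : ∀ b c → size-of b ≤ size-of c
    size-≤ b c = let g , e = transitive (rep b) (rep c) in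
      count-image (λ α → label α ≟ b) (λ α → label α ≟ c) (act g)
        (λ α eq → trans (invariant g (trans eq (sym (label-rep b)))) (trans (cong label e) (label-rep c)))
        (λ α β _ _ → act-injective g)

    module _ (ω : Fin n) where

      k : ℕ
      k = size-of (label ω)

      blocks : Blocks G classes k
      blocks = record
        { transitive = transitive ; label = label ; rep = rep ; label-rep = label-rep ; invariant = invariant
        ; block-size = λ b → ℕ.≤-antisym (size-≤ b (label ω)) (size-≤ (label ω) b)
        ; link = λ e → let x , Kx , eq = exact e in x , (λ α → sym (sound (x , Kx , refl))) , eq }

      classes*k : classes ℕ.* k ≡ n
      classes*k = begin
        classes ℕ.* k                                           ≡⟨ sum-const classes k ⟨
        ∑[ b < classes ] k                                      ≡⟨ sum-cong-≗ {classes} (λ b → Blocks.block-size blocks b) ⟨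
        ∑[ b < classes ] ∑[ α < n ] 𝟙 (label α ≟ b)             ≡⟨ ∑-comm (λ b α → 𝟙 (label α ≟ b)) ⟩
        ∑[ α < n ] (count λ b → label α ≟ b)                    ≡⟨ sum-cong-≗ {n} (λ α → count-unique (λ b → label α ≟ b) (label α) refl λ b e → sym e) ⟩
        ∑[ α < n ] 1                                            ≡⟨ trans (sum-const n 1) (ℕ.*-identityʳ n) ⟩
        n                                                       ∎
        where open ≡-Reasoning

      classes≢1 : ¬ (∀ α β → α ~ β) → classes ≢ 1
      classes≢1 intransitive e = intransitive λ α β → exact (all-equal e (label α) (label β))
        where
        all-equal : ∀ {m} → m ≡ 1 → (a b : Fin m) → a ≡ b
        all-equal refl zero zero = refl

      k≢1 : ∀ {x α} → K x → act x α ≢ α → k ≢ 1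
      k≢1 {x} {α} Kx moved e = moved (two-equal (sym (sound (x , Kx , refl))) refl)
        where
        size-1 : size-of (label α) ≡ 1
        size-1 = trans (Blocks.block-size blocks (label α)) e
        two-equal : ∀ {β γ} → label β ≡ label α → label γ ≡ label α → β ≡ γ
        two-equal {β} {γ} eβ eγ with β ≟ γ
        ... | yes eq = eq
        ... | no neq = contradiction (count-< (λ δ → (label δ ≟ label α) ×-dec (δ ≟ β)) (λ δ → label δ ≟ label α) (λ _ → proj₁) γ eγ λ (_ , eq) → neq (sym eq))
          (ℕ.≤⇒≯ (ℕ.≤-trans (ℕ.≤-reflexive size-1) (count-positive (λ δ → (label δ ≟ label α) ×-dec (δ ≟ β)) β (eβ , refl))))

  module _ {p} (pr : Prime p) (5≤p : 5 ≤ p) {N} (G : FiniteAction N (3 ℕ.* p)) where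
    open FiniteAction G

    intransitive-normal-density : Transitiveᵃ → {K : Pred El 0ℓ} → Decidable K → Subgroup G K → (∀ g {x} → K x → K (conj g x)) →
      (∃ λ x → K x × ∃ λ α → act x α ≢ α) → ¬ (∀ α β → ∃ λ x → K x × act x α ≡ β) → Density1-3/2-3
    intransitive-normal-density transitive K? subgroup normal (x , Kx , α , moved) intransitive =
      by-cases (factorisations-of-3p pr classes (k α) (classes*k α) (classes≢1 α intransitive) (k≢1 α Kx moved))
      where
      open NormalOrbits G transitive K? subgroup normal
      3<p : 3 < p
      3<p = ℕ.<⇒≤ 5≤p
      by-cases : (classes ≡ 3 × k α ≡ p) ⊎ (classes ≡ p × k α ≡ 3) → Density1-3/2-3
      by-cases (inj₁ (e , e′)) = inj₁ (ThreeBlocks.three-blocks-density pr 3<p (subst₂ (Blocks G) e e′ (blocks α)))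
      by-cases (inj₂ (e , e′)) = ThreePointBlocks.three-point-blocks-density pr 3<p (subst₂ (Blocks G) e e′ (blocks α)) α

  rho-of-intransitive-normal : ∀ {p} → Prime p → 5 ≤ p → (G : PermGroup (3 ℕ.* p)) → Transitive G →
    (N : PermGroup (3 ℕ.* p)) → Normal N G → ¬ Trivial N → ¬ Transitive N → RhoIn1-3/2-3 G
  rho-of-intransitive-normal {p} pr 5≤p G transitive N (N≤G , normal) nontrivial intransitive =
    rho G (intransitive-normal-density pr 5≤p (action G) (transitiveᵃ G transitive) K? subgroup conjugate moving intransitiveᵃ)
    where
    n = 3 ℕ.* p
    open FiniteAction (action G)
    module Nᵃ = FiniteAction (action N)
    open import Data.List.Membership.DecPropositional (≡-dec {n = n} _≟_) using (_∈?_)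

    K : Pred El 0ℓ
    K x = perm G x ∈ elems N

    K? : Decidable K
    K? x = perm G x ∈? elems N

    fromN : ∀ {y} → y ∈ elems N → ∃ λ x → perm G x ≡ y
    fromN y∈ = position G (N≤G y∈) , perm-position G (N≤G y∈)

    perm-∙ : ∀ x y → perm G (x ∙ y) ≡ perm G x · perm G y
    perm-∙ x y = perm-position G (closed G (perm∈ G x) (perm∈ G y))

    subgroup : Subgroup (action G) K
    subgroup = record
      { ε∈  = subst (_∈ elems N) (sym (perm-position G (hasId G))) (hasId N)
      ; ∙∈  = λ {x} {y} Kx Ky → subst (_∈ elems N) (sym (perm-∙ x y)) (closed N Kx Ky)
      ; ⁻¹∈ = inverse∈ }
      where
      inverse∈ : ∀ {x} → K x → K (x ⁻¹)
      -- The inverse is taken inside N and read as an element y of G. There it is a left inverse of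
      -- x, hence equal to `x ⁻¹`.
      inverse∈ {x} Kx = subst (_∈ elems N) (trans (sym e) (cong (perm G) y≡x⁻¹)) (perm∈ N i)
        where
        i = position N Kx Nᵃ.⁻¹
        y = proj₁ (fromN (perm∈ N i))
        e = proj₂ (fromN (perm∈ N i))
        y∙x≡ε : y ∙ x ≡ ε
        y∙x≡ε = faithful λ ω → begin
          act (y ∙ x) ω                              ≡⟨ act-∙ y x ω ⟩
          lookup (perm G x) (lookup (perm G y) ω)    ≡⟨ cong₂ (λ g h → lookup g (lookup h ω)) (sym (perm-position N Kx)) e ⟩
          Nᵃ.act (position N Kx) (Nᵃ.act i ω)        ≡⟨ Nᵃ.act-⁻¹ʳ (position N Kx) ω ⟩
          ω                                          ≡⟨ act-ε ω ⟨
          act ε ω                                    ∎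
          where open ≡-Reasoning
        y≡x⁻¹ : y ≡ x ⁻¹
        y≡x⁻¹ = ∙-cancelʳ x y (x ⁻¹) (trans y∙x≡ε (sym (inverseˡ x)))

    conjugate : ∀ g {x} → K x → K (conj g x)
    conjugate g {x} Kx =
      let y , y∈ , xg≡gy = normal (perm∈ G g) Kx
          z , e = fromN y∈
          x∙g≡g∙z : x ∙ g ≡ g ∙ z
          x∙g≡g∙z = perm-injective G (trans (perm-∙ x g) (trans xg≡gy (trans (cong (perm G g ·_) (sym e)) (sym (perm-∙ g z)))))
          conj≡z : conj g x ≡ z
          conj≡z = ∙-cancelˡ g _ z (trans (sym (assoc g _ g)) (trans (cong (_∙ g) (trans (sym (assoc g (g ⁻¹) x)) (trans (cong (_∙ x) (inverseʳ g)) (identityˡ x)))) x∙g≡g∙z))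
      in  subst K (sym conj≡z) (subst (_∈ elems N) (sym e) y∈)

    moving : ∃ λ x → K x × ∃ λ α → act x α ≢ α
    moving with any? (λ x → K? x ×-dec any? λ α → ¬? (act x α ≟ α))
    ... | yes found = found
    ... | no none   = contradiction (λ {y} y∈ → trivial y∈) nontrivial
      where
      fixed : ∀ x → K x → ∀ α → act x α ≡ α
      fixed x Kx α with act x α ≟ α
      ... | yes e = e
      ... | no neq = contradiction (x , Kx , α , neq) none
      trivial : ∀ {y} → y ∈ elems N → y ≡ idP n
      trivial y∈ = let x , e = fromN y∈ in trans (sym e) (perm-ext λ α →
        trans (fixed x (subst (_∈ elems N) (sym e) y∈) α) (sym (lookup∘tabulate (λ i → i) α)))

    intransitiveᵃ : ¬ (∀ α β → ∃ λ x → K x × act x α ≡ β)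
    intransitiveᵃ tr = intransitive λ α β → let x , Kx , e = tr α β in perm G x , Kx , e

open NormalSubgroups using (rho-of-intransitive-normal)
open import Defs
open import Data.Nat using (ℕ; _≤_; _*_; _+_)
open import Data.Nat.Primality using (Prime)
open import Data.Fin using (Fin)
open import Data.Product using (_×_; ∃-syntax; _,_)
open import Data.Sum using (_⊎_; inj₁)
open import Relation.Nullary using (¬_)
open import Relation.Binary.PropositionalEquality using (_≡_)

theorem1p4 : (∀ (p : ℕ) → Prime p → 5 ≤ p →
    (G : PermGroup (3 * p)) → Transitive G →
    (N : PermGroup (3 * p)) → Normal N G → ¬ Trivial N → ¬ Transitive N →
    (m : ℕ) (β : Fin (3 * p) → Fin m) → OrbitLabeling N β →
    (Gbar : PermGroup m) → Induced G β Gbar →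
    (Solvable Gbar → RhoIn1-3/2-3 G) ×
    (TwoTransitive Gbar →
    RhoIn1-3/2-3 G ⊎
    ∃[ q ] (IsPrimePower q × p ≡ q + 1 × FermatPrime p × AlmostSimple Gbar × ContainsPSL2 q Gbar)))
    ×
    (∀ (p : ℕ) → Prime p → 5 ≤ p → ¬ FermatPrime p →
    (G : PermGroup (3 * p)) → Transitive G → Imprimitive G → NotQuasiprimitive G →
    RhoIn1-3/2-3 G)
theorem1p4 =
    (λ p pr 5≤p G tr N normal nontrivial intransitive _ _ _ _ _ →
      let rho-G = rho-of-intransitive-normal pr 5≤p G tr N normal nontrivial intransitive in (λ _ → rho-G) , λ _ → inj₁ rho-G)
  , λ p pr 5≤p _ G tr _ (N , normal , nontrivial , intransitive) → rho-of-intransitive-normal pr 5≤p G tr N normal nontrivial intransitive
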